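{- Let $m=m_n\ge 1$ and $d=d_n$ be integers with $2\le d\le n$ and $m \ll \binom{n}{d}^{1/2}$. Let $H_{nmd}$ be a hypergraph sampled uniformly at random from the set of hypergraphs on node set $\{1,\dots,n\}$ having exactly $m$ distinct hyperedges, each of size $d$. Then, as $n\to\infty$, \[ \mathbb{P}(H_{nmd} \text{ is connected}) \to \begin{cases} 0 & \text{if } \log n + m\log(1-d/n) \to +\infty,\\ 1 & \text{if } \log n + m\log(1-d/n) \to -\infty.\end{cases} \]
   Context: A hypergraph on node set $V$ is a collection of nonempty subsets (hyperedges) of $V$; it is connected if for every partition of $V$ into nonempty sets $V_1,V_2$ some hyperedge meets both $V_1$ and $V_2$. $a_n\ll b_n$ means $a_n/|b_n|\to0$. The convention $\log 0 = -\infty$ is used. -}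

module Defs where

import Algebra.Definitions.RawSemiring
open import Data.Bool.Properties using () renaming (_≟_ to _≟ᵇ_)
open import Data.Fin.Subset using (Subset; Nonempty; inside; outside; ⊤; ⊥; _∪_; _∩_; ∣_∣)
open import Data.Fin.Subset.Properties using (nonempty?; anySubset?)
open import Data.Integer.Base using (+_)
open import Data.List.Base using (List; []; _∷_; _++_; map; filter; length)
open import Data.List.Relation.Unary.All using (All; all?)
open import Data.List.Relation.Unary.Any using (Any; any?)
open import Data.Nat.Base as ℕ using (ℕ; zero; suc)
import Data.Nat.Properties as ℕ
open import Data.Product.Base using (∃; _×_; _,_)
open import Data.Rational.Base using (ℚ; 0ℚ; 1ℚ; _+_; _-_; _*_; -_; _/_; _<_; _≤_; +-*-rawSemiring)
open import Data.Sum.Base using (_⊎_)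
open import Data.Vec.Base using ([]; _∷_)
open import Data.Vec.Properties using (≡-dec)
open import Relation.Binary.PropositionalEquality using (_≡_)
open import Relation.Nullary.Decidable using (Dec; map′; ¬?; _×-dec_; _→-dec_; decidable-stable)
open import Relation.Unary using (Decidable)

open Algebra.Definitions.RawSemiring +-*-rawSemiring using (_^_)

fromℕ : ℕ → ℚ
fromℕ n = + n / 1

-- Totalised by a ÷ 0 = 0.
infixl 7 _÷_
_÷_ : ℕ → ℕ → ℚ
a ÷ zero    = 0ℚ
a ÷ (suc b) = + a / suc b

Eventually : (ℕ → Set) → Set
Eventually P = ∃ λ N → ∀ n → N ℕ.≤ n → P n

-- An extended real x is given by its two open cuts,
-- lower x = { q ∣ q < x } and upper x = { q ∣ x < q }.
-- In particular -∞ has lower cut empty and upper cut all of ℚ.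
-- The Dedekind axioms are not part of the record.
record Cut : Set₁ where
  field
    lower : ℚ → Set
    upper : ℚ → Set

open Cut public

fromℚ : ℚ → Cut
fromℚ x .lower q = q < x
fromℚ x .upper q = x < q

infixl 6 _+ᶜ_
_+ᶜ_ : Cut → Cut → Cut
(x +ᶜ y) .lower q = ∃ λ a → ∃ λ b → lower x a × lower y b × q ≡ a + b
(x +ᶜ y) .upper q = ∃ λ a → ∃ λ b → upper x a × upper y b × q ≡ a + b

infixl 7 _·ᶜ_
_·ᶜ_ : ℕ → Cut → Cut
zero  ·ᶜ x = fromℚ 0ℚ
suc k ·ᶜ x = x +ᶜ k ·ᶜ x

∣_∣ᶜ : Cut → Cut
∣ x ∣ᶜ .lower q = lower x q ⊎ upper x (- q)
∣ x ∣ᶜ .upper q = upper x q × lower x (- q)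

-- Quotient by a positive finite y:  q < x / y  iff  q y < x.  Bounding y on
-- both sides, 0 < r < y < t, makes the formula correct for either sign of q.
infixl 7 _/ᶜ_
_/ᶜ_ : Cut → Cut → Cut
(x /ᶜ y) .lower q = ∃ λ r → ∃ λ t → ∃ λ s →
  0ℚ < r × lower y r × upper y t × lower x s × q * r ≤ s × q * t ≤ s
(x /ᶜ y) .upper q = ∃ λ r → ∃ λ t → ∃ λ s →
  0ℚ < r × lower y r × upper y t × upper x s × s ≤ q * r × s ≤ q * t

-- For 0 ≤ x.
√_ : ℚ → Cut
(√ x) .lower q = q < 0ℚ ⊎ q * q < x
(√ x) .upper q = 0ℚ < q × x < q * q

-- The limit of a convergent sequence of rationals.
lim : (ℕ → ℚ) → Cut
lim s .lower q = ∃ λ r → q < r × Eventually (λ n → r ≤ s n)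
lim s .upper q = ∃ λ r → r < q × Eventually (λ n → s n ≤ r)

exp : ℚ → Cut
exp q = lim λ n → (1ℚ + q * (1 ÷ n)) ^ n

-- The inverse of exp:  q < log x  iff  exp q < x,  and  log x < q  iff  x < exp q.
-- At x = 0 this gives -∞.
log : ℚ → Cut
log x .lower q = upper (exp q) x
log x .upper q = lower (exp q) x

infix 4 _⟶_ _⟶+∞ _⟶-∞ _≪_

_⟶_ : (ℕ → Cut) → ℚ → Set
u ⟶ ℓ = ∀ ε → 0ℚ < ε → Eventually λ n → lower (u n) (ℓ - ε) × upper (u n) (ℓ + ε)

_⟶+∞ : (ℕ → Cut) → Set
u ⟶+∞ = ∀ K → Eventually λ n → lower (u n) K

_⟶-∞ : (ℕ → Cut) → Set
u ⟶-∞ = ∀ K → Eventually λ n → upper (u n) K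

_≪_ : (ℕ → Cut) → (ℕ → Cut) → Set
a ≪ b = (λ n → a n /ᶜ ∣ b n ∣ᶜ) ⟶ 0ℚ

-- The list of hyperedges, on node set Fin n. Every set of nonempty subsets occurs exactly once in
-- allHypergraphs n, as a sublist of a fixed enumeration without repetitions.
Hypergraph : ℕ → Set
Hypergraph n = List (Subset n)

allSubsets : ∀ n → List (Subset n)
allSubsets zero    = [] ∷ []
allSubsets (suc n) = map (inside ∷_) (allSubsets n) ++ map (outside ∷_) (allSubsets n)

sublists : ∀ {A : Set} → List A → List (List A)
sublists []       = [] ∷ []
sublists (x ∷ xs) = map (x ∷_) (sublists xs) ++ sublists xs

allHypergraphs : ∀ n → List (Hypergraph n)
allHypergraphs n = sublists (filter nonempty? (allSubsets n))

HasShape : ∀ {n} → ℕ → ℕ → Hypergraph n → Set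
HasShape m d H = length H ≡ m × All (λ e → ∣ e ∣ ≡ d) H

hasShape? : ∀ {n} m d → Decidable (HasShape {n} m d)
hasShape? m d H = (length H ℕ.≟ m) ×-dec all? (λ e → ∣ e ∣ ℕ.≟ d) H

hypergraphs : ∀ n → ℕ → ℕ → List (Hypergraph n)
hypergraphs n m d = filter (hasShape? m d) (allHypergraphs n)

Connected : ∀ {n} → Hypergraph n → Set
Connected {n} H = ∀ (V₁ V₂ : Subset n) →
  Nonempty V₁ × Nonempty V₂ × V₁ ∪ V₂ ≡ ⊤ × V₁ ∩ V₂ ≡ ⊥ →
  Any (λ e → Nonempty (e ∩ V₁) × Nonempty (e ∩ V₂)) H

allSubset? : ∀ {n} {P : Subset n → Set} → Decidable P → Dec (∀ s → P s)
allSubset? P? = map′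
  (λ ¬∃ s → decidable-stable (P? s) (λ ¬p → ¬∃ (s , ¬p)))
  (λ ∀p (s , ¬p) → ¬p (∀p s))
  (¬? (anySubset? (λ s → ¬? (P? s))))

connected? : ∀ {n} → Decidable (Connected {n})
connected? H = allSubset? λ V₁ → allSubset? λ V₂ →
  (nonempty? V₁ ×-dec nonempty? V₂ ×-dec
    ≡-dec _≟ᵇ_ (V₁ ∪ V₂) ⊤ ×-dec ≡-dec _≟ᵇ_ (V₁ ∩ V₂) ⊥)
  →-dec any? (λ e → nonempty? (e ∩ V₁) ×-dec nonempty? (e ∩ V₂)) H

-- Uniform probability on the entries of Ω (0 if Ω is empty).
ℙ : ∀ {A : Set} (Ω : List A) {P : A → Set} → Decidable P → ℚ
ℙ Ω P? = length (filter P? Ω) ÷ length Ω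

ℙ-connected : (n m d : ℕ) → ℚ
ℙ-connected n m d = ℙ (hypergraphs n m d) connected?

{-# OPTIONS --safe #-}
-- Write N = C(n,d), T = C(N,m) and q = (1 - d/n)^m; the two regimes are n q → ∞ and n q → 0.
--
-- If n q → ∞, count isolated vertices. Their number X has mean n A₁/T with A₁ = C(C(n-1,d),m), and
-- C(C(n-2,d),m) T ≤ A₁² (log-concavity), so Var X ≤ E X and P(X = 0) ≤ 1/E X. Moreover
-- A₁/T ≥ q/2 once 2m(m-1) ≤ C(n-1,d); this follows from m ≪ √N if d ≤ n/2, and from 2^m ≪ n otherwise.
--
-- If n q → 0, take a union bound over the sets S of size k ≤ n/2 that no hyperedge crosses. A random
-- d-set does not cross S with probability p ≤ (1 - d/n)^θ, θ = k(n-k)/(n-1): for d = 2 this is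
-- Bernoulli's inequality with exponent θ, and passing from d to d+1 multiplies p by at most
-- 1 - k/(n-d). With n q ≤ 1/c² and n^(k-1) ≤ k^(n-1) (AM-GM) this gives p^m ≤ (k/(cn))^k, and
-- C(n,k) (k/(cn))^k ≤ (4/c)^k sums to something small.
module Submission where

-- Hyperedges are drawn without replacement, so the exact probabilities are quotients
-- `C(a,m)/C(b,m)`, not powers `(a/b)^m`. The upper estimate by the power always holds and serves
-- the union bound; the lower one, up to the factor 2, requires `m²` to be small against `a`, and
-- this is what `m ≪ √N` is for in the count of isolated vertices. The exponent θ falls short of k
-- by `k(k-1)/(n-1)`. The resulting loss `n^(k(k-1)/(n-1))` is at most `k^k` by the AM-GM
-- inequality, and `k^k` is in turn absorbed by the `k!` in `C(n,k)`. Since `k ≤ n/2`, also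
-- `θ ≥ k/2`, so a factor `c²` in the hypothesis yields the `c^k` in the conclusion. As θ is a
-- fraction, the inequalities about it are raised to the power `n-1` and cleared of denominators;
-- all counting then stays in the natural numbers. The only link with logarithms is `e^K ≥ K`: an
-- exponent above `K` gives `n q ≥ K`, one below `-K` gives `K n q ≤ 1`. Such a weak bound suffices
-- because `K` is arbitrary.

module Finite where
  open import Data.Bool.Base using (true; false; if_then_else_)
  open import Data.Fin.Base using (Fin; zero; suc)
  import Data.Fin.Properties as Fin
  open import Data.Fin.Subset using (Subset; inside; outside; Nonempty; _⊆_; ⊤; ⊥; ⁅_⁆; ∁; ∣_∣; _∩_; _∪_; _-_) renaming (_∈_ to _∈ˢ_; _∉_ to _∉ˢ_)
  open import Data.Fin.Subset.Properties
  open import Data.List.Base using (List; []; _∷_; _++_; map; filter; length; downFrom)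
  open import Data.List.Membership.Propositional using (_∈_)
  open import Data.List.Membership.Propositional.Properties using (∈-++⁺ˡ; ∈-++⁺ʳ; ∈-map⁺; ∈-downFrom⁺)
  open import Data.List.Properties using (length-map)
  open import Data.List.Relation.Unary.All as All using (All; all?)
  open import Data.List.Relation.Unary.All.Properties using (¬Any⇒All¬; All¬⇒¬Any)
  open import Data.List.Relation.Unary.Any using (here; there; any?)
  open import Data.Nat.Base
  open import Data.Nat.Combinatorics
  open import Data.Nat.Properties
  open import Data.Nat.Tactic.RingSolver using (solve-∀)
  open import Data.Product.Base using (_×_; _,_; proj₁; proj₂; ∃)
  open import Data.Sum.Base using (_⊎_; inj₁; inj₂)
  open import Data.Vec.Base using ([]; _∷_)
  open import Function.Base using (_∘_)
  open import Relation.Binary.PropositionalEquality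
  open import Relation.Nullary using (¬_; Dec; yes; no; contradiction; does)
  open import Relation.Nullary.Decidable using (_×-dec_; _⊎-dec_)
  open import Relation.Unary using (Decidable)
  open import Defs using (allSubsets; sublists; Hypergraph; hasShape?; hypergraphs; Connected; connected?)
  open ≤-Reasoning

  -- Powers, Bernoulli's inequality and AM-GM in the natural numbers

  ^-distribʳ-* : ∀ m n k → (m * n) ^ k ≡ m ^ k * n ^ k
  ^-distribʳ-* m n zero    = refl
  ^-distribʳ-* m n (suc k) = trans (cong (m * n *_) (^-distribʳ-* m n k)) (lem m n (m ^ k) (n ^ k))
    where
    lem : ∀ m n x y → m * n * (x * y) ≡ m * x * (n * y)
    lem = solve-∀

  ^-cancelˡ-≤ : ∀ {a b} n → a ^ suc n ≤ b ^ suc n → a ≤ b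
  ^-cancelˡ-≤ n le = ≮⇒≥ λ b<a → <⇒≱ (^-monoˡ-< (suc n) b<a) le

  -- As `0 ^ 0` is 1, cancelling `a ^ a` in the AM-GM inequalities needs no separate case for
  -- `a = 0`.
  n^n≢0 : ∀ n → NonZero (n ^ n)
  n^n≢0 zero    = _
  n^n≢0 (suc n) = m^n≢0 (suc n) (suc n)

  2xy≤x²+y² : ∀ x y → 2 * (x * y) ≤ x * x + y * y
  2xy≤x²+y² x y with ≤-total x y
  ... | inj₁ x≤y with k , refl ← m≤n⇒∃[o]m+o≡n x≤y = begin
    2 * (x * (x + k))           ≤⟨ m≤m+n _ (k * k) ⟩
    2 * (x * (x + k)) + k * k   ≡⟨ lem x k ⟩
    x * x + (x + k) * (x + k)   ∎
    where
    lem : ∀ x k → 2 * (x * (x + k)) + k * k ≡ x * x + (x + k) * (x + k)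
    lem = solve-∀
  2xy≤x²+y² x y | inj₂ y≤x with k , refl ← m≤n⇒∃[o]m+o≡n y≤x = begin
    2 * ((y + k) * y)           ≤⟨ m≤m+n _ (k * k) ⟩
    2 * ((y + k) * y) + k * k   ≡⟨ lem y k ⟩
    (y + k) * (y + k) + y * y   ∎
    where
    lem : ∀ y k → 2 * ((y + k) * y) + k * k ≡ (y + k) * (y + k) + y * y
    lem = solve-∀

  -- Bernoulli's inequality (y/x)^(n+1) ≥ 1 + (n+1)(y/x - 1), cleared of denominators.
  bernoulli : ∀ n x y → suc n * (x ^ n * y) ≤ y ^ suc n + n * x ^ suc n
  bernoulli zero    x y = ≤-reflexive (lem y)
    where
    lem : ∀ y → 1 * (1 * y) ≡ y * 1 + 0
    lem = solve-∀
  -- The extra `n * (x * p * y)` turns the left side into a multiple of `2 * (x * y)`, to which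
  -- `2xy≤x²+y²` applies.
  bernoulli (suc n) x y = +-cancelʳ-≤ (n * (x * p * y)) _ _ (begin
    suc (suc n) * (x * p * y) + n * (x * p * y)          ≡⟨ lem₁ n x p y ⟩
    suc n * p * (2 * (x * y))                            ≤⟨ *-monoʳ-≤ (suc n * p) (2xy≤x²+y² x y) ⟩
    suc n * p * (x * x + y * y)                          ≡⟨ lem₂ n x p y ⟩
    suc n * (p * y) * y + suc n * (x * (x * p))          ≤⟨ +-monoˡ-≤ _ (*-monoˡ-≤ y (bernoulli n x y)) ⟩
    (q + n * (x * p)) * y + suc n * (x * (x * p))        ≡⟨ lem₃ n x p y q ⟩
    y * q + suc n * (x * (x * p)) + n * (x * p * y)      ∎)
    where
    p = x ^ n
    q = y ^ suc n
    lem₁ : ∀ n x p y → (2 + n) * (x * p * y) + n * (x * p * y) ≡ (1 + n) * p * (2 * (x * y))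
    lem₁ = solve-∀
    lem₂ : ∀ n x p y → (1 + n) * p * (x * x + y * y) ≡ (1 + n) * (p * y) * y + (1 + n) * (x * (x * p))
    lem₂ = solve-∀
    lem₃ : ∀ n x p y q → (q + n * (x * p)) * y + (1 + n) * (x * (x * p))
                       ≡ y * q + (1 + n) * (x * (x * p)) + n * (x * p * y)
    lem₃ = solve-∀

  -- AM-GM for a copies of s/a and one copy of v.
  amgm-step : ∀ a s v → s ^ a * v * suc a ^ suc a ≤ a ^ a * (s + v) ^ suc a
  amgm-step zero    s v = ≤-trans (≤-reflexive (lem₁ v)) (≤-trans (m≤n+m v s) (≤-reflexive (lem₂ (s + v))))
    where
    lem₁ : ∀ v → 1 * v * (1 * 1) ≡ v
    lem₁ = solve-∀
    lem₂ : ∀ v → v ≡ 1 * (v * 1)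
    lem₂ = solve-∀
  -- Bernoulli's inequality for the ratio of the new mean `(s + v)/(a+1)` to the old mean `s/a`,
  -- both scaled by `a (a+1)`.
  amgm-step a@(suc a-1) s v = *-cancelˡ-≤ a (+-cancelʳ-≤ (a * (a+1 * A * (S * s))) _ _ (begin
    a * (S * v * (a+1 * A)) + a * (a+1 * A * (S * s))              ≡⟨ lem₁ a a+1 A S s v ⟩
    a+1 * (A * S * ((s + v) * a))                                  ≡⟨ cong (λ z → a+1 * (z * ((s + v) * a))) (^-distribʳ-* a+1 s a) ⟨
    a+1 * ((a+1 * s) ^ a * ((s + v) * a))                          ≤⟨ bernoulli a (a+1 * s) ((s + v) * a) ⟩
    ((s + v) * a) ^ a+1 + a * (a+1 * s) ^ a+1                      ≡⟨ cong₂ (λ y z → y + a * z) (^-distribʳ-* (s + v) a a+1) (^-distribʳ-* a+1 s a+1) ⟩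
    ((s + v) * W) * (a * B) + a * ((a+1 * A) * (s * S))            ≡⟨ lem₂ a a+1 A B S s v W ⟩
    a * (B * ((s + v) * W)) + a * (a+1 * A * (S * s))              ∎))
    where
    a+1 = suc a
    A = a+1 ^ a
    B = a ^ a
    S = s ^ a
    W = (s + v) ^ a
    lem₁ : ∀ a a+1 A S s v → a * (S * v * (a+1 * A)) + a * (a+1 * A * (S * s)) ≡ a+1 * (A * S * ((s + v) * a))
    lem₁ = solve-∀
    lem₂ : ∀ a a+1 A B S s v W → ((s + v) * W) * (a * B) + a * ((a+1 * A) * (s * S))
                               ≡ a * (B * ((s + v) * W)) + a * (a+1 * A * (S * s))
    lem₂ = solve-∀

  -- Copies of `v` are added one at a time to `b` copies of `u`: the induction hypothesis allows the
  -- `a` numbers already present, of sum `s`, to be replaced by `a` copies of `s/a`, which is the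
  -- situation of `amgm-step`.
  weighted-amgm : ∀ b c u v → u ^ b * v ^ c * (c + b) ^ (c + b) ≤ (c * v + b * u) ^ (c + b)
  weighted-amgm b zero    u v = ≤-reflexive (trans (lem (u ^ b) (b ^ b)) (sym (^-distribʳ-* b u b)))
    where
    lem : ∀ x y → x * 1 * y ≡ y * x
    lem = solve-∀
  weighted-amgm b (suc c) u v = *-cancelˡ-≤ (a ^ a) {{n^n≢0 a}} (begin
    a ^ a * (u ^ b * (v * v ^ c) * suc a ^ suc a)   ≡⟨ lem (a ^ a) (u ^ b) v (v ^ c) (suc a ^ suc a) ⟩
    u ^ b * v ^ c * a ^ a * v * suc a ^ suc a       ≤⟨ *-monoˡ-≤ (suc a ^ suc a) (*-monoˡ-≤ v (weighted-amgm b c u v)) ⟩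
    s ^ a * v * suc a ^ suc a                       ≤⟨ amgm-step a s v ⟩
    a ^ a * (s + v) ^ suc a                         ≡⟨ cong (λ z → a ^ a * z ^ suc a) (lem′ (c * v) (b * u) v) ⟩
    a ^ a * (v + c * v + b * u) ^ suc a             ∎)
    where
    a = c + b
    s = c * v + b * u
    lem : ∀ z x v y w → z * (x * (v * y) * w) ≡ x * y * z * v * w
    lem = solve-∀
    lem′ : ∀ x y v → x + y + v ≡ v + x + y
    lem′ = solve-∀

  -- The geometric mean of k - 1 copies of n and n - k copies of 1, whose arithmetic mean is k.
  n^[k-1]≤k^[n-1] : ∀ k l → suc (l + k) ^ k ≤ suc k ^ (l + k)
  n^[k-1]≤k^[n-1] k l = *-cancelʳ-≤ _ _ (a ^ a) {{n^n≢0 a}} (begin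
    suc a ^ k * a ^ a             ≡⟨ cong (_* a ^ a) (*-identityʳ (suc a ^ k)) ⟨
    suc a ^ k * 1 * a ^ a         ≡⟨ cong (λ z → suc a ^ k * z * a ^ a) (^-zeroˡ l) ⟨
    suc a ^ k * 1 ^ l * a ^ a     ≤⟨ weighted-amgm k l (suc a) 1 ⟩
    (l * 1 + k * suc a) ^ a       ≡⟨ cong (_^ a) (lem k l) ⟩
    (suc k * a) ^ a               ≡⟨ ^-distribʳ-* (suc k) a a ⟩
    suc k ^ a * a ^ a             ∎)
    where
    a = l + k
    lem : ∀ k l → l * 1 + k * (1 + (l + k)) ≡ (1 + k) * (l + k)
    lem = solve-∀

  -- AM-GM for two copies of 1 and `k - 1` copies of 2, whose mean is `2k/(k+1)`, gives even
  -- `(1 + 1/k)^(k+1) ≤ 4`; one factor is then dropped.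
  [1+k]^k≤4k^k : ∀ k → suc k ^ k ≤ 4 * k ^ k
  [1+k]^k≤4k^k zero    = s≤s z≤n
  [1+k]^k≤4k^k (suc l) = *-cancelˡ-≤ k (*-cancelˡ-≤ (2 ^ l) {{m^n≢0 2 l}} (begin
    2 ^ l * (k * suc k ^ k)                    ≤⟨ *-monoʳ-≤ (2 ^ l) (*-monoˡ-≤ (suc k ^ k) (n≤1+n k)) ⟩
    2 ^ l * (suc k * suc k ^ k)                ≡⟨ cong (_* suc k ^ suc k) (+-identityʳ (2 ^ l)) ⟨
    1 ^ 2 * 2 ^ l * suc k ^ suc k              ≡⟨ cong (λ z → 1 ^ 2 * 2 ^ l * z ^ z) (+-comm 2 l) ⟩
    1 ^ 2 * 2 ^ l * (l + 2) ^ (l + 2)          ≤⟨ weighted-amgm 2 l 1 2 ⟩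
    (l * 2 + 2 * 1) ^ (l + 2)                  ≡⟨ cong₂ _^_ (lem₁ l) (+-comm l 2) ⟩
    (2 * k) ^ suc k                            ≡⟨ ^-distribʳ-* 2 k (suc k) ⟩
    2 * (2 * 2 ^ l) * (k * k ^ k)              ≡⟨ lem₂ (2 ^ l) k (k ^ k) ⟩
    2 ^ l * (k * (4 * k ^ k))                  ∎))
    where
    k = suc l
    lem₁ : ∀ l → l * 2 + 2 * 1 ≡ 2 * (1 + l)
    lem₁ = solve-∀
    lem₂ : ∀ x y z → 2 * (2 * x) * (y * z) ≡ x * (y * (4 * z))
    lem₂ = solve-∀

  -- A crude Stirling bound with 4 in place of e. With `nCk*k!≤n^k` it gives `C(n,k) k^k ≤ (4n)^k`,
  -- the origin of the 4 in `c = 4 * B`.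
  k^k≤4^k*k! : ∀ k → k ^ k ≤ 4 ^ k * k !
  k^k≤4^k*k! zero    = s≤s z≤n
  k^k≤4^k*k! (suc k) = begin
    suc k * suc k ^ k               ≤⟨ *-monoʳ-≤ (suc k) ([1+k]^k≤4k^k k) ⟩
    suc k * (4 * k ^ k)             ≤⟨ *-monoʳ-≤ (suc k) (*-monoʳ-≤ 4 (k^k≤4^k*k! k)) ⟩
    suc k * (4 * (4 ^ k * k !))     ≡⟨ lem (suc k) (4 ^ k) (k !) ⟩
    4 * 4 ^ k * (suc k * k !)       ∎
    where
    lem : ∀ x y z → x * (4 * (y * z)) ≡ 4 * y * (x * z)
    lem = solve-∀

  -- 1 - k/(a+1) ≤ (1 - 1/(a+1))^k, cleared of denominators.
  bernoulli-∸ : ∀ a k → (suc a ∸ k) * suc a ^ k ≤ suc a * a ^ k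
  bernoulli-∸ a zero    = ≤-refl
  bernoulli-∸ a (suc k) = begin
    (a ∸ k) * (suc a * suc a ^ k)   ≡⟨ *-assoc (a ∸ k) (suc a) (suc a ^ k) ⟨
    (a ∸ k) * suc a * suc a ^ k     ≤⟨ *-monoˡ-≤ (suc a ^ k) step ⟩
    a * (suc a ∸ k) * suc a ^ k     ≡⟨ *-assoc a (suc a ∸ k) (suc a ^ k) ⟩
    a * ((suc a ∸ k) * suc a ^ k)   ≤⟨ *-monoʳ-≤ a (bernoulli-∸ a k) ⟩
    a * (suc a * a ^ k)             ≡⟨ lem a (suc a) (a ^ k) ⟩
    suc a * (a * a ^ k)             ∎
    where
    lem : ∀ a b c → a * (b * c) ≡ b * (a * c)
    lem = solve-∀
    step : (a ∸ k) * suc a ≤ a * (suc a ∸ k)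
    step with ≤-total k a
    ... | inj₁ k≤a = begin
      (a ∸ k) * suc a        ≡⟨ *-suc (a ∸ k) a ⟩
      (a ∸ k) + (a ∸ k) * a  ≤⟨ +-monoˡ-≤ _ (m∸n≤m a k) ⟩
      a + (a ∸ k) * a        ≡⟨ cong (a +_) (*-comm (a ∸ k) a) ⟩
      a + a * (a ∸ k)        ≡⟨ *-suc a (a ∸ k) ⟨
      a * suc (a ∸ k)        ≡⟨ cong (a *_) (+-∸-assoc 1 k≤a) ⟨
      a * (suc a ∸ k)        ∎
    ... | inj₂ a≤k rewrite m≤n⇒m∸n≡0 a≤k = z≤n

  -- The `t`-th power of `bernoulli-∸` has `k t` factors `a/(a+1)`; the surplus `r = k t - w` of
  -- them are bounded by 1. With `t = n-1` and `w = k l` this drives the induction on `d` in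
  -- `M-bound`.
  bernoulli-∸-power : ∀ a k t w → w ≤ k * t → (suc a ∸ k) ^ t * suc a ^ w ≤ suc a ^ t * a ^ w
  bernoulli-∸-power a k t w w≤kt with r , eq ← m≤n⇒∃[o]m+o≡n w≤kt =
    *-cancelʳ-≤ _ _ (suc a ^ r) {{m^n≢0 (suc a) r}} (begin
    (suc a ∸ k) ^ t * suc a ^ w * suc a ^ r    ≡⟨ *-assoc ((suc a ∸ k) ^ t) _ _ ⟩
    (suc a ∸ k) ^ t * (suc a ^ w * suc a ^ r)  ≡⟨ cong ((suc a ∸ k) ^ t *_) (split (suc a)) ⟩
    (suc a ∸ k) ^ t * (suc a ^ k) ^ t          ≡⟨ ^-distribʳ-* (suc a ∸ k) (suc a ^ k) t ⟨
    ((suc a ∸ k) * suc a ^ k) ^ t              ≤⟨ ^-monoˡ-≤ t (bernoulli-∸ a k) ⟩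
    (suc a * a ^ k) ^ t                        ≡⟨ ^-distribʳ-* (suc a) (a ^ k) t ⟩
    suc a ^ t * (a ^ k) ^ t                    ≡⟨ cong (suc a ^ t *_) (split a) ⟨
    suc a ^ t * (a ^ w * a ^ r)                ≤⟨ *-monoʳ-≤ (suc a ^ t) (*-monoʳ-≤ (a ^ w) (^-monoˡ-≤ r (n≤1+n a))) ⟩
    suc a ^ t * (a ^ w * suc a ^ r)            ≡⟨ *-assoc (suc a ^ t) _ _ ⟨
    suc a ^ t * a ^ w * suc a ^ r              ∎)
    where
    split : ∀ x → x ^ w * x ^ r ≡ (x ^ k) ^ t
    split x = trans (sym (^-distribˡ-+-* x w r)) (trans (cong (x ^_) eq) (sym (^-*-assoc x k t)))

  -- Binomial coefficients: absorption, ratios and log-concavity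

  pascal : ∀ n k → suc n C suc k ≡ n C k + n C suc k
  pascal n k = sym (nCk+nC[k+1]≡[n+1]C[k+1] n k)

  [1+k]*[1+n]C[1+k] : ∀ n k → suc k * (suc n C suc k) ≡ suc n * (n C k)
  [1+k]*[1+n]C[1+k] zero    zero    = refl
  [1+k]*[1+n]C[1+k] zero    (suc k) = begin-equality
    suc (suc k) * (1 C suc (suc k))   ≡⟨ cong (suc (suc k) *_) (k>n⇒nCk≡0 {1} {suc (suc k)} (s≤s (s≤s z≤n))) ⟩
    suc (suc k) * 0                   ≡⟨ *-zeroʳ (suc (suc k)) ⟩
    1 * 0                             ≡⟨ cong (1 *_) (k>n⇒nCk≡0 {0} {suc k} (s≤s z≤n)) ⟨
    1 * (0 C suc k)                   ∎
  [1+k]*[1+n]C[1+k] (suc n) zero    = trans (cong (1 *_) (nC1≡n (suc (suc n)))) (*-comm 1 (suc (suc n)))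
  [1+k]*[1+n]C[1+k] (suc n) (suc k) = begin-equality
    k+2 * (suc (suc n) C k+2)                             ≡⟨ cong (k+2 *_) (pascal (suc n) (suc k)) ⟩
    k+2 * (x + suc n C k+2)                               ≡⟨ lem₁ (suc k) x (suc n C k+2) ⟩
    x + suc k * x + k+2 * (suc n C k+2)                   ≡⟨ cong₂ (λ y z → x + y + z) ([1+k]*[1+n]C[1+k] n k) ([1+k]*[1+n]C[1+k] n (suc k)) ⟩
    x + suc n * (n C k) + suc n * (n C suc k)             ≡⟨ lem₂ x (suc n) (n C k) (n C suc k) ⟩
    x + suc n * (n C k + n C suc k)                       ≡⟨ cong (λ z → x + suc n * z) (pascal n k) ⟨
    x + suc n * x                                         ∎
    where
    k+2 = suc (suc k)
    x = suc n C suc k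
    lem₁ : ∀ k x y → (1 + k) * (x + y) ≡ x + k * x + (1 + k) * y
    lem₁ = solve-∀
    lem₂ : ∀ x n y z → x + n * y + n * z ≡ x + n * (y + z)
    lem₂ = solve-∀

  -- For `k > n` both sides vanish, so the inductions on the lower index below run without side
  -- conditions.
  [1+k]*nC[1+k] : ∀ n k → suc k * (n C suc k) ≡ (n ∸ k) * (n C k)
  [1+k]*nC[1+k] n k with ≤-<-connex k n
  ... | inj₁ k≤n = +-cancelˡ-≡ (suc k * (n C k)) _ _ (begin-equality
    suc k * (n C k) + suc k * (n C suc k)     ≡⟨ *-distribˡ-+ (suc k) (n C k) (n C suc k) ⟨
    suc k * (n C k + n C suc k)               ≡⟨ cong (suc k *_) (pascal n k) ⟨
    suc k * (suc n C suc k)                   ≡⟨ [1+k]*[1+n]C[1+k] n k ⟩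
    suc n * (n C k)                           ≡⟨ cong (λ z → suc z * (n C k)) (m+[n∸m]≡n k≤n) ⟨
    (suc k + (n ∸ k)) * (n C k)               ≡⟨ *-distribʳ-+ (n C k) (suc k) (n ∸ k) ⟩
    suc k * (n C k) + (n ∸ k) * (n C k)       ∎)
  ... | inj₂ n<k rewrite k>n⇒nCk≡0 (m<n⇒m<1+n n<k) | k>n⇒nCk≡0 n<k = trans (*-zeroʳ (suc k)) (sym (*-zeroʳ (n ∸ k)))

  [1+n∸k]*[1+n]Ck : ∀ n k → (suc n ∸ k) * (suc n C k) ≡ suc n * (n C k)
  [1+n∸k]*[1+n]Ck n k = trans (sym ([1+k]*nC[1+k] (suc n) k)) ([1+k]*[1+n]C[1+k] n k)

  C-suc-mono : ∀ n k → n C k ≤ suc n C k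
  C-suc-mono n zero    = ≤-refl
  C-suc-mono n (suc k) = ≤-trans (m≤n+m _ _) (≤-reflexive (sym (pascal n k)))

  C-monoˡ-≤ : ∀ {m n} k → m ≤ n → m C k ≤ n C k
  C-monoˡ-≤ {m} k m≤n = go (≤⇒≤′ m≤n)
    where
    go : ∀ {n} → m ≤′ n → m C k ≤ n C k
    go ≤′-refl           = ≤-refl
    go (≤′-step {n} m≤n) = ≤-trans (go m≤n) (C-suc-mono n k)

  C≢0 : ∀ {n k} → k ≤ n → 1 ≤ n C k
  C≢0 {n} {k} k≤n = ≤-trans (≤-reflexive (sym (nCn≡1 k))) (C-monoˡ-≤ k k≤n)

  n≤nCk : ∀ n k → 1 ≤ k → k < n → n ≤ n C k
  n≤nCk (suc n) (suc zero)    _ _         = ≤-reflexive (sym (nC1≡n (suc n)))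
  n≤nCk (suc n) (suc (suc k)) _ (s≤s k<n) = begin
    suc n                             ≡⟨ +-comm 1 n ⟩
    n + 1                             ≤⟨ +-mono-≤ (n≤nCk n (suc k) (s≤s z≤n) k<n) (C≢0 k<n) ⟩
    n C suc k + n C suc (suc k)       ≡⟨ pascal n (suc k) ⟨
    suc n C suc (suc k)               ∎

  nCk*k!≤n^k : ∀ n k → (n C k) * k ! ≤ n ^ k
  nCk*k!≤n^k n zero    = ≤-refl
  nCk*k!≤n^k n (suc k) = begin
    (n C suc k) * (suc k * k !)     ≡⟨ lem (n C suc k) (suc k) (k !) ⟩
    suc k * (n C suc k) * k !       ≡⟨ cong (_* k !) ([1+k]*nC[1+k] n k) ⟩
    (n ∸ k) * (n C k) * k !         ≡⟨ *-assoc (n ∸ k) (n C k) (k !) ⟩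
    (n ∸ k) * ((n C k) * k !)       ≤⟨ *-mono-≤ (m∸n≤m n k) (nCk*k!≤n^k n k) ⟩
    n * n ^ k                       ∎
    where
    lem : ∀ x y z → x * (y * z) ≡ y * x * z
    lem = solve-∀

  -- Factor by factor, `(a - i)/(b - i) ≤ a/b`: drawing without replacement is no more likely to
  -- stay inside a subfamily than drawing with replacement.
  C-ratio-≤ : ∀ {a b} → a ≤ b → ∀ m → (a C m) * b ^ m ≤ (b C m) * a ^ m
  C-ratio-≤ {a} {b} a≤b zero    = ≤-refl
  C-ratio-≤ {a} {b} a≤b (suc m) = *-cancelˡ-≤ (suc m) (begin
    suc m * ((a C suc m) * (b * b ^ m))       ≡⟨ *-assoc (suc m) (a C suc m) _ ⟨
    suc m * (a C suc m) * (b * b ^ m)         ≡⟨ cong (_* (b * b ^ m)) ([1+k]*nC[1+k] a m) ⟩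
    (a ∸ m) * (a C m) * (b * b ^ m)           ≡⟨ lem (a ∸ m) (a C m) b (b ^ m) ⟩
    (a ∸ m) * b * ((a C m) * b ^ m)           ≤⟨ *-mono-≤ step (C-ratio-≤ a≤b m) ⟩
    (b ∸ m) * a * ((b C m) * a ^ m)           ≡⟨ lem (b ∸ m) (b C m) a (a ^ m) ⟨
    (b ∸ m) * (b C m) * (a * a ^ m)           ≡⟨ cong (_* (a * a ^ m)) ([1+k]*nC[1+k] b m) ⟨
    suc m * (b C suc m) * (a * a ^ m)         ≡⟨ *-assoc (suc m) (b C suc m) _ ⟩
    suc m * ((b C suc m) * (a * a ^ m))       ∎)
    where
    lem : ∀ x y z w → x * y * (z * w) ≡ x * z * (y * w)
    lem = solve-∀
    step : (a ∸ m) * b ≤ (b ∸ m) * a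
    step = begin
      (a ∸ m) * b       ≡⟨ *-distribʳ-∸ b a m ⟩
      a * b ∸ m * b     ≤⟨ ∸-monoʳ-≤ (a * b) (*-monoʳ-≤ m a≤b) ⟩
      a * b ∸ m * a     ≡⟨ cong (_∸ m * a) (*-comm a b) ⟩
      b * a ∸ m * a     ≡⟨ *-distribʳ-∸ a b m ⟨
      (b ∸ m) * a       ∎

  -- If x z ≤ y² and 2 y ≤ x + z, then (x - m)(z - m) ≤ (y - m)² for every m ≤ x.
  C-logConcave : ∀ {x y z} → x ≤ y → y ≤ z → x * z ≤ y * y → 2 * y ≤ x + z →
    ∀ m → (x C m) * (z C m) ≤ (y C m) * (y C m)
  C-logConcave {x} {y} {z} x≤y y≤z xz≤y² 2y≤x+z zero = ≤-refl
  C-logConcave {x} {y} {z} x≤y y≤z xz≤y² 2y≤x+z (suc m) =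
    *-cancelˡ-≤ (suc m * suc m) (begin
    suc m * suc m * ((x C suc m) * (z C suc m))         ≡⟨ absorb x z ⟩
    (x ∸ m) * (z ∸ m) * ((x C m) * (z C m))             ≤⟨ *-mono-≤ step (C-logConcave x≤y y≤z xz≤y² 2y≤x+z m) ⟩
    (y ∸ m) * (y ∸ m) * ((y C m) * (y C m))             ≡⟨ absorb y y ⟨
    suc m * suc m * ((y C suc m) * (y C suc m))         ∎)
    where
    lem : ∀ a b c d → a * b * (c * d) ≡ a * c * (b * d)
    lem = solve-∀
    absorb : ∀ x z → suc m * suc m * ((x C suc m) * (z C suc m)) ≡ (x ∸ m) * (z ∸ m) * ((x C m) * (z C m))
    absorb x z = trans (lem (suc m) (suc m) (x C suc m) (z C suc m))
      (trans (cong₂ _*_ ([1+k]*nC[1+k] x m) ([1+k]*nC[1+k] z m)) (lem (x ∸ m) (x C m) (z ∸ m) (z C m)))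
    lem₁ : ∀ m a c b → a * c + (m * m + m * (a + c) + 2 * m * b) ≡ (m + a) * (m + c) + m * (2 * b)
    lem₁ = solve-∀
    lem₂ : ∀ m a c b → (m + b) * (m + b) + m * (a + c) ≡ b * b + (m * m + m * (a + c) + 2 * m * b)
    lem₂ = solve-∀
    lem₃ : ∀ m b → 2 * (m + b) ≡ 2 * m + 2 * b
    lem₃ = solve-∀
    lem₄ : ∀ m a c → m + a + (m + c) ≡ 2 * m + (a + c)
    lem₄ = solve-∀
    -- Expanding `h₁` leaves `ac + m(a + c) ≤ b² + 2mb`, and `h₂` amounts to `2b ≤ a + c`, so the
    -- terms in `m` can be removed.
    shifted : ∀ a b c → (m + a) * (m + c) ≤ (m + b) * (m + b) → 2 * (m + b) ≤ m + a + (m + c) → a * c ≤ b * b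
    shifted a b c h₁ h₂ = +-cancelʳ-≤ (m * m + m * (a + c) + 2 * m * b) _ _ (begin
      a * c + (m * m + m * (a + c) + 2 * m * b)  ≡⟨ lem₁ m a c b ⟩
      (m + a) * (m + c) + m * (2 * b)            ≤⟨ +-mono-≤ h₁ (*-monoʳ-≤ m
                                                      (+-cancelˡ-≤ (2 * m) _ _ (subst₂ _≤_ (lem₃ m b) (lem₄ m a c) h₂))) ⟩
      (m + b) * (m + b) + m * (a + c)            ≡⟨ lem₂ m a c b ⟩
      b * b + (m * m + m * (a + c) + 2 * m * b)  ∎)
    step : (x ∸ m) * (z ∸ m) ≤ (y ∸ m) * (y ∸ m)
    step with ≤-total m x
    ... | inj₂ x≤m rewrite m≤n⇒m∸n≡0 x≤m = z≤n
    ... | inj₁ m≤x = shifted (x ∸ m) (y ∸ m) (z ∸ m)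
      (subst₂ _≤_ (sym (cong₂ _*_ (m+[n∸m]≡n m≤x) (m+[n∸m]≡n m≤z))) (sym (cong₂ _*_ (m+[n∸m]≡n m≤y) (m+[n∸m]≡n m≤y))) xz≤y²)
      (subst₂ _≤_ (sym (cong (2 *_) (m+[n∸m]≡n m≤y))) (sym (cong₂ _+_ (m+[n∸m]≡n m≤x) (m+[n∸m]≡n m≤z))) 2y≤x+z)
      where
      m≤y = ≤-trans m≤x x≤y
      m≤z = ≤-trans m≤y y≤z

  -- The quotient `C(n+1,d)/C(n,d) = (n+1)/(n+1-d)` decreases in `n`. Together with `nCd-convex` it
  -- supplies the hypotheses of `C-logConcave` for the numbers of d-sets that avoid two, one or no
  -- vertices.
  nCd-logConcave : ∀ n d → (n C d) * (suc (suc n) C d) ≤ (suc n C d) * (suc n C d)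
  nCd-logConcave n d with ≤-<-connex d n
  ... | inj₂ n<d rewrite k>n⇒nCk≡0 n<d = z≤n
  ... | inj₁ d≤n = *-cancelˡ-≤ (suc n * suc (suc j)) (begin
    suc n * suc (suc j) * (N₂ * N)            ≡⟨ lem (suc n) (suc (suc j)) N₂ N ⟩
    suc n * N₂ * (suc (suc j) * N)            ≡⟨ cong₂ _*_ ([1+n∸k]*[1+n]Ck n d) eq ⟨
    (suc n ∸ d) * N₁ * (suc (suc n) * N₁)     ≡⟨ cong (λ t → t * N₁ * (suc (suc n) * N₁)) (+-∸-assoc 1 d≤n) ⟩
    suc j * N₁ * (suc (suc n) * N₁)           ≡⟨ lem (suc j) (suc (suc n)) N₁ N₁ ⟨
    suc j * suc (suc n) * (N₁ * N₁)           ≤⟨ *-monoˡ-≤ (N₁ * N₁) step ⟩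
    suc n * suc (suc j) * (N₁ * N₁)           ∎)
    where
    j = n ∸ d
    N  = suc (suc n) C d
    N₁ = suc n C d
    N₂ = n C d
    lem : ∀ a b c d → a * b * (c * d) ≡ a * c * (b * d)
    lem = solve-∀
    eq : suc (suc n) * N₁ ≡ suc (suc j) * N
    eq = trans (sym ([1+n∸k]*[1+n]Ck (suc n) d)) (cong (_* N) (+-∸-assoc 2 d≤n))
    step : suc j * suc (suc n) ≤ suc n * suc (suc j)
    step = begin
      suc j * suc (suc n)     ≡⟨ *-suc (suc j) (suc n) ⟩
      suc j + suc j * suc n   ≤⟨ +-monoˡ-≤ _ (s≤s (m∸n≤m n d)) ⟩
      suc n + suc j * suc n   ≡⟨ cong (suc n +_) (*-comm (suc j) (suc n)) ⟩
      suc n + suc n * suc j   ≡⟨ *-suc (suc n) (suc j) ⟨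
      suc n * suc (suc j)     ∎

  -- By Pascal's rule the successive differences are `C(n,d)` and `C(n+1,d)`, which increase.
  nCd-convex : ∀ n d → 2 * (suc n C suc d) ≤ n C suc d + suc (suc n) C suc d
  nCd-convex n d = begin
    2 * N₁                           ≡⟨ cong (N₁ +_) (+-identityʳ N₁) ⟩
    N₁ + N₁                          ≡⟨ cong (_+ N₁) (pascal n d) ⟩
    n C d + n C suc d + N₁           ≤⟨ +-monoˡ-≤ N₁ (+-monoˡ-≤ _ (C-suc-mono n d)) ⟩
    suc n C d + n C suc d + N₁       ≡⟨ lem (suc n C d) (n C suc d) N₁ ⟩
    n C suc d + (suc n C d + N₁)     ≡⟨ cong (n C suc d +_) (pascal (suc n) d) ⟨
    n C suc d + suc (suc n) C suc d  ∎
    where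
    N₁ = suc n C suc d
    lem : ∀ a b c → a + b + c ≡ b + (a + c)
    lem = solve-∀

  -- With M = 2m, consecutive factors of the two products compare up to 1 - 1/M,
  -- and (1 - 1/M)^m ≥ 1/2.
  C-ratio-≥ : ∀ {a b} m → a ≤ b → 2 * (m * pred m) ≤ a → (b C m) * a ^ m ≤ 2 * ((a C m) * b ^ m)
  C-ratio-≥ {a} {b} zero      a≤b _ = s≤s z≤n
  C-ratio-≥ {a} {b} m@(suc p) a≤b h = *-cancelʳ-≤ _ _ (M ^ m) {{m^n≢0 M m}} (begin
    (b C m) * a ^ m * M ^ m                  ≤⟨ *-monoʳ-≤ ((b C m) * a ^ m) half ⟩
    (b C m) * a ^ m * (2 * pred M ^ m)       ≡⟨ lem₁ ((b C m) * a ^ m) (pred M ^ m) ⟩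
    2 * ((b C m) * a ^ m * pred M ^ m)       ≤⟨ *-monoʳ-≤ 2 (go m ≤-refl) ⟩
    2 * ((a C m) * b ^ m * M ^ m)            ≡⟨ *-assoc 2 ((a C m) * b ^ m) (M ^ m) ⟨
    2 * ((a C m) * b ^ m) * M ^ m            ∎)
    where
    M = 2 * m
    lem₁ : ∀ x y → x * (2 * y) ≡ 2 * (x * y)
    lem₁ = solve-∀
    half : M ^ m ≤ 2 * pred M ^ m
    half = *-cancelˡ-≤ m (begin
      m * M ^ m               ≡⟨ cong (_* M ^ m) (trans (cong (_∸ m) (cong (m +_) (+-identityʳ m))) (m+n∸n≡m m m)) ⟨
      (M ∸ m) * M ^ m         ≤⟨ bernoulli-∸ (pred M) m ⟩
      M * pred M ^ m          ≡⟨ lem₂ m (pred M ^ m) ⟩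
      m * (2 * pred M ^ m)    ∎)
      where
      lem₂ : ∀ x y → 2 * x * y ≡ x * (2 * y)
      lem₂ = solve-∀
    -- The hypothesis on `m` gives `i * M ≤ a`, so replacing `a` by `a - i` loses at most the
    -- proportion `1/M`.
    factor : ∀ i → i ≤ p → (b ∸ i) * a * pred M ≤ (a ∸ i) * b * M
    factor i i≤p with c , refl ← m≤n⇒∃[o]m+o≡n a≤b = +-cancelʳ-≤ (i * (a + c) * M) _ _ (begin
      (a + c ∸ i) * a * pred M + i * (a + c) * M
        ≡⟨ cong (_+ i * (a + c) * M) (*-assoc (a + c ∸ i) a (pred M)) ⟩
      (a + c ∸ i) * (a * pred M) + i * (a + c) * M
        ≤⟨ +-monoˡ-≤ _ (≤-reflexive (*-distribʳ-∸ (a * pred M) (a + c) i)) ⟩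
      (a + c) * (a * pred M) ∸ i * (a * pred M) + i * (a + c) * M
        ≤⟨ bound ⟩
      a * (a + c) * M
        ≡⟨ cong (λ z → z * (a + c) * M) (m∸n+n≡m i≤a) ⟨
      (a ∸ i + i) * (a + c) * M
        ≡⟨ lem₃ (a ∸ i) i (a + c) M ⟩
      (a ∸ i) * (a + c) * M + i * (a + c) * M ∎)
      where
      lem₃ : ∀ x y z w → (x + y) * z * w ≡ x * z * w + y * z * w
      lem₃ = solve-∀
      iM≤a : i * M ≤ a
      iM≤a = begin
        i * M             ≤⟨ *-monoˡ-≤ M i≤p ⟩
        p * (2 * m)       ≡⟨ lem₄ p m ⟩
        2 * (m * p)       ≤⟨ h ⟩
        a                 ∎
        where
        lem₄ : ∀ x y → x * (2 * y) ≡ 2 * (y * x)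
        lem₄ = solve-∀
      i≤a : i ≤ a
      i≤a = ≤-trans (m≤m*n i M) iM≤a
      q = pred M
      lem₅ : ∀ a c i q → (a + c) * (a * q) + i * (a + c) * (1 + q) ≡ (a + c) * (a * q) + i * a * q + (i * (1 + q) * c + i * a)
      lem₅ = solve-∀
      lem₆ : ∀ a c i q → (a + c) * (a * q) + i * a * q + (a * c + a * a) ≡ a * (a + c) * (1 + q) + i * (a * q)
      lem₆ = solve-∀
      bound : (a + c) * (a * q) ∸ i * (a * q) + i * (a + c) * M ≤ a * (a + c) * M
      bound = +-cancelʳ-≤ (i * (a * q)) _ _ (begin
        (a + c) * (a * q) ∸ i * (a * q) + i * (a + c) * M + i * (a * q)
          ≡⟨ lem₇ ((a + c) * (a * q) ∸ i * (a * q)) (i * (a + c) * M) (i * (a * q)) ⟩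
        (a + c) * (a * q) ∸ i * (a * q) + i * (a * q) + i * (a + c) * M
          ≡⟨ cong (_+ i * (a + c) * M) (m∸n+n≡m (*-monoˡ-≤ (a * q) (≤-trans i≤a (m≤m+n a c)))) ⟩
        (a + c) * (a * q) + i * (a + c) * M
          ≡⟨ lem₅ a c i q ⟩
        (a + c) * (a * q) + i * a * q + (i * M * c + i * a)
          ≤⟨ +-monoʳ-≤ ((a + c) * (a * q) + i * a * q) (+-mono-≤ (*-monoˡ-≤ c iM≤a) (*-monoˡ-≤ a i≤a)) ⟩
        (a + c) * (a * q) + i * a * q + (a * c + a * a)
          ≡⟨ lem₆ a c i q ⟩
        a * (a + c) * M + i * (a * q) ∎)
        where
        lem₇ : ∀ x y z → x + y + z ≡ x + z + y
        lem₇ = solve-∀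
    go : ∀ i → i ≤ m → (b C i) * a ^ i * pred M ^ i ≤ (a C i) * b ^ i * M ^ i
    go zero    _   = ≤-refl
    go (suc i) i<m = *-cancelˡ-≤ (suc i) (begin
      suc i * ((b C suc i) * (a * a ^ i) * (pred M * pred M ^ i))   ≡⟨ absorb b a (a ^ i) (pred M) (pred M ^ i) ⟩
      (b ∸ i) * a * pred M * ((b C i) * a ^ i * pred M ^ i)         ≤⟨ *-mono-≤ (factor i (s≤s⁻¹ i<m)) (go i (<⇒≤ i<m)) ⟩
      (a ∸ i) * b * M * ((a C i) * b ^ i * M ^ i)                   ≡⟨ absorb a b (b ^ i) M (M ^ i) ⟨
      suc i * ((a C suc i) * (b * b ^ i) * (M * M ^ i))             ∎)
      where
      lem₂ : ∀ s c x y z w → s * (c * (x * y) * (z * w)) ≡ s * c * (x * y * (z * w))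
      lem₂ = solve-∀
      lem₃ : ∀ s c x y z w → s * c * (x * y * (z * w)) ≡ s * x * z * (c * y * w)
      lem₃ = solve-∀
      absorb : ∀ b x y z w → suc i * ((b C suc i) * (x * y) * (z * w)) ≡ (b ∸ i) * x * z * ((b C i) * y * w)
      absorb b x y z w = trans (lem₂ (suc i) (b C suc i) x y z w)
        (trans (cong (_* (x * y * (z * w))) ([1+k]*nC[1+k] b i)) (lem₃ (b ∸ i) (b C i) x y z w))

  -- The probability that no hyperedge crosses a fixed bipartition

  module Bipartition (k-1 l-1 : ℕ) (k≤l : k-1 ≤ l-1) where
    -- The exponent θ of the overview is `w / n-1`; it appears below as a power `w` on one side
    -- against a power `n-1` on the other.
    k l n-1 n w : ℕ
    k   = suc k-1
    l   = suc l-1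
    n-1 = l + k-1
    n   = suc n-1
    w   = k * l

    -- The number of d-sets contained in one side of a partition into parts of sizes k and l.
    M : ℕ → ℕ
    M d = k C d + l C d

    2*nC2 : ∀ n → 2 * (suc n C 2) ≡ n * suc n
    2*nC2 n = trans ([1+k]*nC[1+k] (suc n) 1) (cong (n *_) (nC1≡n (suc n)))

    -- At d = 2 this is 1 - θ(2/n) ≤ (1 - 2/n)^θ for the rational exponent θ = w/(n-1) ≥ 1.
    M-bound-2 : M 2 ^ n-1 * n ^ w ≤ (n C 2) ^ n-1 * (n ∸ 2) ^ w
    M-bound-2 = *-cancelˡ-≤ (2 ^ n-1) {{m^n≢0 2 n-1}} (*-cancelˡ-≤ (n-1 ^ w) {{m^n≢0 n-1 w}} (begin
      n-1 ^ w * (2 ^ n-1 * (M 2 ^ n-1 * n ^ w))          ≡⟨ lem₁ (n-1 ^ w) (2 ^ n-1) (M 2 ^ n-1) (n ^ w) ⟩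
      2 ^ n-1 * M 2 ^ n-1 * (n-1 ^ w * n ^ w)            ≡⟨ cong₂ _*_ (^-distribʳ-* 2 (M 2) n-1) (^-distribʳ-* n-1 n w) ⟨
      (2 * M 2) ^ n-1 * v ^ w                            ≡⟨ cong₂ (λ x y → x ^ n-1 * v ^ y) 2M≡u w≡c+b ⟩
      u ^ n-1 * v ^ (c + n-1)                            ≡⟨ cong (u ^ n-1 *_) (^-distribˡ-+-* v c n-1) ⟩
      u ^ n-1 * (v ^ c * v ^ n-1)                        ≡⟨ *-assoc (u ^ n-1) (v ^ c) (v ^ n-1) ⟨
      u ^ n-1 * v ^ c * v ^ n-1                          ≤⟨ *-monoˡ-≤ (v ^ n-1) core ⟩
      (n-1 * e) ^ w * v ^ n-1                            ≡⟨ cong₂ _*_ (^-distribʳ-* n-1 e w) (cong (_^ n-1) (sym (2*nC2 n-1))) ⟩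
      n-1 ^ w * e ^ w * (2 * (n C 2)) ^ n-1              ≡⟨ cong (n-1 ^ w * e ^ w *_) (^-distribʳ-* 2 (n C 2) n-1) ⟩
      n-1 ^ w * e ^ w * (2 ^ n-1 * (n C 2) ^ n-1)        ≡⟨ lem₂ (n-1 ^ w) (e ^ w) (2 ^ n-1) ((n C 2) ^ n-1) ⟩
      n-1 ^ w * (2 ^ n-1 * ((n C 2) ^ n-1 * e ^ w))      ∎))
      where
      e = l-1 + k-1
      c = k-1 * l-1
      v = n-1 * n
      u = k-1 * k + l-1 * l
      lem₁ : ∀ a b c d → a * (b * (c * d)) ≡ b * c * (a * d)
      lem₁ = solve-∀
      lem₂ : ∀ a b c d → a * b * (c * d) ≡ a * (c * (d * b))
      lem₂ = solve-∀
      2M≡u : 2 * M 2 ≡ u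
      2M≡u = trans (*-distribˡ-+ 2 (k C 2) (l C 2)) (cong₂ _+_ (2*nC2 k-1) (2*nC2 l-1))
      w≡c+b : w ≡ c + n-1
      w≡c+b = lem k-1 l-1
        where
        lem : ∀ x y → (1 + x) * (1 + y) ≡ x * y + (1 + y + x)
        lem = solve-∀
      mean : c * v + n-1 * u ≡ w * (n-1 * e)
      mean = lem k-1 l-1
        where
        lem : ∀ x y → x * y * ((1 + y + x) * (2 + y + x)) + (1 + y + x) * (x * (1 + x) + y * (1 + y))
                    ≡ (1 + x) * (1 + y) * ((1 + y + x) * (y + x))
        lem = solve-∀
      -- Bernoulli's inequality with exponent `w / n-1` is AM-GM for `n-1` copies of `u = 2 * M 2`
      -- and `c` copies of `v = n(n-1)`. The choice `c = (k-1)(l-1)` makes their number `w`, and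
      -- their mean is exactly `(n-1)(n-2)`.
      core : u ^ n-1 * v ^ c ≤ (n-1 * e) ^ w
      core = *-cancelʳ-≤ _ _ (w ^ w) {{n^n≢0 w}} (begin
        u ^ n-1 * v ^ c * w ^ w                        ≡⟨ cong (λ z → u ^ n-1 * v ^ c * z ^ z) w≡c+b ⟩
        u ^ n-1 * v ^ c * (c + n-1) ^ (c + n-1)        ≤⟨ weighted-amgm n-1 c u v ⟩
        (c * v + n-1 * u) ^ (c + n-1)                  ≡⟨ cong₂ _^_ mean (sym w≡c+b) ⟩
        (w * (n-1 * e)) ^ w                            ≡⟨ ^-distribʳ-* w (n-1 * e) w ⟩
        w ^ w * (n-1 * e) ^ w                          ≡⟨ *-comm (w ^ w) _ ⟩
        (n-1 * e) ^ w * w ^ w                          ∎)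

    w≤k*[n-1] : w ≤ k * n-1
    w≤k*[n-1] = *-monoʳ-≤ k (m≤m+n l k-1)

    -- Absorption on the two sides yields the factors `k - d` and `l - d`; as `k ≤ l`, both are at
    -- most `l - d = n - d - k`. The same identity for all d-sets has the factor `n - d`.
    M-suc : ∀ d → suc d * M (suc d) ≤ (n ∸ d ∸ k) * M d
    M-suc d = begin
      suc d * M (suc d)                             ≡⟨ *-distribˡ-+ (suc d) (k C suc d) (l C suc d) ⟩
      suc d * (k C suc d) + suc d * (l C suc d)     ≡⟨ cong₂ _+_ ([1+k]*nC[1+k] k d) ([1+k]*nC[1+k] l d) ⟩
      (k ∸ d) * (k C d) + (l ∸ d) * (l C d)         ≤⟨ +-monoˡ-≤ _ (*-monoˡ-≤ (k C d) (∸-monoˡ-≤ d (s≤s k≤l))) ⟩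
      (l ∸ d) * (k C d) + (l ∸ d) * (l C d)         ≡⟨ *-distribˡ-+ (l ∸ d) (k C d) (l C d) ⟨
      (l ∸ d) * M d                                 ≡⟨ cong (λ z → (z ∸ d) * M d) n∸k≡l ⟨
      (n ∸ k ∸ d) * M d                             ≡⟨ cong (_* M d) (trans (∸-+-assoc n k d) (trans (cong (n ∸_) (+-comm k d)) (sym (∸-+-assoc n d k)))) ⟩
      (n ∸ d ∸ k) * M d                             ∎
      where
      n∸k≡l : n ∸ k ≡ l
      n∸k≡l = m+n∸n≡m l k-1

    -- With `a = n - d`, the factor `(1 - k/a)^(n-1)` is at most `(1 - 1/a)^w`, and
    -- `(1 - d/n)(1 - 1/a) = 1 - (d+1)/n` makes the bound telescope. The induction starts at sets of
    -- size 2 because singletons never cross, so the bound fails for size 1.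
    M-bound : ∀ d → 2 + d ≤ n → M (2 + d) ^ n-1 * n ^ w ≤ (n C (2 + d)) ^ n-1 * (n ∸ (2 + d)) ^ w
    M-bound zero     _   = M-bound-2
    M-bound (suc d-2) d<n = *-cancelˡ-≤ (suc d ^ n-1) {{m^n≢0 (suc d) n-1}} (*-cancelʳ-≤ _ _ (a ^ w) {{m^n≢0 a w}} (begin
      suc d ^ n-1 * (M (suc d) ^ n-1 * n ^ w) * a ^ w              ≡⟨ lem₁ (suc d ^ n-1) (M (suc d) ^ n-1) (n ^ w) (a ^ w) ⟩
      suc d ^ n-1 * M (suc d) ^ n-1 * (n ^ w * a ^ w)              ≡⟨ cong (_* (n ^ w * a ^ w)) (^-distribʳ-* (suc d) (M (suc d)) n-1) ⟨
      (suc d * M (suc d)) ^ n-1 * (n ^ w * a ^ w)                  ≤⟨ *-monoˡ-≤ (n ^ w * a ^ w) (^-monoˡ-≤ n-1 (M-suc d)) ⟩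
      ((n ∸ d ∸ k) * M d) ^ n-1 * (n ^ w * a ^ w)                  ≡⟨ cong (λ z → ((z ∸ k) * M d) ^ n-1 * (n ^ w * a ^ w)) n∸d≡a ⟩
      ((a ∸ k) * M d) ^ n-1 * (n ^ w * a ^ w)                      ≡⟨ cong (_* (n ^ w * a ^ w)) (^-distribʳ-* (a ∸ k) (M d) n-1) ⟩
      (a ∸ k) ^ n-1 * M d ^ n-1 * (n ^ w * a ^ w)                  ≡⟨ lem₂ ((a ∸ k) ^ n-1) (M d ^ n-1) (n ^ w) (a ^ w) ⟩
      (a ∸ k) ^ n-1 * a ^ w * (M d ^ n-1 * n ^ w)                  ≤⟨ *-mono-≤ (bernoulli-∸-power a-1 k n-1 w w≤k*[n-1]) (M-bound d-2 (<⇒≤ d<n)) ⟩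
      a ^ n-1 * a-1 ^ w * (N d ^ n-1 * (n ∸ d) ^ w)                ≡⟨ cong (λ z → a ^ n-1 * a-1 ^ w * (N d ^ n-1 * z ^ w)) n∸d≡a ⟩
      a ^ n-1 * a-1 ^ w * (N d ^ n-1 * a ^ w)                      ≡⟨ lem₃ (a ^ n-1) (a-1 ^ w) (N d ^ n-1) (a ^ w) ⟩
      a ^ n-1 * N d ^ n-1 * a-1 ^ w * a ^ w                        ≡⟨ cong (λ z → z * a-1 ^ w * a ^ w) (^-distribʳ-* a (N d) n-1) ⟨
      (a * N d) ^ n-1 * a-1 ^ w * a ^ w                            ≡⟨ cong (λ z → z ^ n-1 * a-1 ^ w * a ^ w) absorb ⟨
      (suc d * N (suc d)) ^ n-1 * a-1 ^ w * a ^ w                  ≡⟨ cong (λ z → z * a-1 ^ w * a ^ w) (^-distribʳ-* (suc d) (N (suc d)) n-1) ⟩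
      suc d ^ n-1 * N (suc d) ^ n-1 * a-1 ^ w * a ^ w              ≡⟨ cong (_* a ^ w) (*-assoc (suc d ^ n-1) (N (suc d) ^ n-1) (a-1 ^ w)) ⟩
      suc d ^ n-1 * (N (suc d) ^ n-1 * a-1 ^ w) * a ^ w            ∎))
      where
      d = 2 + d-2
      N : ℕ → ℕ
      N d = n C d
      a-1 = n ∸ suc d
      a = suc a-1
      n∸d≡a : n ∸ d ≡ a
      n∸d≡a = +-∸-assoc 1 {n-1} {d} (s≤s⁻¹ d<n)
      absorb : suc d * N (suc d) ≡ a * N d
      absorb = trans ([1+k]*nC[1+k] n d) (cong (_* N d) n∸d≡a)
      lem₁ : ∀ x y z w → x * (y * z) * w ≡ x * y * (z * w)
      lem₁ = solve-∀
      lem₂ : ∀ x y z w → x * y * (z * w) ≡ x * w * (y * z)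
      lem₂ = solve-∀
      lem₃ : ∀ x y z w → x * y * (z * w) ≡ x * z * y * w
      lem₃ = solve-∀

    module _ (d-2 m B-1 : ℕ) (d≤n : 2 + d-2 ≤ n)
             (sparse : 4 * suc B-1 * (4 * suc B-1) * n * (n ∸ (2 + d-2)) ^ m ≤ n ^ m) where
      private
        d = 2 + d-2
        B = suc B-1
        c = 4 * B
        j = n ∸ d
        N = n C d
        X = M d ^ m
        Y = N ^ m

        ^-swap : ∀ x p q → (x ^ p) ^ q ≡ (x ^ q) ^ p
        ^-swap x p q = trans (^-*-assoc x p q) (trans (cong (x ^_) (*-comm p q)) (sym (^-*-assoc x q p)))

        -- The `m`-th power of `M-bound` bounds `(X/Y)^(n-1)` by `q^w`, and `sparse` says
        -- `c² n q ≤ 1`.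
        X^[n-1]-bound : X ^ n-1 * (c * c * n) ^ w ≤ Y ^ n-1
        X^[n-1]-bound = *-cancelʳ-≤ _ _ ((n ^ m) ^ w) {{m^n≢0 (n ^ m) w {{m^n≢0 n m}}}} (begin
          X ^ n-1 * (c * c * n) ^ w * (n ^ m) ^ w            ≡⟨ lem₁ (X ^ n-1) ((c * c * n) ^ w) ((n ^ m) ^ w) ⟩
          X ^ n-1 * (n ^ m) ^ w * (c * c * n) ^ w            ≡⟨ cong (_* (c * c * n) ^ w) (cong₂ _*_ (^-swap (M d) m n-1) (^-swap n m w)) ⟩
          (M d ^ n-1) ^ m * (n ^ w) ^ m * (c * c * n) ^ w    ≡⟨ cong (_* (c * c * n) ^ w) (^-distribʳ-* (M d ^ n-1) (n ^ w) m) ⟨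
          (M d ^ n-1 * n ^ w) ^ m * (c * c * n) ^ w          ≤⟨ *-monoˡ-≤ ((c * c * n) ^ w) (^-monoˡ-≤ m (M-bound d-2 d≤n)) ⟩
          (N ^ n-1 * j ^ w) ^ m * (c * c * n) ^ w            ≡⟨ cong (_* (c * c * n) ^ w) (^-distribʳ-* (N ^ n-1) (j ^ w) m) ⟩
          (N ^ n-1) ^ m * (j ^ w) ^ m * (c * c * n) ^ w      ≡⟨ cong (_* (c * c * n) ^ w) (cong₂ _*_ (^-swap N m n-1) (^-swap j m w)) ⟨
          Y ^ n-1 * (j ^ m) ^ w * (c * c * n) ^ w            ≡⟨ lem₂ (Y ^ n-1) ((j ^ m) ^ w) ((c * c * n) ^ w) ⟩
          Y ^ n-1 * ((c * c * n) ^ w * (j ^ m) ^ w)          ≡⟨ cong (Y ^ n-1 *_) (^-distribʳ-* (c * c * n) (j ^ m) w) ⟨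
          Y ^ n-1 * (c * c * n * j ^ m) ^ w                  ≤⟨ *-monoʳ-≤ (Y ^ n-1) (^-monoˡ-≤ w sparse) ⟩
          Y ^ n-1 * (n ^ m) ^ w                              ∎)
          where
          lem₁ : ∀ x y z → x * y * z ≡ x * z * y
          lem₁ = solve-∀
          lem₂ : ∀ x y z → x * y * z ≡ x * (z * y)
          lem₂ = solve-∀

        -- The powers of `c` and of `n` are treated separately. From `k ≤ l` follows `k (n-1) ≤ 2w`,
        -- which consumes the `c * c` of the hypothesis. The exponent of `n` is
        -- `k (n-1) = w + k (k-1)`, and its excess `k (k-1)` is paid for by `(k ^ k) ^ n-1`.
        [cn]^k-bound : ((c * n) ^ k) ^ n-1 ≤ (c * c * n) ^ w * (k ^ k) ^ n-1
        [cn]^k-bound = begin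
          ((c * n) ^ k) ^ n-1                          ≡⟨ ^-*-assoc (c * n) k n-1 ⟩
          (c * n) ^ (k * n-1)                          ≡⟨ ^-distribʳ-* c n (k * n-1) ⟩
          c ^ (k * n-1) * n ^ (k * n-1)                ≤⟨ *-mono-≤ (^-monoʳ-≤ c k[n-1]≤2w) (≤-reflexive (cong (n ^_) (*-distribˡ-+ k l k-1))) ⟩
          c ^ (2 * w) * n ^ (w + k * k-1)              ≡⟨ cong₂ _*_ c^2w (^-distribˡ-+-* n w (k * k-1)) ⟩
          (c * c) ^ w * (n ^ w * n ^ (k * k-1))        ≡⟨ *-assoc ((c * c) ^ w) (n ^ w) _ ⟨
          (c * c) ^ w * n ^ w * n ^ (k * k-1)          ≡⟨ cong (_* n ^ (k * k-1)) (^-distribʳ-* (c * c) n w) ⟨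
          (c * c * n) ^ w * n ^ (k * k-1)              ≡⟨ cong (λ z → (c * c * n) ^ w * n ^ z) (*-comm k k-1) ⟩
          (c * c * n) ^ w * n ^ (k-1 * k)              ≡⟨ cong ((c * c * n) ^ w *_) (^-*-assoc n k-1 k) ⟨
          (c * c * n) ^ w * (n ^ k-1) ^ k              ≤⟨ *-monoʳ-≤ ((c * c * n) ^ w) (^-monoˡ-≤ k (n^[k-1]≤k^[n-1] k-1 l)) ⟩
          (c * c * n) ^ w * (k ^ n-1) ^ k              ≡⟨ cong ((c * c * n) ^ w *_) (^-swap k n-1 k) ⟩
          (c * c * n) ^ w * (k ^ k) ^ n-1              ∎
          where
          k[n-1]≤2w : k * n-1 ≤ 2 * w
          k[n-1]≤2w = begin
            k * (l + k-1)   ≤⟨ *-monoʳ-≤ k (+-monoʳ-≤ l (≤-trans k≤l (n≤1+n l-1))) ⟩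
            k * (l + l)     ≡⟨ lem k l ⟩
            2 * (k * l)     ∎
            where
            lem : ∀ k l → k * (l + l) ≡ 2 * (k * l)
            lem = solve-∀
          c^2w : c ^ (2 * w) ≡ (c * c) ^ w
          c^2w = trans (sym (^-*-assoc c 2 w)) (cong (λ z → (c * z) ^ w) (*-identityʳ c))

      M^m-bound : M d ^ m * (c * n) ^ k ≤ N ^ m * k ^ k
      M^m-bound = ^-cancelˡ-≤ (l-1 + k-1) (begin
        (X * (c * n) ^ k) ^ n-1                              ≡⟨ ^-distribʳ-* X ((c * n) ^ k) n-1 ⟩
        X ^ n-1 * ((c * n) ^ k) ^ n-1                        ≤⟨ *-monoʳ-≤ (X ^ n-1) [cn]^k-bound ⟩
        X ^ n-1 * ((c * c * n) ^ w * (k ^ k) ^ n-1)          ≡⟨ *-assoc (X ^ n-1) _ _ ⟨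
        X ^ n-1 * (c * c * n) ^ w * (k ^ k) ^ n-1            ≤⟨ *-monoˡ-≤ ((k ^ k) ^ n-1) X^[n-1]-bound ⟩
        Y ^ n-1 * (k ^ k) ^ n-1                              ≡⟨ ^-distribʳ-* Y (k ^ k) n-1 ⟨
        (Y * k ^ k) ^ n-1                                    ∎)

      M≤N : M d ≤ N
      M≤N = ^-cancelˡ-≤ (l-1 + k-1) (*-cancelʳ-≤ _ _ (n ^ w) {{m^n≢0 n w}}
        (≤-trans (M-bound d-2 d≤n) (*-monoʳ-≤ (N ^ n-1) (^-monoˡ-≤ w (m∸n≤m n d)))))

      private
        instance
          Y≢0 : NonZero Y
          Y≢0 = m^n≢0 N m {{>-nonZero (C≢0 d≤n)}}
        lem₁ : ∀ B n → 4 * B * n ≡ B * (4 * n)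
        lem₁ = solve-∀
        step : (n C k) * X * B ^ k ≤ Y
        -- Multiplication by `(4 * n) ^ k` completes `B ^ k` to `(c * n) ^ k`, since `c = 4 * B`.
        step = *-cancelʳ-≤ _ _ ((4 * n) ^ k) {{m^n≢0 (4 * n) k}} (begin
          (n C k) * X * B ^ k * (4 * n) ^ k          ≡⟨ lem₂ (n C k) X (B ^ k) ((4 * n) ^ k) ⟩
          (n C k) * (X * (B ^ k * (4 * n) ^ k))      ≡⟨ cong (λ z → (n C k) * (X * z)) (^-distribʳ-* B (4 * n) k) ⟨
          (n C k) * (X * (B * (4 * n)) ^ k)          ≡⟨ cong (λ z → (n C k) * (X * z ^ k)) (lem₁ B n) ⟨
          (n C k) * (X * (4 * B * n) ^ k)            ≤⟨ *-monoʳ-≤ (n C k) M^m-bound ⟩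
          (n C k) * (Y * k ^ k)                      ≤⟨ *-monoʳ-≤ (n C k) (*-monoʳ-≤ Y (k^k≤4^k*k! k)) ⟩
          (n C k) * (Y * (4 ^ k * k !))              ≡⟨ lem₃ (n C k) Y (4 ^ k) (k !) ⟩
          Y * (4 ^ k * ((n C k) * k !))              ≤⟨ *-monoʳ-≤ Y (*-monoʳ-≤ (4 ^ k) (nCk*k!≤n^k n k)) ⟩
          Y * (4 ^ k * n ^ k)                        ≡⟨ cong (Y *_) (^-distribʳ-* 4 n k) ⟨
          Y * (4 * n) ^ k                            ∎)
          where
          lem₂ : ∀ a b c d → a * b * c * d ≡ a * (b * (c * d))
          lem₂ = solve-∀
          lem₃ : ∀ a b c d → a * (b * (c * d)) ≡ b * (c * (a * d))
          lem₃ = solve-∀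

      uncrossed-count′ : (n C k) * (M d C m) * B ^ k ≤ N C m
      uncrossed-count′ = *-cancelʳ-≤ _ _ Y (begin
        (n C k) * (M d C m) * B ^ k * Y            ≡⟨ lem₂ (n C k) (M d C m) (B ^ k) Y ⟩
        (n C k) * B ^ k * ((M d C m) * Y)          ≤⟨ *-monoʳ-≤ ((n C k) * B ^ k) (C-ratio-≤ M≤N m) ⟩
        (n C k) * B ^ k * ((N C m) * X)            ≡⟨ lem₃ (n C k) (B ^ k) (N C m) X ⟩
        (N C m) * ((n C k) * X * B ^ k)            ≤⟨ *-monoʳ-≤ (N C m) step ⟩
        (N C m) * Y                                ∎)
        where
        lem₂ : ∀ a b c d → a * b * c * d ≡ a * c * (b * d)
        lem₂ = solve-∀
        lem₃ : ∀ a b c d → a * b * (c * d) ≡ c * (a * d * b)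
        lem₃ = solve-∀

  private
    split : ∀ x y → 2 * suc x + y ≡ suc (suc (x + y) + x)
    split = solve-∀

  uncrossed-count : ∀ n k d m B → 1 ≤ k → 2 * k ≤ n → 2 ≤ d → d ≤ n → 1 ≤ B →
    4 * B * (4 * B) * n * (n ∸ d) ^ m ≤ n ^ m →
    (n C k) * ((k C d + (n ∸ k) C d) C m) * B ^ k ≤ (n C d) C m
  uncrossed-count n (suc k-1) (suc (suc d-2)) m (suc B-1) _ 2k≤n (s≤s (s≤s _)) d≤n _ sparse
    -- With `n = 2k + r` the other part has size `k + r`; this gives `n` the shape that
    -- `Bipartition` builds in, and `k ≤ l` as well.
    with r , 2k+r≡n ← m≤n⇒∃[o]m+o≡n 2k≤n
    with refl ← trans (sym 2k+r≡n) (split k-1 r) =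
    subst (λ l → (n C k) * ((k C d + l C d) C m) * suc B-1 ^ k ≤ (n C d) C m)
      (sym (m+n∸n≡m (suc (k-1 + r)) k-1))
      (Bipartition.uncrossed-count′ k-1 (k-1 + r) (m≤m+n k-1 r) d-2 m B-1 d≤n sparse)
    where
    k = suc k-1
    d = suc (suc d-2)

  -- Indicators, finite sums and the counting of hypergraphs

  private
    variable
      A A′ P Q : Set

  𝟙 : Dec P → ℕ
  𝟙 P? = if does P? then 1 else 0

  𝟙-cong : (P? : Dec P) (Q? : Dec Q) → (P → Q) → (Q → P) → 𝟙 P? ≡ 𝟙 Q?
  𝟙-cong (yes _) (yes _) _ _ = refl
  𝟙-cong (yes p) (no ¬q) f _ = contradiction (f p) ¬q
  𝟙-cong (no ¬p) (yes q) _ g = contradiction (g q) ¬p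
  𝟙-cong (no _)  (no _)  _ _ = refl

  𝟙-mono : (P? : Dec P) (Q? : Dec Q) → (P → Q) → 𝟙 P? ≤ 𝟙 Q?
  𝟙-mono (yes _) (yes _) _ = ≤-refl
  𝟙-mono (yes p) (no ¬q) f = contradiction (f p) ¬q
  𝟙-mono (no _)  _       _ = z≤n

  𝟙≤1 : (P? : Dec P) → 𝟙 P? ≤ 1
  𝟙≤1 (yes _) = ≤-refl
  𝟙≤1 (no _)  = z≤n

  𝟙-true : (P? : Dec P) → P → 𝟙 P? ≡ 1
  𝟙-true (yes _) _ = refl
  𝟙-true (no ¬p) p = contradiction p ¬p

  𝟙-false : (P? : Dec P) → ¬ P → 𝟙 P? ≡ 0
  𝟙-false (yes p) ¬p = contradiction p ¬p
  𝟙-false (no _)  _  = refl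

  𝟙-× : (P? : Dec P) (Q? : Dec Q) → 𝟙 (P? ×-dec Q?) ≡ 𝟙 P? * 𝟙 Q?
  𝟙-× (yes _) (yes _) = refl
  𝟙-× (yes _) (no _)  = refl
  𝟙-× (no _)  _       = refl

  𝟙-⊎ : (P? : Dec P) (Q? : Dec Q) → 𝟙 (P? ⊎-dec Q?) ≤ 𝟙 P? + 𝟙 Q?
  𝟙-⊎ (yes _) _       = s≤s z≤n
  𝟙-⊎ (no _)  (yes _) = ≤-refl
  𝟙-⊎ (no _)  (no _)  = ≤-refl

  ∑ : List A → (A → ℕ) → ℕ
  ∑ []       f = 0
  ∑ (x ∷ xs) f = f x + ∑ xs f

  ∑-mono : ∀ (xs : List A) {f g : A → ℕ} → (∀ x → f x ≤ g x) → ∑ xs f ≤ ∑ xs g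
  ∑-mono []       f≤g = z≤n
  ∑-mono (x ∷ xs) f≤g = +-mono-≤ (f≤g x) (∑-mono xs f≤g)

  ∑-cong : ∀ (xs : List A) {f g : A → ℕ} → (∀ x → f x ≡ g x) → ∑ xs f ≡ ∑ xs g
  ∑-cong []       f≡g = refl
  ∑-cong (x ∷ xs) f≡g = cong₂ _+_ (f≡g x) (∑-cong xs f≡g)

  ∑-const : ∀ (xs : List A) c → ∑ xs (λ _ → c) ≡ length xs * c
  ∑-const []       c = refl
  ∑-const (x ∷ xs) c = cong (c +_) (∑-const xs c)

  ∑-zero : ∀ (xs : List A) → ∑ xs (λ _ → 0) ≡ 0
  ∑-zero xs = trans (∑-const xs 0) (*-zeroʳ (length xs))

  ∑-++ : ∀ (xs ys : List A) f → ∑ (xs ++ ys) f ≡ ∑ xs f + ∑ ys f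
  ∑-++ []       ys f = refl
  ∑-++ (x ∷ xs) ys f = trans (cong (f x +_) (∑-++ xs ys f)) (sym (+-assoc (f x) _ _))

  ∑-map : ∀ (h : A → A′) xs f → ∑ (map h xs) f ≡ ∑ xs (f ∘ h)
  ∑-map h []       f = refl
  ∑-map h (x ∷ xs) f = cong (f (h x) +_) (∑-map h xs f)

  ∑-+ : ∀ (xs : List A) f g → ∑ xs (λ x → f x + g x) ≡ ∑ xs f + ∑ xs g
  ∑-+ []       f g = refl
  ∑-+ (x ∷ xs) f g = trans (cong (f x + g x +_) (∑-+ xs f g)) (lem (f x) (g x) (∑ xs f) (∑ xs g))
    where
    lem : ∀ a b c d → a + b + (c + d) ≡ a + c + (b + d)
    lem = solve-∀

  ∑-*ˡ : ∀ (xs : List A) c f → ∑ xs (λ x → c * f x) ≡ c * ∑ xs f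
  ∑-*ˡ []       c f = sym (*-zeroʳ c)
  ∑-*ˡ (x ∷ xs) c f = trans (cong (c * f x +_) (∑-*ˡ xs c f)) (sym (*-distribˡ-+ c (f x) (∑ xs f)))

  ∑-*ʳ : ∀ (xs : List A) f c → ∑ xs (λ x → f x * c) ≡ ∑ xs f * c
  ∑-*ʳ xs f c = trans (∑-cong xs (λ x → *-comm (f x) c)) (trans (∑-*ˡ xs c f) (*-comm c (∑ xs f)))

  ∑-swap : ∀ (xs : List A) (ys : List A′) (f : A → A′ → ℕ) → ∑ xs (λ x → ∑ ys (f x)) ≡ ∑ ys (λ y → ∑ xs (λ x → f x y))
  ∑-swap []       ys f = sym (∑-zero ys)
  ∑-swap (x ∷ xs) ys f = trans (cong (∑ ys (f x) +_) (∑-swap xs ys f)) (sym (∑-+ ys (f x) _))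

  ∑-∈ : ∀ {xs : List A} {x} → x ∈ xs → ∀ f → f x ≤ ∑ xs f
  ∑-∈ (here refl)  f = m≤m+n _ _
  ∑-∈ (there x∈xs) f = ≤-trans (∑-∈ x∈xs f) (m≤n+m _ _)

  ∑-filter : ∀ {P : A → Set} (P? : Decidable P) xs f → ∑ (filter P? xs) f ≡ ∑ xs (λ x → 𝟙 (P? x) * f x)
  ∑-filter P? []       f = refl
  ∑-filter P? (x ∷ xs) f with does (P? x)
  ... | true  = cong₂ _+_ (sym (+-identityʳ (f x))) (∑-filter P? xs f)
  ... | false = ∑-filter P? xs f

  length-∑ : ∀ (xs : List A) → length xs ≡ ∑ xs (λ _ → 1)
  length-∑ xs = sym (trans (∑-const xs 1) (*-identityʳ (length xs)))

  length-filter-∑ : ∀ {P : A → Set} (P? : Decidable P) xs → length (filter P? xs) ≡ ∑ xs (𝟙 ∘ P?)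
  length-filter-∑ P? xs = trans (length-∑ (filter P? xs))
    (trans (∑-filter P? xs (λ _ → 1)) (∑-cong xs (λ x → *-identityʳ (𝟙 (P? x)))))

  -- Pascal's rule: a sublist either omits the head `x` or contains it, and in the latter case `x`
  -- must satisfy `Q`.
  ∑-sublists : ∀ {Q : A → Set} (Q? : Decidable Q) xs m →
    ∑ (sublists xs) (λ ys → 𝟙 (length ys ≟ m) * 𝟙 (all? Q? ys)) ≡ ∑ xs (𝟙 ∘ Q?) C m
  ∑-sublists Q? []       zero    = refl
  ∑-sublists Q? []       (suc m) = refl
  ∑-sublists {Q = Q} Q? (x ∷ xs) m = begin-equality
    ∑ (map (x ∷_) (sublists xs) ++ sublists xs) (wt m)        ≡⟨ ∑-++ (map (x ∷_) (sublists xs)) (sublists xs) (wt m) ⟩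
    ∑ (map (x ∷_) (sublists xs)) (wt m) + ∑ (sublists xs) (wt m) ≡⟨ cong₂ _+_ (∑-map (x ∷_) (sublists xs) (wt m)) (∑-sublists Q? xs m) ⟩
    ∑ (sublists xs) (wt m ∘ (x ∷_)) + c C m                   ≡⟨ go m ⟩
    (𝟙 (Q? x) + c) C m                                        ∎
    where
    c = ∑ xs (𝟙 ∘ Q?)
    wt : ℕ → List _ → ℕ
    wt m ys = 𝟙 (length ys ≟ m) * 𝟙 (all? Q? ys)
    wt-∷ : ∀ m ys → wt (suc m) (x ∷ ys) ≡ 𝟙 (Q? x) * wt m ys
    wt-∷ m ys = trans (cong (𝟙 (length ys ≟ m) *_) (𝟙-× (Q? x) (all? Q? ys))) (lem (𝟙 (length ys ≟ m)) (𝟙 (Q? x)) (𝟙 (all? Q? ys)))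
      where
      lem : ∀ a b c → a * (b * c) ≡ b * (a * c)
      lem = solve-∀
    pascal-𝟙 : ∀ {P : Set} (P? : Dec P) m → 𝟙 P? * (c C m) + c C suc m ≡ (𝟙 P? + c) C suc m
    pascal-𝟙 (yes _) m = trans (cong (_+ c C suc m) (+-identityʳ (c C m))) (sym (pascal c m))
    pascal-𝟙 (no _)  m = refl
    go : ∀ m → ∑ (sublists xs) (wt m ∘ (x ∷_)) + c C m ≡ (𝟙 (Q? x) + c) C m
    go zero    = cong (_+ 1) (∑-zero (sublists xs))
    go (suc m) = begin-equality
      ∑ (sublists xs) (wt (suc m) ∘ (x ∷_)) + c C suc m         ≡⟨ cong (_+ c C suc m) (∑-cong (sublists xs) (wt-∷ m)) ⟩
      ∑ (sublists xs) (λ ys → 𝟙 (Q? x) * wt m ys) + c C suc m   ≡⟨ cong (_+ c C suc m) (∑-*ˡ (sublists xs) (𝟙 (Q? x)) (wt m)) ⟩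
      𝟙 (Q? x) * ∑ (sublists xs) (wt m) + c C suc m             ≡⟨ cong (λ z → 𝟙 (Q? x) * z + c C suc m) (∑-sublists Q? xs m) ⟩
      𝟙 (Q? x) * (c C m) + c C suc m                            ≡⟨ pascal-𝟙 (Q? x) m ⟩
      (𝟙 (Q? x) + c) C suc m                                    ∎

  ∑-⊆ : ∀ {n} (S : Subset n) d → ∑ (allSubsets n) (λ e → 𝟙 (e ⊆? S) * 𝟙 (∣ e ∣ ≟ d)) ≡ ∣ S ∣ C d
  ∑-⊆ []      zero    = refl
  ∑-⊆ []      (suc d) = refl
  ∑-⊆ {suc n} (s ∷ S) d = begin-equality
    ∑ (allSubsets (suc n)) (wt (s ∷ S) d)                     ≡⟨ ∑-++ (map (inside ∷_) (allSubsets n)) _ (wt (s ∷ S) d) ⟩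
    ∑ (map (inside ∷_) (allSubsets n)) (wt (s ∷ S) d) + ∑ (map (outside ∷_) (allSubsets n)) (wt (s ∷ S) d)
                                                              ≡⟨ cong₂ _+_ (∑-map (inside ∷_) (allSubsets n) (wt (s ∷ S) d)) (∑-map (outside ∷_) (allSubsets n) (wt (s ∷ S) d)) ⟩
    ∑ (allSubsets n) (wt (s ∷ S) d ∘ (inside ∷_)) + ∑ (allSubsets n) (wt S d)
                                                              ≡⟨ cong (∑ (allSubsets n) (wt (s ∷ S) d ∘ (inside ∷_)) +_) (∑-⊆ S d) ⟩
    ∑ (allSubsets n) (wt (s ∷ S) d ∘ (inside ∷_)) + ∣ S ∣ C d   ≡⟨ go s d ⟩
    ∣ s ∷ S ∣ C d                                               ∎
    where
    wt : ∀ {n} → Subset n → ℕ → Subset n → ℕ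
    wt S d e = 𝟙 (e ⊆? S) * 𝟙 (∣ e ∣ ≟ d)
    go : ∀ s d → ∑ (allSubsets n) (wt (s ∷ S) d ∘ (inside ∷_)) + ∣ S ∣ C d ≡ ∣ s ∷ S ∣ C d
    go outside d       = cong (_+ ∣ S ∣ C d) (∑-zero (allSubsets n))
    go inside  zero    = cong (_+ 1) (trans (∑-cong (allSubsets n) (λ e → *-zeroʳ (𝟙 (e ⊆? S)))) (∑-zero (allSubsets n)))
    go inside  (suc d) = trans (cong (_+ ∣ S ∣ C suc d) (∑-⊆ S d)) (sym (pascal ∣ S ∣ d))

  #edges : ∀ n d {Q : Subset n → Set} → Decidable Q → ℕ
  #edges n d Q? = ∑ (allSubsets n) (λ e → 𝟙 (Q? e) * 𝟙 (∣ e ∣ ≟ d))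

  ∣p∣>0⇒Nonempty : ∀ {n} (p : Subset n) → 1 ≤ ∣ p ∣ → Nonempty p
  ∣p∣>0⇒Nonempty {n} p 1≤∣p∣ with nonempty? p
  ... | yes p≢∅ = p≢∅
  ... | no  p≡∅ rewrite Empty-unique p≡∅ | ∣⊥∣≡0 n = contradiction 1≤∣p∣ λ ()

  Nonempty⇒∣p∣>0 : ∀ {n} {p : Subset n} → Nonempty p → 1 ≤ ∣ p ∣
  Nonempty⇒∣p∣>0 (x , x∈p) = ≤-trans (s≤s z≤n) (x∈p⇒∣p-x∣<∣p∣ x∈p)

  -- Having size `d` and satisfying `Q` are both conditions on single hyperedges, so what remains is
  -- a free choice of `m` admissible sets. By `1 ≤ d`, the restriction to nonempty sets removes none
  -- of them. The total, the isolation counts and the uncrossed counts are all instances or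
  -- consequences.
  ∑-hypergraphs : ∀ n m d {Q : Subset n → Set} (Q? : Decidable Q) → 1 ≤ d →
    ∑ (hypergraphs n m d) (𝟙 ∘ all? Q?) ≡ #edges n d Q? C m
  ∑-hypergraphs n m d {Q} Q? 1≤d = begin-equality
    ∑ (hypergraphs n m d) (𝟙 ∘ all? Q?)
      ≡⟨ ∑-filter (hasShape? m d) (sublists E) (𝟙 ∘ all? Q?) ⟩
    ∑ (sublists E) (λ H → 𝟙 (hasShape? m d H) * 𝟙 (all? Q? H))
      ≡⟨ ∑-cong (sublists E) merge ⟩
    ∑ (sublists E) (λ H → 𝟙 (length H ≟ m) * 𝟙 (all? R? H))
      ≡⟨ ∑-sublists R? E m ⟩
    ∑ E (𝟙 ∘ R?) C m
      ≡⟨ cong (_C m) (trans (∑-filter nonempty? (allSubsets n) (𝟙 ∘ R?)) (∑-cong (allSubsets n) drop-nonempty)) ⟩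
    #edges n d Q? C m ∎
    where
    E = filter nonempty? (allSubsets n)
    R? : Decidable (λ e → Q e × ∣ e ∣ ≡ d)
    R? e = Q? e ×-dec (∣ e ∣ ≟ d)
    size? : Decidable (λ (e : Subset n) → ∣ e ∣ ≡ d)
    size? e = ∣ e ∣ ≟ d
    merge : ∀ H → 𝟙 (hasShape? m d H) * 𝟙 (all? Q? H) ≡ 𝟙 (length H ≟ m) * 𝟙 (all? R? H)
    merge H = begin-equality
      𝟙 (hasShape? m d H) * 𝟙 (all? Q? H)                         ≡⟨ cong (_* 𝟙 (all? Q? H)) (𝟙-× (length H ≟ m) (all? size? H)) ⟩
      𝟙 (length H ≟ m) * 𝟙 (all? size? H) * 𝟙 (all? Q? H)         ≡⟨ *-assoc (𝟙 (length H ≟ m)) _ _ ⟩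
      𝟙 (length H ≟ m) * (𝟙 (all? size? H) * 𝟙 (all? Q? H))       ≡⟨ cong (𝟙 (length H ≟ m) *_) (𝟙-× (all? size? H) (all? Q? H)) ⟨
      𝟙 (length H ≟ m) * 𝟙 (all? size? H ×-dec all? Q? H)         ≡⟨ cong (𝟙 (length H ≟ m) *_) (𝟙-cong (all? size? H ×-dec all? Q? H) (all? R? H)
                                                                       (λ (s , q) → All.zip (q , s)) (λ r → proj₂ (All.unzip r) , proj₁ (All.unzip r))) ⟩
      𝟙 (length H ≟ m) * 𝟙 (all? R? H)                            ∎
    drop-nonempty : ∀ e → 𝟙 (nonempty? e) * 𝟙 (R? e) ≡ 𝟙 (Q? e) * 𝟙 (∣ e ∣ ≟ d)
    drop-nonempty e = begin-equality
      𝟙 (nonempty? e) * 𝟙 (R? e)       ≡⟨ 𝟙-× (nonempty? e) (R? e) ⟨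
      𝟙 (nonempty? e ×-dec R? e)       ≡⟨ 𝟙-cong (nonempty? e ×-dec R? e) (R? e) proj₂
                                            (λ r → ∣p∣>0⇒Nonempty e (≤-trans 1≤d (≤-reflexive (sym (proj₂ r)))) , r) ⟩
      𝟙 (R? e)                         ≡⟨ 𝟙-× (Q? e) (∣ e ∣ ≟ d) ⟩
      𝟙 (Q? e) * 𝟙 (∣ e ∣ ≟ d)         ∎

  Within : ∀ {n} → Subset n → Hypergraph n → Set
  Within S = All (_⊆ S)

  within? : ∀ {n} (S : Subset n) → Decidable (Within S)
  within? S = all? (_⊆? S)

  ∑-within : ∀ n m d (S : Subset n) → 1 ≤ d → ∑ (hypergraphs n m d) (𝟙 ∘ within? S) ≡ (∣ S ∣ C d) C m
  ∑-within n m d S 1≤d = trans (∑-hypergraphs n m d (_⊆? S) 1≤d) (cong (_C m) (∑-⊆ S d))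

  length-hypergraphs : ∀ n m d → 1 ≤ d → length (hypergraphs n m d) ≡ (n C d) C m
  length-hypergraphs n m d 1≤d = begin-equality
    length (hypergraphs n m d)                       ≡⟨ length-∑ (hypergraphs n m d) ⟩
    ∑ (hypergraphs n m d) (λ _ → 1)                  ≡⟨ ∑-cong (hypergraphs n m d) (λ H → 𝟙-true (within? ⊤ H) (All.universal (λ e {x} → ⊆⊤ {p = e}) H)) ⟨
    ∑ (hypergraphs n m d) (𝟙 ∘ within? ⊤)            ≡⟨ ∑-within n m d ⊤ 1≤d ⟩
    (∣ ⊤ {n} ∣ C d) C m                              ≡⟨ cong (λ k → (k C d) C m) (∣⊤∣≡n n) ⟩
    (n C d) C m                                      ∎

  ∑-size : ∀ n k → ∑ (allSubsets n) (λ S → 𝟙 (∣ S ∣ ≟ k)) ≡ n C k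
  ∑-size n k = begin-equality
    ∑ (allSubsets n) (λ S → 𝟙 (∣ S ∣ ≟ k))                     ≡⟨ ∑-cong (allSubsets n) (λ S → trans (cong (_* 𝟙 (∣ S ∣ ≟ k)) (𝟙-true (S ⊆? ⊤) ⊆⊤)) (+-identityʳ _)) ⟨
    ∑ (allSubsets n) (λ S → 𝟙 (S ⊆? ⊤) * 𝟙 (∣ S ∣ ≟ k))        ≡⟨ ∑-⊆ {n} ⊤ k ⟩
    ∣ ⊤ {n} ∣ C k                                              ≡⟨ cong (_C k) (∣⊤∣≡n n) ⟩
    n C k                                                      ∎

  ∈-allSubsets : ∀ {n} (S : Subset n) → S ∈ allSubsets n
  ∈-allSubsets []            = here refl
  ∈-allSubsets (inside ∷ S)  = ∈-++⁺ˡ (∈-map⁺ (inside ∷_) (∈-allSubsets S))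
  ∈-allSubsets (outside ∷ S) = ∈-++⁺ʳ _ (∈-map⁺ (outside ∷_) (∈-allSubsets S))

  -- Isolated vertices and the second moment

  vertices : ∀ n → List (Fin n)
  vertices zero    = []
  vertices (suc n) = zero ∷ map suc (vertices n)

  length-vertices : ∀ n → length (vertices n) ≡ n
  length-vertices zero    = refl
  length-vertices (suc n) = cong suc (trans (length-map suc (vertices n)) (length-vertices n))

  ∑-≟ : ∀ {n} (v : Fin n) → ∑ (vertices n) (λ w → 𝟙 (v Fin.≟ w)) ≡ 1
  ∑-≟ {suc n} zero    = cong suc (trans (∑-map suc (vertices n) _) (∑-zero (vertices n)))
  ∑-≟ {suc n} (suc v) = trans (∑-map suc (vertices n) _)
    (trans (∑-cong (vertices n) (λ w → 𝟙-cong (suc v Fin.≟ suc w) (v Fin.≟ w) Fin.suc-injective (cong suc))) (∑-≟ v))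

  -- Avoiding `v` is phrased as containment in a fixed set, so that `∑-within` counts it.
  Isolated : ∀ {n} → Hypergraph n → Fin n → Set
  Isolated H v = Within (∁ ⁅ v ⁆) H

  isolated? : ∀ {n} (H : Hypergraph n) → Decidable (Isolated H)
  isolated? H v = within? (∁ ⁅ v ⁆) H

  #isolated : ∀ {n} → Hypergraph n → ℕ
  #isolated {n} H = ∑ (vertices n) (𝟙 ∘ isolated? H)

  ∣∁⁅v⁆∣≡n∸1 : ∀ {n} (v : Fin n) → ∣ ∁ ⁅ v ⁆ ∣ ≡ n ∸ 1
  ∣∁⁅v⁆∣≡n∸1 {n} v = trans (∣∁p∣≡n∸∣p∣ ⁅ v ⁆) (cong (n ∸_) (∣⁅x⁆∣≡1 v))

  v∉∁⁅v⁆ : ∀ {n} (v : Fin n) → v ∉ˢ ∁ ⁅ v ⁆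
  v∉∁⁅v⁆ v = x∈p⇒x∉∁p (x∈⁅x⁆ v)

  w∈∁⁅v⁆ : ∀ {n} {v w : Fin n} → v ≢ w → w ∈ˢ ∁ ⁅ v ⁆
  w∈∁⁅v⁆ {v = v} v≢w = x∉p⇒x∈∁p (λ w∈ → v≢w (sym (x∈⁅y⁆⇒x≡y v w∈)))

  -- The violated partition is `v` against the rest; `2 ≤ n` makes the rest nonempty.
  connected⇒¬isolated : ∀ {n} → 2 ≤ n → (H : Hypergraph n) → Connected H → ∀ v → ¬ Isolated H v
  connected⇒¬isolated {n} 2≤n H conn v iso = All¬⇒¬Any (All.map uncrossed iso)
    (conn ⁅ v ⁆ (∁ ⁅ v ⁆) ((v , x∈⁅x⁆ v) , other , p∪∁p≡⊤ ⁅ v ⁆ , ∩-inverseʳ ⁅ v ⁆))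
    where
    other : Nonempty (∁ ⁅ v ⁆)
    other = ∣p∣>0⇒Nonempty (∁ ⁅ v ⁆) (≤-trans (∸-monoˡ-≤ 1 2≤n) (≤-reflexive (sym (∣∁⁅v⁆∣≡n∸1 v))))
    uncrossed : ∀ {e} → e ⊆ ∁ ⁅ v ⁆ → ¬ (Nonempty (e ∩ ⁅ v ⁆) × Nonempty (e ∩ ∁ ⁅ v ⁆))
    uncrossed {e} e⊆ ((x , x∈) , _) = let x∈e , x∈v = x∈p∩q⁻ e ⁅ v ⁆ x∈ in x∈p⇒x∉∁p x∈v (e⊆ x∈e)

  #connected : ℕ → ℕ → ℕ → ℕ
  #connected n m d = length (filter connected? (hypergraphs n m d))

  -- Chebyshev: the sum of (u - T X)² is at least u² times the number of zeros of X;
  -- the mixed term is moved to the left so that no subtraction occurs.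
  secondMoment : ∀ {A : Set} (Ω : List A) {P : A → Set} (P? : Decidable P) (X : A → ℕ) T u →
    (∀ x → P x → X x ≡ 0) → length Ω ≡ T → ∑ Ω X ≡ u → T * ∑ Ω (λ x → X x * X x) ≤ u * (T + u) →
    length (filter P? Ω) * u ≤ T * T
  secondMoment Ω P? X T zero        _    _    _  _   = ≤-trans (≤-reflexive (*-zeroʳ (length (filter P? Ω)))) z≤n
  secondMoment Ω {P} P? X T u@(suc _) P⇒0 ∣Ω∣≡T ∑X ∑X² = *-cancelʳ-≤ _ _ u (+-cancelˡ-≤ (2 * (T * (u * u))) _ _ (begin
    2 * (T * (u * u)) + Z * u * u                          ≡⟨ lem₁ T u Z ⟩
    2 * (T * u) * u + u * u * Z                            ≡⟨ cong₂ (λ a b → 2 * (T * u) * a + u * u * b) (sym ∑X) (length-filter-∑ P? Ω) ⟩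
    2 * (T * u) * ∑ Ω X + u * u * ∑ Ω (𝟙 ∘ P?)             ≡⟨ cong₂ _+_ (∑-*ˡ Ω (2 * (T * u)) X) (∑-*ˡ Ω (u * u) (𝟙 ∘ P?)) ⟨
    ∑ Ω (λ x → 2 * (T * u) * X x) + ∑ Ω (λ x → u * u * 𝟙 (P? x))
                                                           ≡⟨ ∑-+ Ω _ _ ⟨
    ∑ Ω (λ x → 2 * (T * u) * X x + u * u * 𝟙 (P? x))       ≤⟨ ∑-mono Ω (λ x → pointwise x (P? x)) ⟩
    ∑ Ω (λ x → u * u + T * T * (X x * X x))                ≡⟨ ∑-+ Ω (λ _ → u * u) _ ⟩
    ∑ Ω (λ _ → u * u) + ∑ Ω (λ x → T * T * (X x * X x))    ≡⟨ cong₂ _+_ (∑-const Ω (u * u)) (∑-*ˡ Ω (T * T) _) ⟩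
    length Ω * (u * u) + T * T * S                         ≡⟨ cong₂ _+_ (cong (_* (u * u)) ∣Ω∣≡T) (*-assoc T T S) ⟩
    T * (u * u) + T * (T * S)                              ≤⟨ +-monoʳ-≤ (T * (u * u)) (*-monoʳ-≤ T ∑X²) ⟩
    T * (u * u) + T * (u * (T + u))                        ≡⟨ lem₂ T u ⟩
    2 * (T * (u * u)) + T * T * u                          ∎))
    where
    Z = length (filter P? Ω)
    S = ∑ Ω (λ x → X x * X x)
    lem₁ : ∀ T u Z → 2 * (T * (u * u)) + Z * u * u ≡ 2 * (T * u) * u + u * u * Z
    lem₁ = solve-∀
    lem₂ : ∀ T u → T * (u * u) + T * (u * (T + u)) ≡ 2 * (T * (u * u)) + T * T * u
    lem₂ = solve-∀
    lem₃ : ∀ T u x → 2 * (T * u) * x + u * u * 0 ≡ 2 * (u * (T * x))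
    lem₃ = solve-∀
    lem₄ : ∀ T u x → u * u + T * x * (T * x) ≡ u * u + T * T * (x * x)
    lem₄ = solve-∀
    lem₅ : ∀ T u → 2 * (T * u) * 0 + u * u * 1 ≡ u * u + T * T * 0
    lem₅ = solve-∀
    pointwise : ∀ x (Px? : Dec (P x)) → 2 * (T * u) * X x + u * u * 𝟙 Px? ≤ u * u + T * T * (X x * X x)
    pointwise x (no _) = begin
      2 * (T * u) * X x + u * u * 0          ≡⟨ lem₃ T u (X x) ⟩
      2 * (u * (T * X x))                    ≤⟨ 2xy≤x²+y² u (T * X x) ⟩
      u * u + T * X x * (T * X x)            ≡⟨ lem₄ T u (X x) ⟩
      u * u + T * T * (X x * X x)            ∎
    pointwise x (yes p) rewrite P⇒0 x p = ≤-reflexive (lem₅ T u)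

  -- Isolation of two vertices is negatively correlated, `A₂/T ≤ (A₁/T)²`. The log-concavity passes
  -- from the numbers of available d-sets to the numbers of m-subsets of them.
  C-pair-≤ : ∀ n m d → 2 ≤ n → 1 ≤ d →
    (((n ∸ 2) C d) C m) * ((n C d) C m) ≤ (((n ∸ 1) C d) C m) * (((n ∸ 1) C d) C m)
  C-pair-≤ (suc (suc n)) m (suc d) (s≤s (s≤s _)) _ =
    C-logConcave (C-suc-mono n (suc d)) (C-suc-mono (suc n) (suc d)) (nCd-logConcave n (suc d)) (nCd-convex n d) m

  module SecondMoment (n m d : ℕ) (2≤n : 2 ≤ n) (1≤d : 1 ≤ d) where
    T A₁ A₂ : ℕ
    T = (n C d) C m
    A₁ = ((n ∸ 1) C d) C m
    A₂ = ((n ∸ 2) C d) C m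

    Ω : List (Hypergraph n)
    Ω = hypergraphs n m d

    X : Hypergraph n → ℕ
    X = #isolated

    ∑X : ∑ Ω X ≡ n * A₁
    ∑X = begin-equality
      ∑ Ω X                                                         ≡⟨ ∑-swap Ω (vertices n) (λ H v → 𝟙 (isolated? H v)) ⟩
      ∑ (vertices n) (λ v → ∑ Ω (𝟙 ∘ within? (∁ ⁅ v ⁆)))            ≡⟨ ∑-cong (vertices n) (λ v → trans (∑-within n m d (∁ ⁅ v ⁆) 1≤d) (cong (λ k → (k C d) C m) (∣∁⁅v⁆∣≡n∸1 v))) ⟩
      ∑ (vertices n) (λ _ → A₁)                                     ≡⟨ ∑-const (vertices n) A₁ ⟩
      length (vertices n) * A₁                                      ≡⟨ cong (_* A₁) (length-vertices n) ⟩
      n * A₁                                                        ∎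

    -- On the diagonal `A₂` is given away, so that one formula covers all pairs and the double sum
    -- splits into `n A₁ + n² A₂`.
    pair-bound : ∀ v w → ∑ Ω (λ H → 𝟙 (isolated? H v) * 𝟙 (isolated? H w)) ≤ 𝟙 (v Fin.≟ w) * A₁ + A₂
    pair-bound v w with v Fin.≟ w
    ... | yes _ = begin
      ∑ Ω (λ H → 𝟙 (isolated? H v) * 𝟙 (isolated? H w))   ≤⟨ ∑-mono Ω (λ H → ≤-trans (*-monoʳ-≤ (𝟙 (isolated? H v)) (𝟙≤1 (isolated? H w))) (≤-reflexive (*-identityʳ _))) ⟩
      ∑ Ω (𝟙 ∘ within? (∁ ⁅ v ⁆))                         ≡⟨ trans (∑-within n m d (∁ ⁅ v ⁆) 1≤d) (cong (λ k → (k C d) C m) (∣∁⁅v⁆∣≡n∸1 v)) ⟩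
      A₁                                                  ≡⟨ +-identityʳ A₁ ⟨
      1 * A₁                                              ≤⟨ m≤m+n (1 * A₁) A₂ ⟩
      1 * A₁ + A₂                                         ∎
    ... | no v≢w = begin
      ∑ Ω (λ H → 𝟙 (isolated? H v) * 𝟙 (isolated? H w))   ≤⟨ ∑-mono Ω (λ H → ≤-trans (≤-reflexive (sym (𝟙-× (isolated? H v) (isolated? H w))))
                                                               (𝟙-mono (isolated? H v ×-dec isolated? H w) (within? S H) (both H))) ⟩
      ∑ Ω (𝟙 ∘ within? S)                                 ≡⟨ ∑-within n m d S 1≤d ⟩
      (∣ S ∣ C d) C m                                     ≤⟨ C-monoˡ-≤ m (C-monoˡ-≤ d ∣S∣≤n-2) ⟩
      A₂                                                  ∎
      where
      S = ∁ ⁅ v ⁆ - w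
      ∣S∣≤n-2 : ∣ S ∣ ≤ n ∸ 2
      ∣S∣≤n-2 = ≤-trans (∸-monoˡ-≤ 1 (≤-trans (x∈p⇒∣p-x∣<∣p∣ (w∈∁⁅v⁆ v≢w)) (≤-reflexive (∣∁⁅v⁆∣≡n∸1 v)))) (≤-reflexive (∸-+-assoc n 1 1))
      inS : ∀ {e : Subset n} → e ⊆ ∁ ⁅ v ⁆ × e ⊆ ∁ ⁅ w ⁆ → e ⊆ S
      inS (e⊆v , e⊆w) x∈e = x∈p∧x≢y⇒x∈p-y (e⊆v x∈e) (λ { refl → v∉∁⁅v⁆ w (e⊆w x∈e) })
      both : ∀ H → Isolated H v × Isolated H w → Within S H
      both H iso = All.map (λ h {x} → inS h {x}) (All.zip iso)

    ∑X² : ∑ Ω (λ H → X H * X H) ≤ n * A₁ + n * n * A₂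
    ∑X² = begin
      ∑ Ω (λ H → X H * X H)                                                ≡⟨ ∑-cong Ω square ⟩
      ∑ Ω (λ H → ∑ V (λ v → ∑ V (λ w → I H v * I H w)))                    ≡⟨ ∑-swap Ω V (λ H v → ∑ V (λ w → I H v * I H w)) ⟩
      ∑ V (λ v → ∑ Ω (λ H → ∑ V (λ w → I H v * I H w)))                    ≡⟨ ∑-cong V (λ v → ∑-swap Ω V (λ H w → I H v * I H w)) ⟩
      ∑ V (λ v → ∑ V (λ w → ∑ Ω (λ H → I H v * I H w)))                    ≤⟨ ∑-mono V (λ v → ∑-mono V (pair-bound v)) ⟩
      ∑ V (λ v → ∑ V (λ w → 𝟙 (v Fin.≟ w) * A₁ + A₂))                      ≡⟨ ∑-cong V row ⟩
      ∑ V (λ _ → A₁ + n * A₂)                                              ≡⟨ trans (∑-const V (A₁ + n * A₂)) (cong (_* (A₁ + n * A₂)) (length-vertices n)) ⟩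
      n * (A₁ + n * A₂)                                                    ≡⟨ lem n A₁ A₂ ⟩
      n * A₁ + n * n * A₂                                                  ∎
      where
      V = vertices n
      I : Hypergraph n → Fin n → ℕ
      I H v = 𝟙 (isolated? H v)
      lem : ∀ n a b → n * (a + n * b) ≡ n * a + n * n * b
      lem = solve-∀
      square : ∀ H → X H * X H ≡ ∑ V (λ v → ∑ V (λ w → I H v * I H w))
      square H = trans (sym (∑-*ʳ V (I H) (X H))) (∑-cong V (λ v → sym (∑-*ˡ V (I H v) (I H))))
      row : ∀ v → ∑ V (λ w → 𝟙 (v Fin.≟ w) * A₁ + A₂) ≡ A₁ + n * A₂
      row v = trans (∑-+ V (λ w → 𝟙 (v Fin.≟ w) * A₁) (λ _ → A₂)) (cong₂ _+_
        (trans (∑-*ʳ V (λ w → 𝟙 (v Fin.≟ w)) A₁) (trans (cong (_* A₁) (∑-≟ v)) (+-identityʳ A₁)))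
        (trans (∑-const V A₂) (cong (_* A₂) (length-vertices n))))

    connected-bound : #connected n m d * (n * A₁) ≤ T * T
    connected-bound = secondMoment Ω connected? X T (n * A₁) no-isolated (length-hypergraphs n m d 1≤d) ∑X (begin
      T * ∑ Ω (λ H → X H * X H)           ≤⟨ *-monoʳ-≤ T ∑X² ⟩
      T * (n * A₁ + n * n * A₂)           ≡⟨ lem₁ T n A₁ A₂ ⟩
      n * A₁ * T + n * n * (A₂ * T)       ≤⟨ +-monoʳ-≤ (n * A₁ * T) (*-monoʳ-≤ (n * n) (C-pair-≤ n m d 2≤n 1≤d)) ⟩
      n * A₁ * T + n * n * (A₁ * A₁)      ≡⟨ lem₂ T n A₁ ⟩
      n * A₁ * (T + n * A₁)               ∎)
      where
      lem₁ : ∀ T n a b → T * (n * a + n * n * b) ≡ n * a * T + n * n * (b * T)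
      lem₁ = solve-∀
      lem₂ : ∀ T n a → n * a * T + n * n * (a * a) ≡ n * a * (T + n * a)
      lem₂ = solve-∀
      no-isolated : ∀ H → Connected H → X H ≡ 0
      no-isolated H conn = trans (∑-cong (vertices n) (λ v → 𝟙-false (isolated? H v) (connected⇒¬isolated 2≤n H conn v)))
        (∑-zero (vertices n))

  -- Below the threshold: comparing the mean number of isolated vertices with `n q`

  m≤2^m : ∀ m → m ≤ 2 ^ m
  m≤2^m zero    = z≤n
  m≤2^m (suc m) = begin
    1 + m            ≤⟨ +-mono-≤ (m^n>0 2 m) (m≤2^m m) ⟩
    2 ^ m + 2 ^ m    ≡⟨ cong (2 ^ m +_) (+-identityʳ (2 ^ m)) ⟨
    2 * 2 ^ m        ∎

  m*[m-1]≤2*2^m : ∀ m → m * pred m ≤ 2 * 2 ^ m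
  m*[m-1]≤2*2^m zero          = z≤n
  m*[m-1]≤2*2^m (suc zero)    = z≤n
  m*[m-1]≤2*2^m (suc (suc p)) = begin
    (2 + p) * (1 + p)                     ≡⟨ lem₁ p ⟩
    (1 + p) * p + 2 * (1 + p)             ≤⟨ +-mono-≤ (m*[m-1]≤2*2^m (suc p)) (*-monoʳ-≤ 2 (m≤2^m (suc p))) ⟩
    2 * 2 ^ suc p + 2 * 2 ^ suc p         ≡⟨ lem₂ (2 ^ suc p) ⟩
    2 * (2 * 2 ^ suc p)                   ∎
    where
    lem₁ : ∀ p → (2 + p) * (1 + p) ≡ (1 + p) * p + 2 * (1 + p)
    lem₁ = solve-∀
    lem₂ : ∀ x → 2 * x + 2 * x ≡ 2 * (2 * x)
    lem₂ = solve-∀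

  m≤16*m² : ∀ m → m ≤ 16 * (m * m)
  m≤16*m² zero    = z≤n
  m≤16*m² (suc p) = ≤-trans (m≤m*n (suc p) (suc p)) (m≤m+n _ _)

  -- For d ≤ n/2 this follows from N₁ ≥ N/2. For larger d the threshold condition forces 2^m ≤ n/K.
  m[m-1]≤N₁ : ∀ n m d K → 1 ≤ n → 1 ≤ m → 1 ≤ d → d ≤ n → 8 ≤ K →
    16 * (m * m) ≤ n C d → K * n ^ m ≤ n * (n ∸ d) ^ m →
    2 * (m * pred m) ≤ (n ∸ 1) C d
  m[m-1]≤N₁ (suc n-1) m@(suc p) d K _ _ 1≤d d≤n 8≤K m²≤N dense with ≤-<-connex (suc n-1) (2 * (suc n-1 ∸ d))
  ... | inj₁ n≤2j = *-cancelˡ-≤ (2 * n) (begin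
    2 * n * (2 * (m * p))         ≤⟨ *-monoʳ-≤ (2 * n) (*-monoʳ-≤ 2 (*-monoʳ-≤ m (n≤1+n p))) ⟩
    2 * n * (2 * (m * m))         ≡⟨ lem₁ n (m * m) ⟩
    n * (4 * (m * m))             ≤⟨ *-monoʳ-≤ n (≤-trans (*-monoˡ-≤ (m * m) {4} {16} (m≤m+n 4 12)) m²≤N) ⟩
    n * N                         ≤⟨ *-monoˡ-≤ N n≤2j ⟩
    2 * j * N                     ≡⟨ *-assoc 2 j N ⟩
    2 * (j * N)                   ≡⟨ cong (2 *_) ([1+n∸k]*[1+n]Ck n-1 d) ⟩
    2 * (n * (n-1 C d))           ≡⟨ *-assoc 2 n (n-1 C d) ⟨
    2 * n * (n-1 C d)             ∎)
    where
    n = suc n-1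
    N = n C d
    j = n ∸ d
    lem₁ : ∀ n x → 2 * n * (2 * x) ≡ n * (4 * x)
    lem₁ = solve-∀
  ... | inj₂ 2j<n = begin
    2 * (m * p)              ≤⟨ *-monoʳ-≤ 2 (m*[m-1]≤2*2^m m) ⟩
    2 * (2 * 2 ^ m)          ≤⟨ s≤s⁻¹ bound ⟩
    n-1                      ≤⟨ n≤nCk n-1 d 1≤d d<n-1 ⟩
    n-1 C d                  ∎
    where
    n = suc n-1
    j = n ∸ d
    -- If `j ≤ 1`, then `n * j ^ m ≤ n` contradicts `dense`. So `d < n-1`, which is what makes
    -- `C(n-1,d)` at least `n-1`.
    2≤j : 2 ≤ j
    2≤j = ≰⇒> λ j≤1 → <⇒≱ {n} {8 * n} n<8n (begin
      8 * n             ≤⟨ *-mono-≤ 8≤K (m≤m*n n (n ^ p) {{m^n≢0 n p}}) ⟩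
      K * n ^ m         ≤⟨ dense ⟩
      n * j ^ m         ≤⟨ *-monoʳ-≤ n (^-monoˡ-≤ m j≤1) ⟩
      n * 1 ^ m         ≡⟨ cong (n *_) (^-zeroˡ m) ⟩
      n * 1             ≡⟨ *-identityʳ n ⟩
      n                 ∎)
      where
      n<8n : n < 8 * n
      n<8n = m<m+n n {7 * n} (s≤s z≤n)
    d<n-1 : d < n-1
    d<n-1 = s≤s⁻¹ (begin
      2 + d           ≤⟨ +-monoˡ-≤ d 2≤j ⟩
      j + d           ≡⟨ m∸n+n≡m d≤n ⟩
      n               ∎)
    K2^m≤n : K * 2 ^ m ≤ n
    K2^m≤n = *-cancelʳ-≤ _ _ (j ^ m) {{m^n≢0 j m {{>-nonZero (<⇒≤ 2≤j)}}}} (begin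
      K * 2 ^ m * j ^ m       ≡⟨ *-assoc K (2 ^ m) (j ^ m) ⟩
      K * (2 ^ m * j ^ m)     ≡⟨ cong (K *_) (^-distribʳ-* 2 j m) ⟨
      K * (2 * j) ^ m         ≤⟨ *-monoʳ-≤ K (^-monoˡ-≤ m (<⇒≤ 2j<n)) ⟩
      K * n ^ m               ≤⟨ dense ⟩
      n * j ^ m               ∎)
    -- The 1 covers the passage from `n` to `n-1`, and `2 m (m-1)` is at most `4 * 2 ^ m`; the
    -- requirement `8 ≤ K` has room for both.
    bound : 1 + 2 * (2 * 2 ^ m) ≤ n
    bound = begin
      1 + 2 * (2 * 2 ^ m)           ≤⟨ +-monoˡ-≤ _ (m^n>0 2 m) ⟩
      2 ^ m + 2 * (2 * 2 ^ m)       ≤⟨ m≤m+n _ (3 * 2 ^ m) ⟩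
      2 ^ m + 2 * (2 * 2 ^ m) + 3 * 2 ^ m ≡⟨ lem₂ (2 ^ m) ⟩
      8 * 2 ^ m                     ≤⟨ *-monoˡ-≤ (2 ^ m) 8≤K ⟩
      K * 2 ^ m                     ≤⟨ K2^m≤n ⟩
      n                             ∎
      where
      lem₂ : ∀ x → x + 2 * (2 * x) + 3 * x ≡ 8 * x
      lem₂ = solve-∀

  -- As `N₁/N = j/n`, the second hypothesis reads `A₁/T ≥ q/2`. With `n q ≥ K` the mean `n A₁/T` is
  -- at least `K/2`, and the second-moment bound then gives `Z/T ≤ 2/K`.
  threshold-ratio : ∀ N₁ N A₁ T Z K n j m .{{_ : NonZero N}} .{{_ : NonZero T}} .{{_ : NonZero n}} →
    j * N ≡ n * N₁ → T * N₁ ^ m ≤ 2 * (A₁ * N ^ m) → K * n ^ m ≤ n * j ^ m → Z * (n * A₁) ≤ T * T → K * Z ≤ 2 * T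
  threshold-ratio N₁ N A₁ T Z K n j m jN≡nN₁ ratio dense moment =
    *-cancelʳ-≤ _ _ T (*-cancelʳ-≤ _ _ (n ^ m) {{m^n≢0 n m}} (begin
    K * Z * T * n ^ m              ≡⟨ lem₁ K Z T (n ^ m) ⟩
    Z * T * (K * n ^ m)            ≤⟨ *-monoʳ-≤ (Z * T) dense ⟩
    Z * T * (n * j ^ m)            ≡⟨ lem₂ Z T n (j ^ m) ⟩
    Z * n * (T * j ^ m)            ≤⟨ *-monoʳ-≤ (Z * n) ratio′ ⟩
    Z * n * (2 * (A₁ * n ^ m))     ≡⟨ lem₃ Z n A₁ (n ^ m) ⟩
    2 * (Z * (n * A₁)) * n ^ m     ≤⟨ *-monoˡ-≤ (n ^ m) (*-monoʳ-≤ 2 moment) ⟩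
    2 * (T * T) * n ^ m            ≡⟨ cong (_* n ^ m) (sym (*-assoc 2 T T)) ⟩
    2 * T * T * n ^ m              ∎))
    where
    lem₁ : ∀ K Z T x → K * Z * T * x ≡ Z * T * (K * x)
    lem₁ = solve-∀
    lem₂ : ∀ Z T n x → Z * T * (n * x) ≡ Z * n * (T * x)
    lem₂ = solve-∀
    lem₃ : ∀ Z n A x → Z * n * (2 * (A * x)) ≡ 2 * (Z * (n * A)) * x
    lem₃ = solve-∀
    ratio′ : T * j ^ m ≤ 2 * (A₁ * n ^ m)
    ratio′ = *-cancelʳ-≤ _ _ (N ^ m) {{m^n≢0 N m}} (begin
      T * j ^ m * N ^ m              ≡⟨ *-assoc T (j ^ m) (N ^ m) ⟩
      T * (j ^ m * N ^ m)            ≡⟨ cong (T *_) (trans (sym (^-distribʳ-* j N m)) (trans (cong (_^ m) jN≡nN₁) (^-distribʳ-* n N₁ m))) ⟩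
      T * (n ^ m * N₁ ^ m)           ≡⟨ lem₄ T (n ^ m) (N₁ ^ m) ⟩
      n ^ m * (T * N₁ ^ m)           ≤⟨ *-monoʳ-≤ (n ^ m) ratio ⟩
      n ^ m * (2 * (A₁ * N ^ m))     ≡⟨ lem₅ (n ^ m) A₁ (N ^ m) ⟩
      2 * (A₁ * n ^ m) * N ^ m       ∎)
      where
      lem₄ : ∀ a b c → a * (b * c) ≡ b * (a * c)
      lem₄ = solve-∀
      lem₅ : ∀ a b c → a * (2 * (b * c)) ≡ 2 * (b * a) * c
      lem₅ = solve-∀

  [n∸d]*nCd : ∀ n d → 1 ≤ n → (n ∸ d) * (n C d) ≡ n * ((n ∸ 1) C d)
  [n∸d]*nCd (suc n) d _ = [1+n∸k]*[1+n]Ck n d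

  rarely-connected : ∀ n m d K → 2 ≤ n → 1 ≤ m → 1 ≤ d → d ≤ n → 8 ≤ K →
    16 * (m * m) ≤ n C d → K * n ^ m ≤ n * (n ∸ d) ^ m →
    K * #connected n m d ≤ 2 * ((n C d) C m)
  rarely-connected n m d K 2≤n 1≤m 1≤d d≤n 8≤K m²≤N dense =
    threshold-ratio ((n ∸ 1) C d) (n C d) (((n ∸ 1) C d) C m) ((n C d) C m) (#connected n m d) K n (n ∸ d) m
      {{>-nonZero (C≢0 d≤n)}} {{>-nonZero (C≢0 (≤-trans (m≤16*m² m) m²≤N))}} {{>-nonZero 1≤n}}
      ([n∸d]*nCd n d 1≤n)
      (C-ratio-≥ m (C-monoˡ-≤ d (m∸n≤m n 1)) (m[m-1]≤N₁ n m d K 1≤n 1≤m 1≤d d≤n 8≤K m²≤N dense))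
      dense (SecondMoment.connected-bound n m d 2≤n 1≤d)
    where
    1≤n = <⇒≤ 2≤n

  -- Above the threshold: the union bound over uncrossed sets

  Uncrossed : ∀ {n} → Subset n → Subset n → Set
  Uncrossed S e = e ⊆ S ⊎ e ⊆ ∁ S

  uncrossed? : ∀ {n} (S : Subset n) → Decidable (Uncrossed S)
  uncrossed? S e = (e ⊆? S) ⊎-dec (e ⊆? ∁ S)

  Small : ∀ {n} → Subset n → Set
  Small {n} S = 1 ≤ ∣ S ∣ × 2 * ∣ S ∣ ≤ n

  small? : ∀ {n} → Decidable (Small {n})
  small? {n} S = (1 ≤? ∣ S ∣) ×-dec (2 * ∣ S ∣ ≤? n)

  Crossed : ∀ {n} → Subset n → Subset n → Subset n → Set
  Crossed V₁ V₂ e = Nonempty (e ∩ V₁) × Nonempty (e ∩ V₂)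

  ¬crossed⇒uncrossed : ∀ {n} (V₁ V₂ e : Subset n) → V₁ ∪ V₂ ≡ ⊤ → ¬ Crossed V₁ V₂ e → Uncrossed V₁ e
  ¬crossed⇒uncrossed V₁ V₂ e ∪≡⊤ ¬cross with nonempty? (e ∩ V₁) | nonempty? (e ∩ V₂)
  ... | yes ne₁ | yes ne₂ = contradiction (ne₁ , ne₂) ¬cross
  ... | no  e₁  | _       = inj₂ λ {x} x∈e → x∉p⇒x∈∁p (λ x∈V₁ → e₁ (x , x∈p∩q⁺ (x∈e , x∈V₁)))
  ... | yes _   | no  e₂  = inj₁ λ {x} x∈e → side x x∈e (x∈p∪q⁻ V₁ V₂ (subst (x ∈ˢ_) (sym ∪≡⊤) ∈⊤))
    where
    side : ∀ x → x ∈ˢ e → x ∈ˢ V₁ ⊎ x ∈ˢ V₂ → x ∈ˢ V₁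
    side x x∈e (inj₁ x∈V₁) = x∈V₁
    side x x∈e (inj₂ x∈V₂) = contradiction (x , x∈p∩q⁺ (x∈e , x∈V₂)) e₂

  half : ∀ {n} (V₁ V₂ : Subset n) → V₁ ∩ V₂ ≡ ⊥ → 2 * ∣ V₁ ∣ ≤ n ⊎ 2 * ∣ V₂ ∣ ≤ n
  half {n} V₁ V₂ ∩≡⊥ with ≤-total (2 * ∣ V₁ ∣) n
  ... | inj₁ le = inj₁ le
  ... | inj₂ ge = inj₂ (+-cancelˡ-≤ n _ _ (begin
    n + 2 * ∣ V₂ ∣                    ≤⟨ +-monoˡ-≤ _ ge ⟩
    2 * ∣ V₁ ∣ + 2 * ∣ V₂ ∣           ≡⟨ *-distribˡ-+ 2 ∣ V₁ ∣ ∣ V₂ ∣ ⟨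
    2 * (∣ V₁ ∣ + ∣ V₂ ∣)             ≤⟨ *-monoʳ-≤ 2 sizes ⟩
    2 * n                             ≡⟨ cong (n +_) (+-identityʳ n) ⟩
    n + n                             ∎))
    where
    V₂⊆∁V₁ : V₂ ⊆ ∁ V₁
    V₂⊆∁V₁ {x} x∈V₂ = x∉p⇒x∈∁p λ x∈V₁ → ∉⊥ (subst (x ∈ˢ_) ∩≡⊥ (x∈p∩q⁺ (x∈V₁ , x∈V₂)))
    sizes : ∣ V₁ ∣ + ∣ V₂ ∣ ≤ n
    sizes = begin
      ∣ V₁ ∣ + ∣ V₂ ∣           ≤⟨ +-monoʳ-≤ ∣ V₁ ∣ (p⊆q⇒∣p∣≤∣q∣ V₂⊆∁V₁) ⟩
      ∣ V₁ ∣ + ∣ ∁ V₁ ∣         ≡⟨ cong (∣ V₁ ∣ +_) (∣∁p∣≡n∸∣p∣ V₁) ⟩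
      ∣ V₁ ∣ + (n ∸ ∣ V₁ ∣)     ≡⟨ m+[n∸m]≡n (∣p∣≤n V₁) ⟩
      n                         ∎

  connected : ∀ {n} (H : Hypergraph n) → (∀ S → Small S → ¬ All (Uncrossed S) H) → Connected H
  connected H none V₁ V₂ (ne₁ , ne₂ , ∪≡⊤ , ∩≡⊥)
    with any? (λ e → nonempty? (e ∩ V₁) ×-dec nonempty? (e ∩ V₂)) H
  ... | yes crossed = crossed
  ... | no ¬crossed with half V₁ V₂ ∩≡⊥
  ...   | inj₁ small = contradiction (All.map (λ {e} → ¬crossed⇒uncrossed V₁ V₂ e ∪≡⊤) (¬Any⇒All¬ H ¬crossed))
                         (none V₁ (Nonempty⇒∣p∣>0 ne₁ , small))
  ...   | inj₂ small = contradiction (All.map (λ {e} ¬c → ¬crossed⇒uncrossed V₂ V₁ e (trans (∪-comm V₂ V₁) ∪≡⊤) (λ (a , b) → ¬c (b , a)))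
                           (¬Any⇒All¬ H ¬crossed))
                         (none V₂ (Nonempty⇒∣p∣>0 ne₂ , small))

  -- Stated for each `H`, so that summing over all hypergraphs and exchanging sums leaves one count
  -- per set `S`.
  unionBound : ∀ {n} (H : Hypergraph n) →
    1 ≤ 𝟙 (connected? H) + ∑ (allSubsets n) (λ S → 𝟙 (small? S) * 𝟙 (all? (uncrossed? S) H))
  unionBound {n} H = go (anySubset? (λ S → small? S ×-dec all? (uncrossed? S) H))
    where
    go : Dec (∃ λ S → Small S × All (Uncrossed S) H) →
      1 ≤ 𝟙 (connected? H) + ∑ (allSubsets n) (λ S → 𝟙 (small? S) * 𝟙 (all? (uncrossed? S) H))
    go (yes (S , small , un)) = begin
      1                                                   ≡⟨ cong₂ _*_ (𝟙-true (small? S) small) (𝟙-true (all? (uncrossed? S) H) un) ⟨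
      𝟙 (small? S) * 𝟙 (all? (uncrossed? S) H)            ≤⟨ ∑-∈ (∈-allSubsets S) (λ S → 𝟙 (small? S) * 𝟙 (all? (uncrossed? S) H)) ⟩
      ∑ (allSubsets n) (λ S → 𝟙 (small? S) * 𝟙 (all? (uncrossed? S) H)) ≤⟨ m≤n+m _ _ ⟩
      𝟙 (connected? H) + ∑ (allSubsets n) (λ S → 𝟙 (small? S) * 𝟙 (all? (uncrossed? S) H)) ∎
    go (no none) = ≤-trans (≤-reflexive (sym (𝟙-true (connected? H) (connected H (λ S sm un → none (S , sm , un)))))) (m≤m+n _ _)

  #edges-uncrossed : ∀ {n} d (S : Subset n) → #edges n d (uncrossed? S) ≤ ∣ S ∣ C d + (n ∸ ∣ S ∣) C d
  #edges-uncrossed {n} d S = begin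
    ∑ (allSubsets n) (λ e → 𝟙 (uncrossed? S e) * s e)                                    ≤⟨ ∑-mono (allSubsets n) (λ e → *-monoˡ-≤ (s e) (𝟙-⊎ (e ⊆? S) (e ⊆? ∁ S))) ⟩
    ∑ (allSubsets n) (λ e → (𝟙 (e ⊆? S) + 𝟙 (e ⊆? ∁ S)) * s e)                          ≡⟨ ∑-cong (allSubsets n) (λ e → *-distribʳ-+ (s e) (𝟙 (e ⊆? S)) (𝟙 (e ⊆? ∁ S))) ⟩
    ∑ (allSubsets n) (λ e → 𝟙 (e ⊆? S) * s e + 𝟙 (e ⊆? ∁ S) * s e)                      ≡⟨ ∑-+ (allSubsets n) (λ e → 𝟙 (e ⊆? S) * s e) (λ e → 𝟙 (e ⊆? ∁ S) * s e) ⟩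
    ∑ (allSubsets n) (λ e → 𝟙 (e ⊆? S) * s e) + ∑ (allSubsets n) (λ e → 𝟙 (e ⊆? ∁ S) * s e) ≡⟨ cong₂ _+_ (∑-⊆ S d) (∑-⊆ (∁ S) d) ⟩
    ∣ S ∣ C d + ∣ ∁ S ∣ C d                                                              ≡⟨ cong (λ k → ∣ S ∣ C d + k C d) (∣∁p∣≡n∸∣p∣ S) ⟩
    ∣ S ∣ C d + (n ∸ ∣ S ∣) C d                                                          ∎
    where
    s : Subset n → ℕ
    s e = 𝟙 (∣ e ∣ ≟ d)

  -- The first `K` terms sum to at most `(T/g)(1 - 2^-K)`. The `+ T` on the left is the subtracted
  -- part, which the induction needs; `geometric-∑` discards it.
  geometric : ∀ g T D → (∀ k → D k * (g * 2 ^ suc k) ≤ T) → ∀ K → g * 2 ^ K * ∑ (downFrom K) D + T ≤ T * 2 ^ K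
  geometric g T D h zero    = ≤-reflexive (cong₂ _+_ (*-zeroʳ (g * 1)) (sym (*-identityʳ T)))
  geometric g T D h (suc K) = begin
    g * (2 * p) * (D K + s) + T                    ≡⟨ lem₁ g p (D K) s T ⟩
    D K * (g * (2 * p)) + (2 * (g * p * s) + T)    ≤⟨ +-monoˡ-≤ _ (h K) ⟩
    T + (2 * (g * p * s) + T)                      ≡⟨ lem₂ T (g * p * s) ⟩
    2 * (g * p * s + T)                            ≤⟨ *-monoʳ-≤ 2 (geometric g T D h K) ⟩
    2 * (T * p)                                    ≡⟨ lem₃ T p ⟩
    T * (2 * p)                                    ∎
    where
    p = 2 ^ K
    s = ∑ (downFrom K) D
    lem₁ : ∀ g p d s T → g * (2 * p) * (d + s) + T ≡ d * (g * (2 * p)) + (2 * (g * p * s) + T)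
    lem₁ = solve-∀
    lem₂ : ∀ T x → T + (2 * x + T) ≡ 2 * (x + T)
    lem₂ = solve-∀
    lem₃ : ∀ T p → 2 * (T * p) ≡ T * (2 * p)
    lem₃ = solve-∀

  geometric-∑ : ∀ g T D → (∀ k → D k * (g * 2 ^ suc k) ≤ T) → ∀ K → g * ∑ (downFrom K) D ≤ T
  geometric-∑ g T D h K = *-cancelʳ-≤ _ _ (2 ^ K) {{m^n≢0 2 K}} (begin
    g * ∑ (downFrom K) D * 2 ^ K          ≡⟨ lem g (∑ (downFrom K) D) (2 ^ K) ⟩
    g * 2 ^ K * ∑ (downFrom K) D          ≤⟨ m≤m+n _ T ⟩
    g * 2 ^ K * ∑ (downFrom K) D + T      ≤⟨ geometric g T D h K ⟩
    T * 2 ^ K                             ∎)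
    where
    lem : ∀ g s p → g * s * p ≡ g * p * s
    lem = solve-∀

  module UnionBound (n m d : ℕ) (2≤d : 2 ≤ d) (d≤n : d ≤ n) where
    T : ℕ
    T = (n C d) C m

    1≤d : 1 ≤ d
    1≤d = <⇒≤ 2≤d

    Ω : List (Hypergraph n)
    Ω = hypergraphs n m d

    F : ℕ → ℕ
    F k = 𝟙 (2 * k ≤? n) * ((k C d + (n ∸ k) C d) C m)

    -- Index `k` stands for sets of size `k + 1`, so `downFrom n` covers the sizes 1 to `n` and the
    -- empty set does not enter.
    D : ℕ → ℕ
    D k = (n C suc k) * F (suc k)

    -- At most one term of the sum over `k` is nonzero; written as a sum, it lets `group` collect
    -- the sets by size through an exchange of sums.
    per-subset : ∀ S → ∑ Ω (λ H → 𝟙 (small? S) * 𝟙 (all? (uncrossed? S) H)) ≤ ∑ (downFrom n) (λ k → 𝟙 (∣ S ∣ ≟ suc k) * F (suc k))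
    per-subset S = begin
      ∑ Ω (λ H → 𝟙 (small? S) * 𝟙 (all? (uncrossed? S) H))             ≡⟨ ∑-*ˡ Ω (𝟙 (small? S)) (𝟙 ∘ all? (uncrossed? S)) ⟩
      𝟙 (small? S) * ∑ Ω (𝟙 ∘ all? (uncrossed? S))                     ≡⟨ cong (𝟙 (small? S) *_) (∑-hypergraphs n m d (uncrossed? S) 1≤d) ⟩
      𝟙 (small? S) * (#edges n d (uncrossed? S) C m)                   ≤⟨ *-monoʳ-≤ (𝟙 (small? S)) (C-monoˡ-≤ m (#edges-uncrossed d S)) ⟩
      𝟙 (small? S) * ((∣ S ∣ C d + (n ∸ ∣ S ∣) C d) C m)               ≤⟨ by-size ∣ S ∣ (∣p∣≤n S) ⟩
      ∑ (downFrom n) (λ k → 𝟙 (∣ S ∣ ≟ suc k) * F (suc k))             ∎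
      where
      by-size : ∀ s → s ≤ n → 𝟙 ((1 ≤? s) ×-dec (2 * s ≤? n)) * ((s C d + (n ∸ s) C d) C m) ≤ ∑ (downFrom n) (λ k → 𝟙 (s ≟ suc k) * F (suc k))
      by-size zero    _   = z≤n
      by-size (suc s) s<n = begin
        𝟙 ((1 ≤? suc s) ×-dec (2 * suc s ≤? n)) * c       ≡⟨ cong (_* c) (trans (𝟙-× (1 ≤? suc s) (2 * suc s ≤? n)) (+-identityʳ _)) ⟩
        F (suc s)                                         ≡⟨ +-identityʳ (F (suc s)) ⟨
        1 * F (suc s)                                     ≡⟨ cong (_* F (suc s)) (𝟙-true (suc s ≟ suc s) refl) ⟨
        𝟙 (suc s ≟ suc s) * F (suc s)                     ≤⟨ ∑-∈ (∈-downFrom⁺ s<n) (λ k → 𝟙 (suc s ≟ suc k) * F (suc k)) ⟩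
        ∑ (downFrom n) (λ k → 𝟙 (suc s ≟ suc k) * F (suc k))  ∎
        where
        c = (suc s C d + (n ∸ suc s) C d) C m

    T≤ : T ≤ #connected n m d + ∑ (downFrom n) D
    T≤ = begin
      T                                                                 ≡⟨ length-hypergraphs n m d 1≤d ⟨
      length Ω                                                          ≡⟨ length-∑ Ω ⟩
      ∑ Ω (λ _ → 1)                                                     ≤⟨ ∑-mono Ω unionBound ⟩
      ∑ Ω (λ H → 𝟙 (connected? H) + ∑ (allSubsets n) (λ S → u H S))     ≡⟨ ∑-+ Ω (𝟙 ∘ connected?) (λ H → ∑ (allSubsets n) (u H)) ⟩
      ∑ Ω (𝟙 ∘ connected?) + ∑ Ω (λ H → ∑ (allSubsets n) (u H))         ≡⟨ cong₂ _+_ (sym (length-filter-∑ connected? Ω)) (∑-swap Ω (allSubsets n) u) ⟩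
      #connected n m d + ∑ (allSubsets n) (λ S → ∑ Ω (λ H → u H S))     ≤⟨ +-monoʳ-≤ (#connected n m d) (∑-mono (allSubsets n) per-subset) ⟩
      #connected n m d + ∑ (allSubsets n) (λ S → ∑ (downFrom n) (λ k → 𝟙 (∣ S ∣ ≟ suc k) * F (suc k)))
                                                                        ≡⟨ cong (#connected n m d +_) group ⟩
      #connected n m d + ∑ (downFrom n) D                               ∎
      where
      u : Hypergraph n → Subset n → ℕ
      u H S = 𝟙 (small? S) * 𝟙 (all? (uncrossed? S) H)
      group : ∑ (allSubsets n) (λ S → ∑ (downFrom n) (λ k → 𝟙 (∣ S ∣ ≟ suc k) * F (suc k))) ≡ ∑ (downFrom n) D
      group = trans (∑-swap (allSubsets n) (downFrom n) (λ S k → 𝟙 (∣ S ∣ ≟ suc k) * F (suc k)))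
        (∑-cong (downFrom n) (λ k → trans (∑-*ʳ (allSubsets n) (λ S → 𝟙 (∣ S ∣ ≟ suc k)) (F (suc k))) (cong (_* F (suc k)) (∑-size n (suc k)))))

    module _ (g-1 : ℕ) (sparse : 4 * (2 * suc g-1) * (4 * (2 * suc g-1)) * n * (n ∸ d) ^ m ≤ n ^ m) where
      -- The target is a failure probability of at most `1/g`. In `B ^ suc k` the factor `2 ^ suc k`
      -- makes the sum over sizes converge, and what is left is at least `g`.
      g B : ℕ
      g = suc g-1
      B = 2 * g

      D-bound : ∀ k → D k * (g * 2 ^ suc k) ≤ T
      D-bound k = begin
        (n C suc k) * F (suc k) * (g * 2 ^ suc k)    ≤⟨ *-monoʳ-≤ (D k) weights ⟩
        (n C suc k) * F (suc k) * B ^ suc k          ≤⟨ go (2 * suc k ≤? n) ⟩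
        T                                            ∎
        where
        c = (suc k C d + (n ∸ suc k) C d) C m
        weights : g * 2 ^ suc k ≤ B ^ suc k
        weights = begin
          g * 2 ^ suc k              ≡⟨ *-comm g (2 ^ suc k) ⟩
          2 ^ suc k * g              ≤⟨ *-monoʳ-≤ (2 ^ suc k) (m≤m*n g (g ^ k) {{m^n≢0 g k}}) ⟩
          2 ^ suc k * g ^ suc k      ≡⟨ ^-distribʳ-* 2 g (suc k) ⟨
          B ^ suc k                  ∎
        go : (p : Dec (2 * suc k ≤ n)) → (n C suc k) * (𝟙 p * c) * B ^ suc k ≤ T
        go (no _)     = ≤-trans (≤-reflexive (cong (_* B ^ suc k) (*-zeroʳ (n C suc k)))) z≤n
        go (yes 2k≤n) = ≤-trans (≤-reflexive (cong (λ z → (n C suc k) * z * B ^ suc k) (+-identityʳ c)))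
          (uncrossed-count n (suc k) d m B (s≤s z≤n) 2k≤n 2≤d d≤n (s≤s z≤n) sparse)

      mostly-connected : g * T ≤ g * #connected n m d + T
      mostly-connected = begin
        g * T                                              ≤⟨ *-monoʳ-≤ g T≤ ⟩
        g * (#connected n m d + ∑ (downFrom n) D)          ≡⟨ *-distribˡ-+ g (#connected n m d) (∑ (downFrom n) D) ⟩
        g * #connected n m d + g * ∑ (downFrom n) D        ≤⟨ +-monoʳ-≤ (g * #connected n m d) (geometric-∑ g T D D-bound n) ⟩
        g * #connected n m d + T                           ∎

-- From inequalities between natural numbers to limits of cuts

module Asymptotic where
  import Algebra.Definitions.RawSemiring
  open import Data.Integer.Base as ℤ using (+_; -[1+_])
  import Data.Integer.Properties as ℤ
  open import Data.List.Properties using (length-filter)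
  open import Data.Nat.Base as ℕ using (ℕ; zero; suc; z≤n; s≤s)
  open import Data.Nat.Combinatorics using (_C_)
  import Data.Nat.Properties as ℕ
  import Data.Nat.Tactic.RingSolver as ℕ
  open import Data.Product.Base using (_×_; _,_; proj₁; proj₂; ∃)
  open import Data.Rational.Base hiding (_÷_)
  open import Data.Rational.Properties
  open import Data.Rational.Solver using (module +-*-Solver)
  open import Data.Rational.Unnormalised.Base as ℚᵘ using (mkℚᵘ)
  import Data.Rational.Unnormalised.Properties as ℚᵘ
  open import Data.Sum.Base using (inj₁; inj₂)
  open import Relation.Binary.PropositionalEquality
  open import Relation.Nullary using (contradiction)
  open import Defs
  open Finite using (C≢0; length-hypergraphs; #connected; rarely-connected; module UnionBound; m≤16*m²)
  open +-*-Solver using (solve; _:=_; _:+_; _:*_; :-_; _:-_; con)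
  open Algebra.Definitions.RawSemiring +-*-rawSemiring using (_^_)
  open ≤-Reasoning

  fromℚᵘ-* : ∀ p q → fromℚᵘ p * fromℚᵘ q ≡ fromℚᵘ (p ℚᵘ.* q)
  fromℚᵘ-* p q = toℚᵘ-injective (ℚᵘ.≃-trans (toℚᵘ-homo-* (fromℚᵘ p) (fromℚᵘ q))
    (ℚᵘ.≃-trans (ℚᵘ.*-cong (toℚᵘ-fromℚᵘ p) (toℚᵘ-fromℚᵘ q)) (ℚᵘ.≃-sym (toℚᵘ-fromℚᵘ (p ℚᵘ.* q)))))

  fromℚᵘ-+ : ∀ p q → fromℚᵘ p + fromℚᵘ q ≡ fromℚᵘ (p ℚᵘ.+ q)
  fromℚᵘ-+ p q = toℚᵘ-injective (ℚᵘ.≃-trans (toℚᵘ-homo-+ (fromℚᵘ p) (fromℚᵘ q))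
    (ℚᵘ.≃-trans (ℚᵘ.+-cong (toℚᵘ-fromℚᵘ p) (toℚᵘ-fromℚᵘ q)) (ℚᵘ.≃-sym (toℚᵘ-fromℚᵘ (p ℚᵘ.+ q)))))

  fromℕ-+ : ∀ a b → fromℕ (a ℕ.+ b) ≡ fromℕ a + fromℕ b
  fromℕ-+ a b = sym (trans (fromℚᵘ-+ (mkℚᵘ (+ a) 0) (mkℚᵘ (+ b) 0)) (fromℚᵘ-cong {mkℚᵘ (+ a) 0 ℚᵘ.+ mkℚᵘ (+ b) 0} {mkℚᵘ (+ (a ℕ.+ b)) 0} (ℚᵘ.*≡*
    (cong (ℤ._* + 1) (cong₂ ℤ._+_ (ℤ.*-identityʳ (+ a)) (ℤ.*-identityʳ (+ b)))))))

  fromℕ-* : ∀ a b → fromℕ (a ℕ.* b) ≡ fromℕ a * fromℕ b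
  fromℕ-* a b = sym (trans (fromℚᵘ-* (mkℚᵘ (+ a) 0) (mkℚᵘ (+ b) 0)) (fromℚᵘ-cong {mkℚᵘ (+ a) 0 ℚᵘ.* mkℚᵘ (+ b) 0} {mkℚᵘ (+ (a ℕ.* b)) 0} (ℚᵘ.*≡*
    (cong (ℤ._* + 1) (sym (ℤ.pos-* a b))))))

  ÷-*-cancel : ∀ a b → 1 ℕ.≤ b → (a ÷ b) * fromℕ b ≡ fromℕ a
  ÷-*-cancel a (suc b) _ = trans (fromℚᵘ-* (mkℚᵘ (+ a) b) (mkℚᵘ (+ suc b) 0)) (fromℚᵘ-cong {mkℚᵘ (+ a) b ℚᵘ.* mkℚᵘ (+ suc b) 0} {mkℚᵘ (+ a) 0} (ℚᵘ.*≡*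
    (trans (ℤ.*-identityʳ (+ a ℤ.* + suc b)) (cong (λ z → + a ℤ.* + z) (sym (ℕ.*-identityʳ (suc b)))))))

  p≤p+q : ∀ p {q} → 0ℚ ≤ q → p ≤ p + q
  p≤p+q p 0≤q = ≤-trans (≤-reflexive (sym (+-identityʳ p))) (+-monoʳ-≤ p 0≤q)

  p<p+q : ∀ p {q} → 0ℚ < q → p < p + q
  p<p+q p 0<q = ≤-<-trans (≤-reflexive (sym (+-identityʳ p))) (+-monoʳ-< p 0<q)

  p≤q⇒0≤q-p : ∀ {p q} → p ≤ q → 0ℚ ≤ q - p
  p≤q⇒0≤q-p {p} {q} p≤q = ≤-trans (≤-reflexive (sym (+-inverseʳ p))) (+-monoˡ-≤ (- p) p≤q)

  p<q⇒0<q-p : ∀ {p q} → p < q → 0ℚ < q - p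
  p<q⇒0<q-p {p} {q} p<q = ≤-<-trans (≤-reflexive (sym (+-inverseʳ p))) (+-monoˡ-< (- p) p<q)

  *-monoˡ-≤ : ∀ {r p q} → 0ℚ ≤ r → p ≤ q → r * p ≤ r * q
  *-monoˡ-≤ {r} 0≤r = *-monoˡ-≤-nonNeg r {{nonNegative 0≤r}}

  *-monoʳ-≤ : ∀ {r p q} → 0ℚ ≤ r → p ≤ q → p * r ≤ q * r
  *-monoʳ-≤ {r} 0≤r = *-monoʳ-≤-nonNeg r {{nonNegative 0≤r}}

  *-mono-≤ : ∀ {p q r s} → 0ℚ ≤ p → p ≤ q → 0ℚ ≤ r → r ≤ s → p * r ≤ q * s
  *-mono-≤ 0≤p p≤q 0≤r r≤s = ≤-trans (*-monoʳ-≤ 0≤r p≤q) (*-monoˡ-≤ (≤-trans 0≤p p≤q) r≤s)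

  0≤p*q : ∀ {p q} → 0ℚ ≤ p → 0ℚ ≤ q → 0ℚ ≤ p * q
  0≤p*q {p} 0≤p 0≤q = ≤-trans (≤-reflexive (sym (*-zeroʳ p))) (*-monoˡ-≤ 0≤p 0≤q)

  0≤1 : 0ℚ ≤ 1ℚ
  0≤1 = nonNegative⁻¹ 1ℚ

  0≤fromℕ : ∀ n → 0ℚ ≤ fromℕ n
  0≤fromℕ zero    = ≤-refl
  0≤fromℕ (suc n) = ≤-trans (≤-trans (0≤fromℕ n) (p≤p+q (fromℕ n) 0≤1)) (≤-reflexive (trans (+-comm (fromℕ n) 1ℚ) (sym (fromℕ-+ 1 n))))

  fromℕ-mono-≤ : ∀ {a b} → a ℕ.≤ b → fromℕ a ≤ fromℕ b
  fromℕ-mono-≤ {a} a≤b with c , refl ← ℕ.m≤n⇒∃[o]m+o≡n a≤b =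
    ≤-trans (p≤p+q (fromℕ a) (0≤fromℕ c)) (≤-reflexive (sym (fromℕ-+ a c)))

  fromℕ-mono-< : ∀ {a b} → a ℕ.< b → fromℕ a < fromℕ b
  fromℕ-mono-< {a} a<b = <-≤-trans (<-≤-trans (p<p+q (fromℕ a) (positive⁻¹ 1ℚ)) (≤-reflexive (trans (+-comm (fromℕ a) 1ℚ) (sym (fromℕ-+ 1 a)))))
    (fromℕ-mono-≤ a<b)

  fromℕ-cancel-≤ : ∀ {a b} → fromℕ a ≤ fromℕ b → a ℕ.≤ b
  fromℕ-cancel-≤ le = ℕ.≮⇒≥ λ b<a → <-irrefl refl (<-≤-trans (fromℕ-mono-< b<a) le)

  0<fromℕ : ∀ {n} → 1 ℕ.≤ n → 0ℚ < fromℕ n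
  0<fromℕ = fromℕ-mono-<

  archimedean : ∀ x → ∃ λ k → x ≤ fromℕ k
  archimedean x@(mkℚ n d-1 _) = ℤ.∣ n ∣ , toℚᵘ-cancel-≤ (ℚᵘ.≤-trans (bound n) (ℚᵘ.≤-reflexive (ℚᵘ.≃-sym (toℚᵘ-fromℚᵘ (mkℚᵘ (+ ℤ.∣ n ∣) 0)))))
    where
    bound : ∀ n → mkℚᵘ n d-1 ℚᵘ.≤ mkℚᵘ (+ ℤ.∣ n ∣) 0
    bound (+ a)    = ℚᵘ.*≤* (subst₂ ℤ._≤_ (ℤ.pos-* a 1) (ℤ.pos-* a (suc d-1)) (ℤ.+≤+ (ℕ.*-monoʳ-≤ a (s≤s z≤n))))
    bound -[1+ a ] = ℚᵘ.*≤* ℤ.-≤+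

  -- 1 ÷ 0 = 0 is nonnegative as well.
  0≤1÷n : ∀ n → 0ℚ ≤ 1 ÷ n
  0≤1÷n zero    = ≤-refl
  0≤1÷n (suc n) = *-cancelʳ-≤-pos (fromℕ (suc n)) {{positive (0<fromℕ {suc n} (s≤s z≤n))}} (begin
    0ℚ * fromℕ (suc n)             ≡⟨ *-zeroˡ (fromℕ (suc n)) ⟩
    0ℚ                             ≤⟨ 0≤1 ⟩
    1ℚ                             ≡⟨ ÷-*-cancel 1 (suc n) (s≤s z≤n) ⟨
    (1 ÷ suc n) * fromℕ (suc n)    ∎)

  *-interchange : ∀ a b c d → a * b * (c * d) ≡ a * c * (b * d)
  *-interchange = solve 4 (λ a b c d → a :* b :* (c :* d) := a :* c :* (b :* d)) refl

  ^-distribʳ-* : ∀ x y n → (x * y) ^ n ≡ x ^ n * y ^ n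
  ^-distribʳ-* x y zero    = refl
  ^-distribʳ-* x y (suc n) = trans (cong (x * y *_) (^-distribʳ-* x y n))
    (*-interchange x y (x ^ n) (y ^ n))

  0≤x^n : ∀ {x} → 0ℚ ≤ x → ∀ n → 0ℚ ≤ x ^ n
  0≤x^n 0≤x zero    = 0≤1
  0≤x^n 0≤x (suc n) = 0≤p*q 0≤x (0≤x^n 0≤x n)

  ^-monoˡ-≤ : ∀ {x y} → 0ℚ ≤ x → x ≤ y → ∀ n → x ^ n ≤ y ^ n
  ^-monoˡ-≤ 0≤x x≤y zero    = ≤-refl
  ^-monoˡ-≤ 0≤x x≤y (suc n) = *-mono-≤ 0≤x x≤y (0≤x^n 0≤x n) (^-monoˡ-≤ 0≤x x≤y n)

  1^n≡1 : ∀ n → 1ℚ ^ n ≡ 1ℚ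
  1^n≡1 zero    = refl
  1^n≡1 (suc n) = trans (*-identityˡ (1ℚ ^ n)) (1^n≡1 n)

  fromℕ-^ : ∀ a n → fromℕ (a ℕ.^ n) ≡ fromℕ a ^ n
  fromℕ-^ a zero    = refl
  fromℕ-^ a (suc n) = trans (fromℕ-* a (a ℕ.^ n)) (cong (fromℕ a *_) (fromℕ-^ a n))

  -- Exponentials and logarithms through `(1 + c/n)^n`

  bernoulli : ∀ {t} → 0ℚ ≤ t → ∀ n → 1ℚ + fromℕ n * t ≤ (1ℚ + t) ^ n
  bernoulli {t} 0≤t zero    = ≤-reflexive (trans (cong (λ z → 1ℚ + z) (*-zeroˡ t)) (+-identityʳ 1ℚ))
  bernoulli {t} 0≤t (suc n) = begin
    1ℚ + fromℕ (suc n) * t                        ≡⟨ cong (λ z → 1ℚ + z * t) (fromℕ-+ 1 n) ⟩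
    1ℚ + (1ℚ + fromℕ n) * t                       ≤⟨ p≤p+q _ (0≤p*q 0≤t (0≤p*q (0≤fromℕ n) 0≤t)) ⟩
    1ℚ + (1ℚ + fromℕ n) * t + t * (fromℕ n * t)   ≡⟨ lem t (fromℕ n) ⟩
    (1ℚ + t) * (1ℚ + fromℕ n * t)                 ≤⟨ *-monoˡ-≤ (≤-trans 0≤1 (p≤p+q 1ℚ 0≤t)) (bernoulli 0≤t n) ⟩
    (1ℚ + t) * (1ℚ + t) ^ n                       ∎
    where
    lem : ∀ t n → 1ℚ + (1ℚ + n) * t + t * (n * t) ≡ (1ℚ + t) * (1ℚ + n * t)
    lem = solve 2 (λ t n → con 1ℚ :+ (con 1ℚ :+ n) :* t :+ t :* (n :* t) := (con 1ℚ :+ t) :* (con 1ℚ :+ n :* t)) refl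

  -- `base c n ^ n` is the `n`-th term of the sequence whose limit defines `exp c`.
  base : ℚ → ℕ → ℚ
  base c n = 1ℚ + c * (1 ÷ n)

  base-mono : ∀ {a b} → a ≤ b → ∀ n → base a n ≤ base b n
  base-mono a≤b n = +-monoʳ-≤ 1ℚ (*-monoʳ-≤ (0≤1÷n n) a≤b)

  1+c≤base^n : ∀ {c} n → 0ℚ ≤ c → 1 ℕ.≤ n → 1ℚ + c ≤ base c n ^ n
  1+c≤base^n {c} n 0≤c 1≤n = begin
    1ℚ + c                              ≡⟨ cong (λ z → 1ℚ + z) (trans (cong (c *_) (÷-*-cancel 1 n 1≤n)) (*-identityʳ c)) ⟨
    1ℚ + c * ((1 ÷ n) * fromℕ n)        ≡⟨ cong (λ z → 1ℚ + z) (lem c (1 ÷ n) (fromℕ n)) ⟩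
    1ℚ + fromℕ n * (c * (1 ÷ n))        ≤⟨ bernoulli (0≤p*q 0≤c (0≤1÷n n)) n ⟩
    base c n ^ n                        ∎
    where
    lem : ∀ c u n → c * (u * n) ≡ n * (c * u)
    lem = solve 3 (λ c u n → c :* (u :* n) := n :* (c :* u)) refl

  infixr 4 _⊓ᵉ_
  _⊓ᵉ_ : ∀ {P Q : ℕ → Set} → Eventually P → Eventually Q → Eventually (λ n → P n × Q n)
  (M , p) ⊓ᵉ (N , q) = M ℕ.⊔ N , λ n le → p n (ℕ.≤-trans (ℕ.m≤m⊔n M N) le) , q n (ℕ.≤-trans (ℕ.m≤n⊔m M N) le)

  mapᵉ : ∀ {P Q : ℕ → Set} → (∀ n → P n → Q n) → Eventually P → Eventually Q
  mapᵉ f (N , p) = N , λ n le → f n (p n le)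

  from : ∀ N → Eventually (N ℕ.≤_)
  from N = N , λ _ le → le

  -- With `δ = 1` this makes `base` nonnegative, so that its powers are monotone even for negative
  -- exponents; with `δ` a gap between exponents it absorbs the second-order term of a product of
  -- two bases.
  eventually-0≤δ+e/n : ∀ e {δ} → 0ℚ < δ → Eventually λ n → 0ℚ ≤ δ + e * (1 ÷ n)
  eventually-0≤δ+e/n e {δ} 0<δ = mapᵉ bound (from (suc k))
    where
    instance
      _ = positive 0<δ
      _ = pos⇒nonZero δ
    k : ℕ
    k = proj₁ (archimedean (- e * (1/ δ)))
    -e≤kδ : - e ≤ fromℕ k * δ
    -e≤kδ = begin
      - e                      ≡⟨ *-identityʳ (- e) ⟨
      - e * 1ℚ                 ≡⟨ cong (- e *_) (*-inverseˡ δ) ⟨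
      - e * ((1/ δ) * δ)       ≡⟨ *-assoc (- e) (1/ δ) δ ⟨
      - e * (1/ δ) * δ         ≤⟨ *-monoʳ-≤ (<⇒≤ 0<δ) (proj₂ (archimedean (- e * (1/ δ)))) ⟩
      fromℕ k * δ              ∎
    bound : ∀ n → suc k ℕ.≤ n → 0ℚ ≤ δ + e * (1 ÷ n)
    bound n k<n = begin
      0ℚ                                  ≤⟨ 0≤p*q (0≤1÷n n) (p≤q⇒0≤q-p (≤-trans -e≤kδ (*-monoʳ-≤ (<⇒≤ 0<δ) (fromℕ-mono-≤ (ℕ.<⇒≤ k<n))))) ⟩
      (1 ÷ n) * (fromℕ n * δ - - e)       ≡⟨ lem (1 ÷ n) (fromℕ n) δ e ⟩
      (1 ÷ n) * fromℕ n * δ + e * (1 ÷ n) ≡⟨ cong (λ z → z * δ + e * (1 ÷ n)) (÷-*-cancel 1 n (ℕ.≤-trans (s≤s z≤n) k<n)) ⟩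
      1ℚ * δ + e * (1 ÷ n)                ≡⟨ cong (_+ e * (1 ÷ n)) (*-identityˡ δ) ⟩
      δ + e * (1 ÷ n)                     ∎
      where
      lem : ∀ u n d e → u * (n * d - - e) ≡ u * n * d + e * u
      lem = solve 4 (λ u n d e → u :* (n :* d :- (:- e)) := (u :* n) :* d :+ e :* u) refl

  eventually-0≤base : ∀ c → Eventually λ n → 0ℚ ≤ base c n
  eventually-0≤base c = eventually-0≤δ+e/n c (positive⁻¹ 1ℚ)

  -- exp b ≤ y and y ≤ exp b.
  Exp≤ Exp≥ : ℚ → ℚ → Set
  Exp≤ b y = ∀ c → c < b → Eventually λ n → base c n ^ n ≤ y
  Exp≥ b y = ∀ c → b < c → Eventually λ n → y ≤ base c n ^ n

  [a+b]-a≡b : ∀ a b → a + b - a ≡ b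
  [a+b]-a≡b = solve 2 (λ a b → a :+ b :- a := b) refl

  base-*-slack : ∀ a b c u → 1ℚ + c * u + u * ((b - (c - a)) + a * b * u) ≡ (1ℚ + a * u) * (1ℚ + b * u)
  base-*-slack = solve 4 (λ a b c u → con 1ℚ :+ c :* u :+ u :* ((b :- (c :- a)) :+ a :* b :* u)
    := (con 1ℚ :+ a :* u) :* (con 1ℚ :+ b :* u)) refl

  base-*-excess : ∀ a b c u → (1ℚ + a * u) * (1ℚ + b * u) + u * ((c - a - b) + - (a * b) * u) ≡ 1ℚ + c * u
  base-*-excess = solve 4 (λ a b c u → (con 1ℚ :+ a :* u) :* (con 1ℚ :+ b :* u) :+ u :* ((c :- a :- b) :+ (:- (a :* b)) :* u)
    := con 1ℚ :+ c :* u) refl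

  -- In `(1 + a/n)(1 + b′/n)` the surplus of `a + b′` over `c` outweighs the term `a b′/n` for large
  -- `n`. The second exponent gives up room by passing to `b′ < b`; the bound on the first factor,
  -- coming from a cut of a logarithm, already holds at `a` itself.
  Exp≤-* : ∀ {a b y z} → (Eventually λ n → base a n ^ n ≤ y) → Exp≤ b z → Exp≤ (a + b) (y * z)
  Exp≤-* {a} {b} {y} {z} ay bz c c<a+b =
    let b′ , c-a<b′ , b′<b = <-dense (<-≤-trans (+-monoˡ-< (- a) c<a+b) (≤-reflexive ([a+b]-a≡b a b))) in
    mapᵉ (bound b′) (ay ⊓ᵉ bz b′ b′<b ⊓ᵉ eventually-0≤base a ⊓ᵉ eventually-0≤base b′ ⊓ᵉ eventually-0≤base c
      ⊓ᵉ eventually-0≤δ+e/n (a * b′) (p<q⇒0<q-p c-a<b′))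
    where
    bound : ∀ b′ n → base a n ^ n ≤ y × base b′ n ^ n ≤ z × 0ℚ ≤ base a n × 0ℚ ≤ base b′ n × 0ℚ ≤ base c n
      × 0ℚ ≤ b′ - (c - a) + a * b′ * (1 ÷ n) → base c n ^ n ≤ y * z
    bound b′ n (a≤y , b≤z , 0≤a , 0≤b , 0≤c , 0≤δ) = begin
      base c n ^ n                    ≤⟨ ^-monoˡ-≤ 0≤c step n ⟩
      (base a n * base b′ n) ^ n      ≡⟨ ^-distribʳ-* (base a n) (base b′ n) n ⟩
      base a n ^ n * base b′ n ^ n    ≤⟨ *-mono-≤ (0≤x^n 0≤a n) a≤y (0≤x^n 0≤b n) b≤z ⟩
      y * z                           ∎
      where
      step : base c n ≤ base a n * base b′ n
      step = ≤-trans (p≤p+q (base c n) (0≤p*q (0≤1÷n n) 0≤δ)) (≤-reflexive (base-*-slack a b′ c (1 ÷ n)))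

  Exp≥-* : ∀ {a b y z} → 0ℚ ≤ y → 0ℚ ≤ z → (Eventually λ n → y ≤ base a n ^ n) → Exp≥ b z → Exp≥ (a + b) (y * z)
  Exp≥-* {a} {b} {y} {z} 0≤y 0≤z ay bz c a+b<c =
    let b′ , b<b′ , b′<c-a = <-dense (≤-<-trans (≤-reflexive (sym ([a+b]-a≡b a b))) (+-monoˡ-< (- a) a+b<c)) in
    mapᵉ (bound b′) (ay ⊓ᵉ bz b′ b<b′ ⊓ᵉ eventually-0≤base a ⊓ᵉ eventually-0≤base b′
      ⊓ᵉ eventually-0≤δ+e/n (- (a * b′)) (p<q⇒0<q-p b′<c-a))
    where
    bound : ∀ b′ n → y ≤ base a n ^ n × z ≤ base b′ n ^ n × 0ℚ ≤ base a n × 0ℚ ≤ base b′ n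
      × 0ℚ ≤ c - a - b′ + - (a * b′) * (1 ÷ n) → y * z ≤ base c n ^ n
    bound b′ n (y≤a , z≤b , 0≤a , 0≤b , 0≤δ) = begin
      y * z                           ≤⟨ *-mono-≤ 0≤y y≤a 0≤z z≤b ⟩
      base a n ^ n * base b′ n ^ n    ≡⟨ ^-distribʳ-* (base a n) (base b′ n) n ⟨
      (base a n * base b′ n) ^ n      ≤⟨ ^-monoˡ-≤ (0≤p*q 0≤a 0≤b) step n ⟩
      base c n ^ n                    ∎
      where
      step : base a n * base b′ n ≤ base c n
      step = ≤-trans (p≤p+q _ (0≤p*q (0≤1÷n n) 0≤δ)) (≤-reflexive (base-*-excess a b′ c (1 ÷ n)))

  eventually-≤-log : ∀ {x q} → lower (log x) q → Eventually λ n → base q n ^ n ≤ x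
  eventually-≤-log (r , r<x , ev) = mapᵉ (λ n le → ≤-trans le (<⇒≤ r<x)) ev

  eventually-≥-log : ∀ {x q} → upper (log x) q → Eventually λ n → x ≤ base q n ^ n
  eventually-≥-log (r , x<r , ev) = mapᵉ (λ n le → ≤-trans (<⇒≤ x<r) le) ev

  base-0 : ∀ n → base 0ℚ n ≡ 1ℚ
  base-0 n = trans (cong (λ z → 1ℚ + z) (*-zeroˡ (1 ÷ n))) (+-identityʳ 1ℚ)

  -- Each summand `log x` contributes one factor `x` through `Exp≤-*`. At `x = 0`, that is `d = n`,
  -- the lower cut of `log x` is empty, so `-∞` needs no separate case.
  Exp≤-·log : ∀ {x} m {q} → lower (m ·ᶜ log x) q → Exp≤ q (x ^ m)
  Exp≤-·log zero q<0 c c<q = mapᵉ (λ n 0≤c → ≤-trans (^-monoˡ-≤ 0≤c (≤-trans (base-mono (<⇒≤ (<-trans c<q q<0)) n) (≤-reflexive (base-0 n))) n) (≤-reflexive (1^n≡1 n)))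
    (eventually-0≤base c)
  Exp≤-·log (suc m) (a , b , la , lb , refl) = Exp≤-* {a} {b} (eventually-≤-log {q = a} la) (Exp≤-·log m lb)

  Exp≥-·log : ∀ {x} → 0ℚ ≤ x → ∀ m {q} → upper (m ·ᶜ log x) q → Exp≥ q (x ^ m)
  Exp≥-·log 0≤x zero 0<q c q<c = mapᵉ (λ n _ → ≤-trans (≤-reflexive (sym (1^n≡1 n))) (^-monoˡ-≤ 0≤1 (≤-trans (≤-reflexive (sym (base-0 n))) (base-mono (<⇒≤ (<-trans 0<q q<c)) n)) n)) (from 0)
  Exp≥-·log 0≤x (suc m) (a , b , la , lb , refl) = Exp≥-* {a} {b} 0≤x (0≤x^n 0≤x m) (eventually-≥-log {q = a} la) (Exp≥-·log 0≤x m lb)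

  q≡1+[q-1] : ∀ q → q ≡ 1ℚ + (q - 1ℚ)
  q≡1+[q-1] = solve 1 (λ q → q := con 1ℚ :+ (q :- con 1ℚ)) refl

  q-1<q : ∀ q → q - 1ℚ < q
  q-1<q q = <-≤-trans (+-monoʳ-< q (neg-antimono-< (positive⁻¹ 1ℚ))) (≤-reflexive (+-identityʳ q))

  -q<1-q : ∀ q → - q < 1ℚ - q
  -q<1-q q = ≤-<-trans (≤-reflexive (sym (+-identityˡ (- q)))) (+-monoˡ-< (- q) (positive⁻¹ 1ℚ))

  witness : ∀ {P : ℕ → Set} → Eventually P → ∃ λ n → 1 ℕ.≤ n × P n
  witness (N , p) = suc N , s≤s z≤n , p (suc N) (ℕ.n≤1+n N)

  1≤q⇒q≤base^n : ∀ {q} n → 1ℚ ≤ q → 1 ℕ.≤ n → q ≤ base (q - 1ℚ) n ^ n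
  1≤q⇒q≤base^n {q} n 1≤q 1≤n = ≤-trans (≤-reflexive (q≡1+[q-1] q)) (1+c≤base^n n (p≤q⇒0≤q-p 1≤q) 1≤n)

  -- Bernoulli's inequality at the smaller exponent `q - 1` gives
  -- `base (q - 1ℚ) n ^ n ≥ 1 + (q - 1) = q`; a single index `n ≥ 1` is enough.
  Exp≤⇒≤ : ∀ {q y} → 1ℚ ≤ q → Exp≤ q y → q ≤ y
  Exp≤⇒≤ {q} 1≤q h =
    let n , 1≤n , le = witness (h (q - 1ℚ) (q-1<q q)) in
    ≤-trans (1≤q⇒q≤base^n n 1≤q 1≤n) le

  -- (1 + e/n)(1 - e/n) ≤ 1 for e = q - 1.
  Exp≥⇒≤ : ∀ {q y} → 1ℚ ≤ q → 0ℚ ≤ y → Exp≥ (- q) y → q * y ≤ 1ℚ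
  Exp≥⇒≤ {q} {y} 1≤q 0≤y h =
    let n , 1≤n , y≤ , 0≤base = witness (h (1ℚ - q) (-q<1-q q) ⊓ᵉ eventually-0≤base (1ℚ - q)) in
    bound n 1≤n y≤ 0≤base
    where
    0≤e : 0ℚ ≤ q - 1ℚ
    0≤e = p≤q⇒0≤q-p 1≤q
    lem : ∀ q u → (1ℚ + (q - 1ℚ) * u) * (1ℚ + (1ℚ - q) * u) + (q - 1ℚ) * u * ((q - 1ℚ) * u) ≡ 1ℚ
    lem = solve 2 (λ q u → (con 1ℚ :+ (q :- con 1ℚ) :* u) :* (con 1ℚ :+ (con 1ℚ :- q) :* u)
      :+ (q :- con 1ℚ) :* u :* ((q :- con 1ℚ) :* u) := con 1ℚ) refl
    step : ∀ n → base (q - 1ℚ) n * base (1ℚ - q) n ≤ 1ℚ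
    step n = ≤-trans (p≤p+q _ (0≤p*q (0≤p*q 0≤e (0≤1÷n n)) (0≤p*q 0≤e (0≤1÷n n)))) (≤-reflexive (lem q (1 ÷ n)))
    bound : ∀ n → 1 ℕ.≤ n → y ≤ base (1ℚ - q) n ^ n → 0ℚ ≤ base (1ℚ - q) n → q * y ≤ 1ℚ
    bound n 1≤n y≤ 0≤base = begin
      q * y                                        ≤⟨ *-mono-≤ (≤-trans 0≤1 1≤q) (1≤q⇒q≤base^n n 1≤q 1≤n) 0≤y y≤ ⟩
      base (q - 1ℚ) n ^ n * base (1ℚ - q) n ^ n    ≡⟨ ^-distribʳ-* (base (q - 1ℚ) n) (base (1ℚ - q) n) n ⟨
      (base (q - 1ℚ) n * base (1ℚ - q) n) ^ n      ≤⟨ ^-monoˡ-≤ (0≤p*q (≤-trans 0≤1 (p≤p+q 1ℚ (0≤p*q 0≤e (0≤1÷n n)))) 0≤base) (step n) n ⟩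
      1ℚ ^ n                                       ≡⟨ 1^n≡1 n ⟩
      1ℚ                                           ∎

  -- The limit at `ε = 1/4` provides a rational `r` below `√N` with `4m ≤ r`; squaring produces the
  -- 16.
  ≪-√⇒ : ∀ (m N : ℕ → ℕ) → (λ n → fromℚ (fromℕ (m n))) ≪ (λ n → √ (fromℕ (N n))) → Eventually λ n → 16 ℕ.* (m n ℕ.* m n) ℕ.≤ N n
  ≪-√⇒ m N h = mapᵉ (λ n (_ , up) → bound n up) (h (+ 1 / 4) (positive⁻¹ (+ 1 / 4)))
    where
    core : ∀ m N r s → 0ℚ < r → r * r < fromℕ N → fromℕ m < s → s ≤ (0ℚ + + 1 / 4) * r → 16 ℕ.* (m ℕ.* m) ℕ.≤ N
    core m N r s 0<r r²<N m<s s≤ = fromℕ-cancel-≤ (begin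
      fromℕ (16 ℕ.* (m ℕ.* m))                     ≡⟨ cong fromℕ (lem₁ m) ⟩
      fromℕ ((4 ℕ.* m) ℕ.* (4 ℕ.* m))              ≡⟨ fromℕ-* (4 ℕ.* m) (4 ℕ.* m) ⟩
      fromℕ (4 ℕ.* m) * fromℕ (4 ℕ.* m)            ≤⟨ *-mono-≤ (0≤fromℕ (4 ℕ.* m)) 4m≤r (0≤fromℕ (4 ℕ.* m)) 4m≤r ⟩
      r * r                                        ≤⟨ <⇒≤ r²<N ⟩
      fromℕ N                                      ∎)
      where
      lem₁ : ∀ m → 16 ℕ.* (m ℕ.* m) ≡ (4 ℕ.* m) ℕ.* (4 ℕ.* m)
      lem₁ = ℕ.solve-∀
      4m≤r : fromℕ (4 ℕ.* m) ≤ r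
      4m≤r = begin
        fromℕ (4 ℕ.* m)                            ≡⟨ fromℕ-* 4 m ⟩
        fromℕ 4 * fromℕ m                          ≤⟨ *-monoˡ-≤ (0≤fromℕ 4) (≤-trans (<⇒≤ m<s) s≤) ⟩
        fromℕ 4 * ((0ℚ + + 1 / 4) * r)             ≡⟨ *-assoc (fromℕ 4) (0ℚ + + 1 / 4) r ⟨
        fromℕ 4 * (0ℚ + + 1 / 4) * r               ≡⟨ *-identityˡ r ⟩
        r                                          ∎
    bound : ∀ n → upper (fromℚ (fromℕ (m n)) /ᶜ ∣ √ (fromℕ (N n)) ∣ᶜ) (0ℚ + + 1 / 4) → 16 ℕ.* (m n ℕ.* m n) ℕ.≤ N n
    -- Since `0 < r`, membership of `r` in the lower cut of `∣ √ N ∣ᶜ` can only mean `r * r < N`;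
    -- the other two cases force `r < 0`.
    bound n (r , t , s , 0<r , inj₁ (inj₁ r<0) , _)              = contradiction (<-trans 0<r r<0) (<-irrefl refl)
    bound n (r , t , s , 0<r , inj₁ (inj₂ r²<N) , _ , m<s , s≤ , _) = core (m n) (N n) r s 0<r r²<N m<s s≤
    bound n (r , t , s , 0<r , inj₂ (0<-r , _) , _)              = contradiction (<-trans 0<r (neg-cancel-< {r} {0ℚ} 0<-r)) (<-irrefl refl)
      where
      neg-cancel-< : ∀ {p q} → - q < - p → p < q
      neg-cancel-< {p} {q} lt = ≰⇒> λ q≤p → <-irrefl refl (<-≤-trans lt (neg-antimono-≤ q≤p))

  -- The threshold exponent as an inequality between natural numbers

  module Threshold (n m d : ℕ) (1≤n : 1 ℕ.≤ n) (d≤n : d ℕ.≤ n) where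
    x : ℚ
    x = 1ℚ - d ÷ n

    xn≡n-d : x * fromℕ n ≡ fromℕ (n ℕ.∸ d)
    xn≡n-d = begin-equality
      (1ℚ - d ÷ n) * fromℕ n                       ≡⟨ lem (d ÷ n) (fromℕ n) ⟩
      fromℕ n - d ÷ n * fromℕ n                    ≡⟨ cong₂ (λ a b → a - b) (trans (cong fromℕ (sym (ℕ.m∸n+n≡m d≤n))) (fromℕ-+ (n ℕ.∸ d) d)) (÷-*-cancel d n 1≤n) ⟩
      fromℕ (n ℕ.∸ d) + fromℕ d - fromℕ d          ≡⟨ lem′ (fromℕ (n ℕ.∸ d)) (fromℕ d) ⟩
      fromℕ (n ℕ.∸ d)                              ∎
      where
      lem : ∀ y n → (1ℚ - y) * n ≡ n - y * n
      lem = solve 2 (λ y n → (con 1ℚ :- y) :* n := n :- y :* n) refl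
      lem′ : ∀ a b → a + b - b ≡ a
      lem′ = solve 2 (λ a b → a :+ b :- b := a) refl

    0≤x : 0ℚ ≤ x
    0≤x = *-cancelʳ-≤-pos (fromℕ n) {{positive (0<fromℕ 1≤n)}} (≤-trans (≤-reflexive (*-zeroˡ (fromℕ n))) (≤-trans (0≤fromℕ (n ℕ.∸ d)) (≤-reflexive (sym xn≡n-d))))

    nx^m*n^m : fromℕ n * x ^ m * fromℕ (n ℕ.^ m) ≡ fromℕ (n ℕ.* (n ℕ.∸ d) ℕ.^ m)
    nx^m*n^m = begin-equality
      fromℕ n * x ^ m * fromℕ (n ℕ.^ m)            ≡⟨ cong (fromℕ n * x ^ m *_) (fromℕ-^ n m) ⟩
      fromℕ n * x ^ m * fromℕ n ^ m                ≡⟨ *-assoc (fromℕ n) (x ^ m) (fromℕ n ^ m) ⟩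
      fromℕ n * (x ^ m * fromℕ n ^ m)              ≡⟨ cong (fromℕ n *_) (^-distribʳ-* x (fromℕ n) m) ⟨
      fromℕ n * (x * fromℕ n) ^ m                  ≡⟨ cong (λ z → fromℕ n * z ^ m) xn≡n-d ⟩
      fromℕ n * fromℕ (n ℕ.∸ d) ^ m                ≡⟨ cong (fromℕ n *_) (fromℕ-^ (n ℕ.∸ d) m) ⟨
      fromℕ n * fromℕ ((n ℕ.∸ d) ℕ.^ m)            ≡⟨ fromℕ-* n ((n ℕ.∸ d) ℕ.^ m) ⟨
      fromℕ (n ℕ.* (n ℕ.∸ d) ℕ.^ m)                ∎

    -- An exponent above `K` forces `n x^m ≥ K` by `Exp≤⇒≤`; multiplying by `n^m` turns
    -- `x = 1 - d/n` into `n - d`. The companion `sparse` uses `Exp≥⇒≤` in the same way.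
    dense : ∀ K → 1 ℕ.≤ K → lower (log (fromℕ n) +ᶜ m ·ᶜ log x) (fromℕ K) → K ℕ.* n ℕ.^ m ℕ.≤ n ℕ.* (n ℕ.∸ d) ℕ.^ m
    dense K 1≤K (a , b , la , lb , K≡a+b) = fromℕ-cancel-≤ (begin
      fromℕ (K ℕ.* n ℕ.^ m)                        ≡⟨ fromℕ-* K (n ℕ.^ m) ⟩
      fromℕ K * fromℕ (n ℕ.^ m)                    ≤⟨ *-monoʳ-≤ (0≤fromℕ (n ℕ.^ m)) K≤nx^m ⟩
      fromℕ n * x ^ m * fromℕ (n ℕ.^ m)            ≡⟨ nx^m*n^m ⟩
      fromℕ (n ℕ.* (n ℕ.∸ d) ℕ.^ m)                ∎)
      where
      K≤nx^m : fromℕ K ≤ fromℕ n * x ^ m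
      K≤nx^m = Exp≤⇒≤ (fromℕ-mono-≤ 1≤K) (subst (λ q → Exp≤ q (fromℕ n * x ^ m)) (sym K≡a+b)
        (Exp≤-* {a} {b} (eventually-≤-log {q = a} la) (Exp≤-·log m {b} lb)))

    sparse : ∀ K → 1 ℕ.≤ K → upper (log (fromℕ n) +ᶜ m ·ᶜ log x) (- fromℕ K) → K ℕ.* n ℕ.* (n ℕ.∸ d) ℕ.^ m ℕ.≤ n ℕ.^ m
    sparse K 1≤K (a , b , ua , ub , K≡a+b) = fromℕ-cancel-≤ (begin
      fromℕ (K ℕ.* n ℕ.* (n ℕ.∸ d) ℕ.^ m)          ≡⟨ cong fromℕ (ℕ.*-assoc K n ((n ℕ.∸ d) ℕ.^ m)) ⟩
      fromℕ (K ℕ.* (n ℕ.* (n ℕ.∸ d) ℕ.^ m))        ≡⟨ fromℕ-* K (n ℕ.* (n ℕ.∸ d) ℕ.^ m) ⟩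
      fromℕ K * fromℕ (n ℕ.* (n ℕ.∸ d) ℕ.^ m)      ≡⟨ cong (fromℕ K *_) nx^m*n^m ⟨
      fromℕ K * (fromℕ n * x ^ m * fromℕ (n ℕ.^ m)) ≡⟨ *-assoc (fromℕ K) (fromℕ n * x ^ m) (fromℕ (n ℕ.^ m)) ⟨
      fromℕ K * (fromℕ n * x ^ m) * fromℕ (n ℕ.^ m) ≤⟨ *-monoʳ-≤ (0≤fromℕ (n ℕ.^ m)) Knx^m≤1 ⟩
      1ℚ * fromℕ (n ℕ.^ m)                         ≡⟨ *-identityˡ (fromℕ (n ℕ.^ m)) ⟩
      fromℕ (n ℕ.^ m)                              ∎)
      where
      Knx^m≤1 : fromℕ K * (fromℕ n * x ^ m) ≤ 1ℚ
      Knx^m≤1 = Exp≥⇒≤ (fromℕ-mono-≤ 1≤K) (0≤p*q (0≤fromℕ n) (0≤x^n 0≤x m))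
        (subst (λ q → Exp≥ q (fromℕ n * x ^ m)) (sym K≡a+b)
          (Exp≥-* {a} {b} (0≤fromℕ n) (0≤x^n 0≤x m) (eventually-≥-log {q = a} ua) (Exp≥-·log 0≤x m {b} ub)))

  -- Probabilities as quotients and the two limits

  0≤÷ : ∀ a b → 0ℚ ≤ a ÷ b
  0≤÷ a zero      = ≤-refl
  0≤÷ a b@(suc _) = *-cancelʳ-≤-pos (fromℕ b) {{positive (0<fromℕ {b} (s≤s z≤n))}}
    (≤-trans (≤-reflexive (*-zeroˡ (fromℕ b))) (≤-trans (0≤fromℕ a) (≤-reflexive (sym (÷-*-cancel a b (s≤s z≤n))))))

  reciprocal : ∀ ε → 0ℚ < ε → ∃ λ g-1 → 1ℚ < ε * fromℕ (suc g-1)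
  reciprocal ε 0<ε = k , (begin-strict
    1ℚ                    ≡⟨ *-inverseʳ ε ⟨
    ε * (1/ ε)            ≤⟨ *-monoˡ-≤ (<⇒≤ 0<ε) (proj₂ (archimedean (1/ ε))) ⟩
    ε * fromℕ k           <⟨ *-monoʳ-<-pos ε (fromℕ-mono-< (ℕ.n<1+n k)) ⟩
    ε * fromℕ (suc k)     ∎)
    where
    instance
      _ = positive 0<ε
      _ = pos⇒nonZero ε
    k = proj₁ (archimedean (1/ ε))

  ÷<ε : ∀ Z T g ε → 1 ℕ.≤ T → 1ℚ < ε * fromℕ g → g ℕ.* Z ℕ.≤ T → Z ÷ T < 0ℚ + ε
  ÷<ε Z T g ε 1≤T 1<εg gZ≤T = <-≤-trans Z÷T<ε (≤-reflexive (sym (+-identityˡ ε)))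
    where
    instance
      _ = nonNegative (0≤fromℕ g)
      _ = positive (0<fromℕ 1≤T)
    lem : ∀ p g t → p * g * t ≡ g * (p * t)
    lem = solve 3 (λ p g t → p :* g :* t := g :* (p :* t)) refl
    Z÷T<ε : Z ÷ T < ε
    Z÷T<ε = *-cancelʳ-<-nonNeg (fromℕ g) (≤-<-trans (*-cancelʳ-≤-pos (fromℕ T) (begin
      Z ÷ T * fromℕ g * fromℕ T       ≡⟨ lem (Z ÷ T) (fromℕ g) (fromℕ T) ⟩
      fromℕ g * (Z ÷ T * fromℕ T)     ≡⟨ cong (fromℕ g *_) (÷-*-cancel Z T 1≤T) ⟩
      fromℕ g * fromℕ Z               ≡⟨ fromℕ-* g Z ⟨
      fromℕ (g ℕ.* Z)                 ≤⟨ fromℕ-mono-≤ gZ≤T ⟩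
      fromℕ T                         ≡⟨ *-identityˡ (fromℕ T) ⟨
      1ℚ * fromℕ T                    ∎)) 1<εg)

  1-ε<÷ : ∀ Z T g ε → 1 ℕ.≤ T → 1ℚ < ε * fromℕ g → g ℕ.* T ℕ.≤ g ℕ.* Z ℕ.+ T → 1ℚ - ε < Z ÷ T
  1-ε<÷ Z T g ε 1≤T 1<εg gT≤gZ+T = *-cancelʳ-<-nonNeg (fromℕ g) (begin-strict
    (1ℚ - ε) * fromℕ g                          ≡⟨ lem₁ ε (fromℕ g) ⟩
    fromℕ g - ε * fromℕ g                       <⟨ +-monoʳ-< (fromℕ g) (neg-antimono-< 1<εg) ⟩
    fromℕ g - 1ℚ                                ≤⟨ +-monoˡ-≤ (- 1ℚ) scaled ⟩
    Z ÷ T * fromℕ g + 1ℚ - 1ℚ                   ≡⟨ lem₂ (Z ÷ T * fromℕ g) ⟩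
    Z ÷ T * fromℕ g                             ∎)
    where
    instance
      _ = nonNegative (0≤fromℕ g)
      _ = positive (0<fromℕ 1≤T)
    lem₁ : ∀ e g → (1ℚ - e) * g ≡ g - e * g
    lem₁ = solve 2 (λ e g → (con 1ℚ :- e) :* g := g :- e :* g) refl
    lem₂ : ∀ a → a + 1ℚ - 1ℚ ≡ a
    lem₂ = solve 1 (λ a → a :+ con 1ℚ :- con 1ℚ := a) refl
    lem₃ : ∀ p g t → g * (p * t) + t ≡ (p * g + 1ℚ) * t
    lem₃ = solve 3 (λ p g t → g :* (p :* t) :+ t := (p :* g :+ con 1ℚ) :* t) refl
    scaled : fromℕ g ≤ Z ÷ T * fromℕ g + 1ℚ
    scaled = *-cancelʳ-≤-pos (fromℕ T) (begin
      fromℕ g * fromℕ T                         ≡⟨ fromℕ-* g T ⟨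
      fromℕ (g ℕ.* T)                           ≤⟨ fromℕ-mono-≤ gT≤gZ+T ⟩
      fromℕ (g ℕ.* Z ℕ.+ T)                     ≡⟨ fromℕ-+ (g ℕ.* Z) T ⟩
      fromℕ (g ℕ.* Z) + fromℕ T                 ≡⟨ cong (_+ fromℕ T) (fromℕ-* g Z) ⟩
      fromℕ g * fromℕ Z + fromℕ T               ≡⟨ cong (λ z → fromℕ g * z + fromℕ T) (÷-*-cancel Z T 1≤T) ⟨
      fromℕ g * (Z ÷ T * fromℕ T) + fromℕ T     ≡⟨ lem₃ (Z ÷ T) (fromℕ g) (fromℕ T) ⟩
      (Z ÷ T * fromℕ g + 1ℚ) * fromℕ T          ∎)

  ÷≤1 : ∀ Z T → 1 ℕ.≤ T → Z ℕ.≤ T → Z ÷ T ≤ 1ℚ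
  ÷≤1 Z T 1≤T Z≤T = *-cancelʳ-≤-pos (fromℕ T) {{positive (0<fromℕ 1≤T)}} (begin
    Z ÷ T * fromℕ T     ≡⟨ ÷-*-cancel Z T 1≤T ⟩
    fromℕ Z             ≤⟨ fromℕ-mono-≤ Z≤T ⟩
    fromℕ T             ≡⟨ *-identityˡ (fromℕ T) ⟨
    1ℚ * fromℕ T        ∎)

  0-ε<p : ∀ {p} ε → 0ℚ < ε → 0ℚ ≤ p → 0ℚ - ε < p
  0-ε<p ε 0<ε 0≤p = <-≤-trans (<-≤-trans (+-monoʳ-< 0ℚ (neg-antimono-< 0<ε)) (≤-reflexive (+-identityʳ 0ℚ))) 0≤p

  ℙ-connected≡ : ∀ n m d → 1 ℕ.≤ d → ℙ-connected n m d ≡ #connected n m d ÷ ((n C d) C m)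
  ℙ-connected≡ n m d 1≤d = cong (#connected n m d ÷_) (length-hypergraphs n m d 1≤d)

  module _ (m d : ℕ → ℕ)
    (1≤m : ∀ n → 2 ℕ.≤ n → 1 ℕ.≤ m n)
    (bounds : ∀ n → 2 ℕ.≤ n → 2 ℕ.≤ d n × d n ℕ.≤ n)
    (m≪√ : (λ n → fromℚ (fromℕ (m n))) ≪ (λ n → √ (fromℕ (n C d n)))) where

    exponent : ℕ → Cut
    exponent n = log (fromℕ n) +ᶜ m n ·ᶜ log (1ℚ - d n ÷ n)

    T : ℕ → ℕ
    T n = (n C d n) C m n

    m²≤N : Eventually λ n → 2 ℕ.≤ n × 16 ℕ.* (m n ℕ.* m n) ℕ.≤ n C d n
    m²≤N = from 2 ⊓ᵉ ≪-√⇒ m (λ n → n C d n) m≪√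

    -- From `m ≤ 16 m² ≤ N`, hypergraphs of the prescribed shape exist, so `ℙ` is a genuine quotient
    -- and not the default value 0.
    1≤T : ∀ n → 16 ℕ.* (m n ℕ.* m n) ℕ.≤ n C d n → 1 ℕ.≤ T n
    1≤T n le = C≢0 (ℕ.≤-trans (m≤16*m² (m n)) le)

    below-threshold : exponent ⟶+∞ → (λ n → fromℚ (ℙ-connected n (m n) (d n))) ⟶ 0ℚ
    below-threshold h ε 0<ε = mapᵉ bound (m²≤N ⊓ᵉ h (fromℕ K))
      where
      g = suc (proj₁ (reciprocal ε 0<ε))
      -- The 8 meets the requirement of `rarely-connected`, and `2 * g` turns its conclusion
      -- `K Z ≤ 2 T` into `g Z ≤ T`.
      K = 8 ℕ.+ 2 ℕ.* g
      bound : ∀ n → (2 ℕ.≤ n × 16 ℕ.* (m n ℕ.* m n) ℕ.≤ n C d n) × lower (exponent n) (fromℕ K) →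
        0ℚ - ε < ℙ-connected n (m n) (d n) × ℙ-connected n (m n) (d n) < 0ℚ + ε
      bound n ((2≤n , m²≤) , low) = subst (λ p → 0ℚ - ε < p × p < 0ℚ + ε) (sym (ℙ-connected≡ n (m n) (d n) 1≤d))
        (0-ε<p ε 0<ε (0≤÷ Z (T n)) , ÷<ε Z (T n) g ε (1≤T n m²≤) (proj₂ (reciprocal ε 0<ε)) gZ≤T)
        where
        Z = #connected n (m n) (d n)
        1≤n = ℕ.<⇒≤ 2≤n
        1≤d = ℕ.<⇒≤ (proj₁ (bounds n 2≤n))
        d≤n = proj₂ (bounds n 2≤n)
        KZ≤2T : K ℕ.* Z ℕ.≤ 2 ℕ.* T n
        KZ≤2T = rarely-connected n (m n) (d n) K 2≤n (1≤m n 2≤n) 1≤d d≤n (ℕ.m≤m+n 8 (2 ℕ.* g)) m²≤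
          (Threshold.dense n (m n) (d n) 1≤n d≤n K (s≤s z≤n) low)
        gZ≤T : g ℕ.* Z ℕ.≤ T n
        gZ≤T = ℕ.*-cancelˡ-≤ 2 (ℕ.≤-trans (ℕ.≤-trans (ℕ.≤-reflexive (sym (ℕ.*-assoc 2 g Z))) (ℕ.*-monoˡ-≤ Z (ℕ.m≤n+m (2 ℕ.* g) 8))) KZ≤2T)

    above-threshold : exponent ⟶-∞ → (λ n → fromℚ (ℙ-connected n (m n) (d n))) ⟶ 1ℚ
    above-threshold h ε 0<ε = mapᵉ bound (m²≤N ⊓ᵉ h (- fromℕ K))
      where
      g-1 = proj₁ (reciprocal ε 0<ε)
      g = suc g-1
      -- This is `c²` for `c = 4 * B` and `B = 2 * g`, so that an exponent below `-K` yields
      -- `c² n q ≤ 1`.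
      K = 4 ℕ.* (2 ℕ.* g) ℕ.* (4 ℕ.* (2 ℕ.* g))
      bound : ∀ n → (2 ℕ.≤ n × 16 ℕ.* (m n ℕ.* m n) ℕ.≤ n C d n) × upper (exponent n) (- fromℕ K) →
        1ℚ - ε < ℙ-connected n (m n) (d n) × ℙ-connected n (m n) (d n) < 1ℚ + ε
      bound n ((2≤n , m²≤) , up) = subst (λ p → 1ℚ - ε < p × p < 1ℚ + ε) (sym (ℙ-connected≡ n (m n) (d n) 1≤d))
        ( 1-ε<÷ Z (T n) g ε (1≤T n m²≤) (proj₂ (reciprocal ε 0<ε))
            (UnionBound.mostly-connected n (m n) (d n) 2≤d d≤n g-1 (Threshold.sparse n (m n) (d n) 1≤n d≤n K (s≤s z≤n) up))
        , ≤-<-trans (÷≤1 Z (T n) (1≤T n m²≤) Z≤T) (p<p+q 1ℚ 0<ε))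
        where
        Z = #connected n (m n) (d n)
        1≤n = ℕ.<⇒≤ 2≤n
        2≤d = proj₁ (bounds n 2≤n)
        1≤d = ℕ.<⇒≤ 2≤d
        d≤n = proj₂ (bounds n 2≤n)
        Z≤T : Z ℕ.≤ T n
        Z≤T = ℕ.≤-trans (length-filter connected? (hypergraphs n (m n) (d n))) (ℕ.≤-reflexive (length-hypergraphs n (m n) (d n) 1≤d))

open import Defs
open import Data.Nat.Base using (ℕ; _≤_)
open import Data.Nat.Combinatorics using (_C_)
open import Data.Product.Base using (_×_; _,_)
open import Data.Rational.Base using (ℚ; 0ℚ; 1ℚ; _-_)

mainTheorem2 : (m d : ℕ → ℕ) →
    (∀ n → 2 ≤ n → 1 ≤ m n) →
    (∀ n → 2 ≤ n → 2 ≤ d n × d n ≤ n) →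
    (λ n → fromℚ (fromℕ (m n))) ≪ (λ n → √ (fromℕ (n C d n))) →
    ((λ n → log (fromℕ n) +ᶜ m n ·ᶜ log (1ℚ - d n ÷ n)) ⟶+∞ →
    (λ n → fromℚ (ℙ-connected n (m n) (d n))) ⟶ 0ℚ)
    ×
    ((λ n → log (fromℕ n) +ᶜ m n ·ᶜ log (1ℚ - d n ÷ n)) ⟶-∞ →
    (λ n → fromℚ (ℙ-connected n (m n) (d n))) ⟶ 1ℚ)
mainTheorem2 m d 1≤m bounds m≪√N =
  Asymptotic.below-threshold m d 1≤m bounds m≪√N , Asymptotic.above-threshold m d 1≤m bounds m≪√N
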